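{- Let $T^a$ be the tree with vertex set $\{1,2,3,4,5,6,7\}$ and edge set $\{12,13,24,25,36,37\}$. Then $\mathrm{sp}^*(T^a,E(T^a))=4$, and for every tree $T\neq T^a$, \[ \mathrm{sp}^*(T,E(T)) = \max\left\{ \left\lceil \frac{2h_1(T)+h_2(T)}{3}\right\rceil, \left\lceil \frac{h_1(T)+h_2(T)}{2}\right\rceil \right\}. \]
   Context: All graphs are finite, simple and undirected. A path in a graph $G$ is a sequence of distinct vertices $v_0v_1\dots v_l$ ($l\ge 0$) with $v_{i-1}v_i\in E(G)$ for all $i$; it contains the vertices $v_0,\dots,v_l$ and the edges $v_{i-1}v_i$. For $S\subseteq V(G)\cup E(G)$ and a family $\mathcal F$ of paths in $G$, let $\mathcal F(s)$ be the set of paths of $\mathcal F$ containing $s$. $\mathcal F$ separates $S$ if $\mathcal F(s)\neq\mathcal F(t)$ for all distinct $s,t\in S$, and covers $S$ if $\mathcal F(s)\neq\emptyset$ for all $s\in S$. $\mathrm{sp}^*(G,S)$ denotes the minimum size of a family of paths in $G$ that both separates and covers $S$. For a tree $T$, $h_1(T)$ is the number of leaves (degree-1 vertices) and $h_2(T)$ the number of vertices of degree $2$.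
   Formalization: The tree with two vertices (a single edge) is excluded, since there sp* = 1 while the formula gives 2; "T ≠ T^a" is read as "T not isomorphic to T^a". -}

module Defs where

open import Data.Nat using (ℕ; zero; suc; _+_; _*_; _∸_; _≤_; _≡ᵇ_; _⊔_)
open import Data.Nat.DivMod using (_/_)
open import Data.Bool using (Bool; true; false; _∨_; if_then_else_)
open import Data.Bool.Properties using (∨-comm)
open import Data.Fin using (Fin; toℕ; _<_) renaming (zero to fz; suc to fs)
open import Data.List using (List; []; _∷_; _++_; length; map; allFin)
open import Data.Nat.ListAction using (sum)
open import Data.List.Relation.Unary.Unique.Propositional using (Unique)
open import Data.List.Membership.Propositional using (_∈_)
open import Data.Product using (Σ; ∃; ∃-syntax; _×_; _,_)
open import Data.Sum using (_⊎_)
open import Data.Unit using (⊤)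
open import Data.Empty using (⊥)
open import Relation.Nullary using (¬_)
open import Relation.Binary.PropositionalEquality using (_≡_; refl)
open import Function.Bundles using (_↔_; Inverse; _⇔_)

record Graph (n : ℕ) : Set where
  field
    adj    : Fin n → Fin n → Bool
    sym    : ∀ u v → adj u v ≡ adj v u
    irrefl : ∀ v → adj v v ≡ false
open Graph public

module _ {n : ℕ} (G : Graph n) where

  IsWalk : List (Fin n) → Set
  IsWalk []            = ⊥
  IsWalk (x ∷ [])      = ⊤
  IsWalk (x ∷ y ∷ r)   = (adj G x y ≡ true) × IsWalk (y ∷ r)

  record Path : Set where
    constructor mkPath
    field
      verts    : List (Fin n)
      distinct : Unique verts
      walk     : IsWalk verts

  record Edge : Set where
    constructor mkEdge
    field
      eu  : Fin n
      ev  : Fin n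
      ord : eu < ev
      isE : adj G eu ev ≡ true

  SameEdge : Edge → Edge → Set
  SameEdge e f = (Edge.eu e ≡ Edge.eu f) × (Edge.ev e ≡ Edge.ev f)

  ContainsE : List (Fin n) → Fin n → Fin n → Set
  ContainsE (x ∷ y ∷ r) a b = ((x ≡ a × y ≡ b) ⊎ (x ≡ b × y ≡ a)) ⊎ ContainsE (y ∷ r) a b
  ContainsE _ a b = ⊥

  PathContains : Path → Edge → Set
  PathContains P e = ContainsE (Path.verts P) (Edge.eu e) (Edge.ev e)

  SeparatesE : List Path → Set
  SeparatesE F = ∀ e f → ¬ SameEdge e f →
    ¬ (∀ P → P ∈ F → (PathContains P e ⇔ PathContains P f))

  CoversE : List Path → Set
  CoversE F = ∀ e → ∃[ P ] (P ∈ F × PathContains P e)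

  SpStarE≡ : ℕ → Set
  SpStarE≡ k = (∃[ F ] (SeparatesE F × CoversE F × length F ≡ k))
             × (∀ F → SeparatesE F → CoversE F → k ≤ length F)

  data Walk : Fin n → Fin n → Set where
    here : ∀ {v} → Walk v v
    step : ∀ {u w v} → adj G u w ≡ true → Walk w v → Walk u v

  Connected : Set
  Connected = ∀ u v → Walk u v

  HasCycle : Set
  HasCycle = ∃[ x ] ∃[ ys ] (Unique (x ∷ ys) × (2 ≤ length ys) × IsWalk (x ∷ ys ++ x ∷ []))

  IsTree : Set
  IsTree = Connected × ¬ HasCycle

  deg : Fin n → ℕ
  deg v = sum (map (λ u → if adj G v u then 1 else 0) (allFin n))

  h : ℕ → ℕ
  h d = sum (map (λ v → if deg v ≡ᵇ d then 1 else 0) (allFin n))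

  h₁ h₂ : ℕ
  h₁ = h 1
  h₂ = h 2

⌈_/_⌉ : ℕ → (b : ℕ) → ℕ
⌈ a / b ⌉ with b
... | zero  = 0
... | suc c = (a + c) / suc c

_≅_ : ∀ {n m} → Graph n → Graph m → Set
_≅_ {n} {m} G H = Σ (Fin n ↔ Fin m) λ φ →
  ∀ u v → adj G u v ≡ adj H (Inverse.to φ u) (Inverse.to φ v)

-- T^a: vertices 1..7 are Fin 7 elements 0..6; edges 12,13,24,25,36,37
edgeA : ℕ → ℕ → Bool
edgeA 0 1 = true
edgeA 0 2 = true
edgeA 1 3 = true
edgeA 1 4 = true
edgeA 2 5 = true
edgeA 2 6 = true
edgeA _ _ = false

adjA : Fin 7 → Fin 7 → Bool
adjA u v = edgeA (toℕ u) (toℕ v) ∨ edgeA (toℕ v) (toℕ u)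

private
  irreflA : ∀ v → adjA v v ≡ false
  irreflA fz = refl
  irreflA (fs fz) = refl
  irreflA (fs (fs fz)) = refl
  irreflA (fs (fs (fs fz))) = refl
  irreflA (fs (fs (fs (fs fz)))) = refl
  irreflA (fs (fs (fs (fs (fs fz))))) = refl
  irreflA (fs (fs (fs (fs (fs (fs fz)))))) = refl

Ta : Graph 7
Ta = record
  { adj = adjA
  ; sym = λ u v → ∨-comm (edgeA (toℕ u) (toℕ v)) (edgeA (toℕ v) (toℕ u))
  ; irrefl = irreflA
  }

spFormula : ∀ {n} → Graph n → ℕ
spFormula T = ⌈ 2 * h₁ T + h₂ T / 3 ⌉ ⊔ ⌈ h₁ T + h₂ T / 2 ⌉

{-# OPTIONS --safe #-}
module Submission where

-- Root the tree at a leaf.  A path is a chord joining its two ends, and it contains the edge above x iff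
-- it has exactly one end among the descendants S x of x.  So a family of paths separates and covers the
-- edges iff no symmetric difference of two distinct sets S x, S y (S root := ∅) is a union of components
-- of the chord graph.
--
-- Lower bounds: every leaf and every degree-2 vertex is an end of a path, and a leaf that is an end only
-- once owns a path which no other leaf can own.
--
-- Upper bound: it suffices to separate the traces of the sets S x on the leaves N (without the root) and
-- the degree-2 vertices D.  While D ≠ ∅ and there are at least as many leaves, one removes a leaf l and
-- some v ∈ D at the cost of one chord: either l v itself, or, if v is the only degree-2 vertex having
-- just l below it, by rerouting a chord through l and v.  Forbidden pairs are those cut out by two edges,
-- and laminarity of the sets S x leaves a permitted pair unless the tree is Tᵃ or tiny.  When D = ∅ the
-- leaves, in depth-first order ℓ₀, …, ℓ_{3q-1}, are grouped as {ℓ_k, ℓ_{k+q}, ℓ_{k+2q}}.  If D is larger than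
-- the number of leaves, pairs of degree-2 vertices are joined first.

-- The 3 is a budget. A leaf weighs 2 and a degree-2 vertex 1, so a chord bought by removing one of
-- each is paid for exactly, and so are two chords joining three leaves; the only slack is the 2
-- gained by rounding up. No reduction may therefore waste a chord, and this is why forbidden pairs
-- have to be classified instead of being bypassed with an extra path. A removal must also leave
-- some leaf below every remaining degree-2 vertex. It fails to do so exactly for the vertices that
-- have just the removed leaf below them, which is the origin of the rerouting. The induction must
-- never enter the position of Tᵃ, where the formula gives 3 but four paths are needed. It can be
-- entered only from four leaves besides the root and two degree-2 vertices, so there the removed
-- pair is chosen by a separate case analysis. Two degree-2 vertices weigh too little in the first
-- budget to pay for a chord, but pay exactly in the second, where every vertex counts 1 and a chord
-- costs 2. Both budgets allow the same number of chords when there are as many degree-2 vertices as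
-- leaves, and there the pairing hands over to the reduction.

open import Defs hiding (sym)
open import Data.Nat using (ℕ; zero; suc; _+_; _*_; _∸_; _≤_; _<_; z≤n; s≤s; _⊔_; _≡ᵇ_)
import Data.Nat.Properties as ℕ
open import Data.Nat.DivMod as DivMod using (_/_)
open import Data.Nat.ListAction using (sum)
open import Data.Nat.Tactic.RingSolver using (solve-∀)
open import Data.Bool using (Bool; T; true; false; if_then_else_; _∧_; _∨_; _xor_; not)
import Data.Bool.Properties as Bool
open import Data.Fin using (Fin; toℕ) renaming (zero to fz; suc to fs)
open import Data.Fin.Properties using (_≟_; any?; all?)
import Data.Fin.Properties as Fin
open import Data.Bool.ListAction using (any; all)
open import Data.Vec using (Vec; lookup; tabulate)
open import Data.Vec.Properties using (lookup∘tabulate)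
open import Data.List.Relation.Unary.Unique.DecPropositional using (unique?)
open import Data.List using (List; concatMap; []; _∷_; _++_; length; map; filter; allFin; upTo)
import Data.List.Properties as List
open import Data.List.Membership.Propositional using (_∈_; _∉_; find; lose)
open import Data.List.Membership.Propositional.Properties
open import Data.List.Relation.Unary.Any using (here; there)
import Data.List.Relation.Unary.Any as Any
open import Data.List.Relation.Unary.Any.Properties using (any⁻)
open import Data.List.Relation.Unary.All using (All; []; _∷_)
import Data.List.Relation.Unary.All as All
import Data.List.Relation.Unary.All.Properties as All
open import Data.List.Relation.Unary.AllPairs using (AllPairs; []; _∷_)
open import Data.List.Relation.Unary.Linked.Properties using (Linked⇒AllPairs)
open import Data.List.Relation.Binary.Permutation.Propositional using (↭-sym)
open import Data.List.Relation.Binary.Permutation.Propositional.Properties using (∈-resp-↭; ↭-length)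
import Relation.Binary.Construct.On as On
open import Data.List.Relation.Unary.Unique.Propositional using (Unique)
import Data.List.Relation.Unary.Unique.Propositional.Properties as Unique
open import Data.Product using (Σ; ∃; ∃-syntax; ∃₂; _×_; _,_; proj₁; proj₂)
open import Data.Sum using (_⊎_; inj₁; inj₂; [_,_]′)
open import Data.Empty using (⊥; ⊥-elim)
open import Data.Unit using (tt)
open import Function using (_∘_; id; case_of_)
open import Function.Bundles using (mk↔ₛ′; _⇔_; mk⇔; Equivalence)
open import Relation.Nullary using (¬_; Dec; yes; no; does)
open import Relation.Nullary.Decidable using (_×-dec_; _⊎-dec_; _→-dec_; ¬?; dec-true; dec-false; decidable-stable; from-yes)
open import Relation.Binary.Definitions using (tri<; tri≈; tri>)
open import Relation.Binary.PropositionalEquality hiding ([_])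

-- Counting in lists

-- Has the shape of `deg` and `h`, so that the bounds below apply to both without conversion.
count : {A : Set} → (A → Bool) → List A → ℕ
count f xs = sum (map (λ x → if f x then 1 else 0) xs)

record Removal {A : Set} (x : A) (xs ys : List A) : Set where
  field
    sub    : ∀ {y} → y ∈ ys → y ∈ xs
    fresh  : ∀ {y} → y ∈ ys → y ≢ x
    cover  : ∀ {y} → y ∈ xs → y ≡ x ⊎ y ∈ ys
    unique : Unique ys
    size   : length xs ≡ suc (length ys)

  keep : ∀ {y} → y ∈ xs → y ≢ x → y ∈ ys
  keep y∈ y≢ with cover y∈
  ... | inj₁ e = ⊥-elim (y≢ e)
  ... | inj₂ i = i

remove : ∀ {A : Set} {x : A} {xs} → Unique xs → x ∈ xs → ∃ (Removal x xs)
remove {xs = x ∷ xs} (x∉ ∷ u) (here refl) = xs , record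
  { sub = there ; fresh = λ i e → All.lookup x∉ i (sym e)
  ; cover = λ { (here e) → inj₁ e ; (there i) → inj₂ i } ; unique = u ; size = refl }
remove {x = x} {xs = y ∷ xs} (y∉ ∷ u) (there i) with remove u i
... | ys , R = y ∷ ys , record
  { sub = λ { (here e) → here e ; (there j) → there (R.sub j) }
  ; fresh = λ { (here refl) e → All.lookup y∉ i e ; (there j) → R.fresh j }
  ; cover = λ { (here e) → inj₂ (here e)
              ; (there j) → [ inj₁ , inj₂ ∘ there ]′ (R.cover j) }
  ; unique = All.tabulate (λ j → All.lookup y∉ (R.sub j)) ∷ R.unique
  ; size = cong suc R.size }
  where module R = Removal R

unique-⊆-length : ∀ {A : Set} {xs ys : List A} → Unique xs → Unique ys →
  (∀ {x} → x ∈ xs → x ∈ ys) → length xs ≤ length ys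
unique-⊆-length {xs = []} _ _ _ = z≤n
unique-⊆-length {xs = x ∷ xs} (x∉ ∷ u) w ⊆ with remove w (⊆ (here refl))
... | zs , R = subst (suc (length xs) ≤_) (sym (Removal.size R))
  (s≤s (unique-⊆-length u (Removal.unique R)
    (λ i → Removal.keep R (⊆ (there i)) (λ e → All.lookup x∉ i (sym e)))))

module _ {A : Set} where

  count-filter : (f : A → Bool) (xs : List A) →
    count f xs ≡ length (filter (λ x → f x Bool.≟ true) xs)
  count-filter f [] = refl
  count-filter f (x ∷ xs) with f x
  ... | true  = cong suc (count-filter f xs)
  ... | false = count-filter f xs

  count-≥ : ∀ {f : A → Bool} {xs ys} → Unique xs → Unique ys →
    (∀ {y} → y ∈ ys → y ∈ xs × f y ≡ true) → length ys ≤ count f xs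
  count-≥ {f} {xs} u w h = subst (_ ≤_) (sym (count-filter f xs)) (unique-⊆-length w
    (Unique.filter⁺ (λ x → f x Bool.≟ true) u) λ y∈ → let x∈ , e = h y∈ in ∈-filter⁺ (λ x → f x Bool.≟ true) x∈ e)

  count-≤ : ∀ {f : A → Bool} {xs ys} → Unique xs → Unique ys →
    (∀ {x} → x ∈ xs → f x ≡ true → x ∈ ys) → count f xs ≤ length ys
  count-≤ {f} {xs} u w h = subst (_≤ _) (sym (count-filter f xs)) (unique-⊆-length
    (Unique.filter⁺ (λ x → f x Bool.≟ true) u) w λ x∈ →
      let i , e = ∈-filter⁻ (λ x → f x Bool.≟ true) x∈ in h i e)

  count-pos : ∀ {f : A → Bool} {x xs} → x ∈ xs → f x ≡ true → 1 ≤ count f xs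
  count-pos {xs = y ∷ xs} (here refl) e rewrite e = s≤s z≤n
  count-pos {xs = y ∷ xs} (there i) e = ℕ.≤-trans (count-pos i e) (ℕ.m≤n+m _ _)

  count-two : ∀ {f : A → Bool} {x y xs} → x ∈ xs → y ∈ xs → x ≢ y →
    f x ≡ true → f y ≡ true → 2 ≤ count f xs
  count-two (here refl) (here refl) ne _ _ = ⊥-elim (ne refl)
  count-two (here refl) (there j) ne e e′ rewrite e = s≤s (count-pos j e′)
  count-two (there i) (here refl) ne e e′ rewrite e′ = s≤s (count-pos i e)
  count-two {xs = z ∷ _} (there i) (there j) ne e e′ =
    ℕ.≤-trans (count-two i j ne e e′) (ℕ.m≤n+m _ _)

  count-none : ∀ {f : A → Bool} xs → (∀ {x} → x ∈ xs → f x ≡ false) → count f xs ≡ 0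
  count-none [] h = refl
  count-none (x ∷ xs) h rewrite h (here refl) = count-none xs (h ∘ there)

  count-≤1 : ∀ {f : A → Bool} {xs} → Unique xs →
    (∀ {x y} → x ∈ xs → y ∈ xs → f x ≡ true → f y ≡ true → x ≡ y) → count f xs ≤ 1
  count-≤1 [] h = z≤n
  count-≤1 {f} {x ∷ xs} (x∉ ∷ u) h with f x in e
  ... | false = count-≤1 u (λ i j → h (there i) (there j))
  ... | true  = s≤s (ℕ.≤-reflexive (count-none xs λ {y} i →
                  Bool.¬-not λ e′ → All.lookup x∉ i (h (here refl) (there i) e e′)))

  sum-mono : ∀ {f g : A → ℕ} xs → (∀ {x} → x ∈ xs → f x ≤ g x) → sum (map f xs) ≤ sum (map g xs)
  sum-mono [] h = z≤n
  sum-mono (x ∷ xs) h = ℕ.+-mono-≤ (h (here refl)) (sum-mono xs (h ∘ there))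

  sum-const : ∀ c (xs : List A) → sum (map (λ _ → c) xs) ≡ length xs * c
  sum-const c [] = refl
  sum-const c (x ∷ xs) = cong (c +_) (sum-const c xs)

  sum-+ : ∀ (f g : A → ℕ) xs → sum (map (λ x → f x + g x) xs) ≡ sum (map f xs) + sum (map g xs)
  sum-+ f g [] = refl
  sum-+ f g (x ∷ xs) rewrite sum-+ f g xs = interchange (f x) (g x) _ _
    where
      interchange : ∀ a b c d → (a + b) + (c + d) ≡ (a + c) + (b + d)
      interchange = solve-∀

sum-swap : ∀ {A B : Set} (g : A → B → ℕ) xs ys →
  sum (map (λ x → sum (map (g x) ys)) xs) ≡ sum (map (λ y → sum (map (λ x → g x y) xs)) ys)
sum-swap g [] ys = sym (trans (sum-const 0 ys) (ℕ.*-zeroʳ (length ys)))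
sum-swap g (x ∷ xs) ys =
  trans (cong (sum (map (g x) ys) +_) (sum-swap g xs ys)) (sym (sum-+ (g x) _ ys))

count-sum-≤ : ∀ {A B : Set} (g : A → B → Bool) {d} xs ys → (∀ {y} → y ∈ ys → count (λ x → g x y) xs ≤ d) →
  sum (map (λ x → count (g x) ys) xs) ≤ length ys * d
count-sum-≤ g {d} xs ys hi = begin
  sum (map (λ x → count (g x) ys) xs)         ≡⟨ sum-swap (λ x y → if g x y then 1 else 0) xs ys ⟩
  sum (map (λ y → count (λ x → g x y) xs) ys) ≤⟨ sum-mono ys hi ⟩
  sum (map (λ _ → d) ys)                      ≡⟨ sum-const d ys ⟩
  length ys * d                               ∎
  where open ℕ.≤-Reasoning

double-count : ∀ {A B : Set} (g : A → B → Bool) {c d} xs ys →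
  (∀ {x} → x ∈ xs → c ≤ count (g x) ys) → (∀ {y} → y ∈ ys → count (λ x → g x y) xs ≤ d) →
  length xs * c ≤ length ys * d
double-count g {c} xs ys lo hi = ℕ.≤-trans (ℕ.≤-reflexive (sym (sum-const c xs)))
  (ℕ.≤-trans (sum-mono xs lo) (count-sum-≤ g xs ys hi))

contra : ∀ {b} → b ≡ true → b ≡ false → ⊥
contra refl ()

last : {A : Set} → A → List A → A
last x []       = x
last x (y ∷ ys) = last y ys

last-∷ʳ : ∀ {A : Set} (x : A) ys {z} → last x (ys ++ z ∷ []) ≡ z
last-∷ʳ x []       = refl
last-∷ʳ x (y ∷ ys) = last-∷ʳ y ys

maximum : ∀ {A : Set} (f : A → ℕ) {x} xs → x ∈ xs → ∃[ m ] (m ∈ xs × (∀ {y} → y ∈ xs → f y ≤ f m))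
maximum f (x ∷ []) _ = x , here refl , λ { (here refl) → ℕ.≤-refl }
maximum f (x ∷ y ∷ xs) _ with maximum f (y ∷ xs) (here refl)
... | m , m∈ , max with f x ℕ.≤? f m
... | yes le = m , there m∈ , λ { (here refl) → le ; (there i) → max i }
... | no gt  = x , here refl , λ { (here refl) → ℕ.≤-refl ; (there i) → ℕ.≤-trans (max i) (ℕ.<⇒≤ (ℕ.≰⇒> gt)) }

≡ᵇ-sound : ∀ a b → (a ≡ᵇ b) ≡ true → a ≡ b
≡ᵇ-sound a b e = ℕ.≡ᵇ⇒≡ a b (subst T (sym e) tt)

≡ᵇ-complete : ∀ a b → a ≡ b → (a ≡ᵇ b) ≡ true
≡ᵇ-complete a b e with a ≡ᵇ b | ℕ.≡⇒≡ᵇ a b e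
... | true | _ = refl

∈⇒nonempty : ∀ {A : Set} {x : A} {xs} → x ∈ xs → 1 ≤ length xs
∈⇒nonempty (here _)  = s≤s z≤n
∈⇒nonempty (there _) = s≤s z≤n

singleton-≡ : ∀ {A : Set} {x y : A} {xs} → length xs ≡ 1 → x ∈ xs → y ∈ xs → x ≡ y
singleton-≡ {xs = _ ∷ []} _ (here refl) (here refl) = refl

-- Rooted trees

-- S x is the set of descendants of x; it stands for the edge joining x to par x.  The index root
-- carries no edge, and S root = ∅ plays the role of an edge contained in no path.
record Rooted {n : ℕ} (G : Graph n) : Set where
  field
    root    : Fin n
    par     : Fin n → Fin n
    rank    : Fin n → ℕ
    S       : Fin n → Fin n → Bool
    S-root  : ∀ y → S root y ≡ false
    root-S  : ∀ x → S x root ≡ false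
    S-rec   : ∀ x {y} → y ≢ root → S x y ≡ does (x ≟ y) ∨ S x (par y)
    rank-<  : ∀ {y} → y ≢ root → rank (par y) < rank y
    par-adj : ∀ {y} → y ≢ root → adj G y (par y) ≡ true
    adj-par : ∀ {u w} → adj G u w ≡ true → (u ≢ root × par u ≡ w) ⊎ (w ≢ root × par w ≡ u)

module Tree {n : ℕ} {G : Graph n} (R : Rooted G) where
  open Rooted R

  rank-induction : (P : Fin n → Set) → P root → (∀ {y} → y ≢ root → P (par y) → P y) → ∀ y → P y
  rank-induction P base up y = go (suc (rank y)) y ℕ.≤-refl
    where
      go : ∀ k y → rank y < k → P y
      go (suc k) y (s≤s le) with y ≟ root
      ... | yes refl = base
      ... | no ne    = up ne (go k (par y) (ℕ.≤-trans (rank-< ne) le))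

  in⇒≢root : ∀ {x y} → S x y ≡ true → x ≢ root × y ≢ root
  in⇒≢root e = (λ { refl → contra e (S-root _) }) , (λ { refl → contra e (root-S _) })

  S-refl : ∀ {x} → x ≢ root → S x x ≡ true
  S-refl {x} ne rewrite S-rec x ne | dec-true (x ≟ x) refl = refl

  S-par : ∀ {x y} → y ≢ root → S x (par y) ≡ true → S x y ≡ true
  S-par {x} {y} ne e rewrite S-rec x ne | e = Bool.∨-zeroʳ _

  S-step : ∀ {x y} → S x y ≡ true → x ≡ y ⊎ S x (par y) ≡ true
  S-step {x} {y} e with x ≟ y in eq
  ... | yes p = inj₁ p
  ... | no ne = inj₂ (trans (sym (trans (S-rec x (proj₂ (in⇒≢root {x} e)))
                                        (cong (λ d → does d ∨ S x (par y)) eq))) e)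

  S-par-≡ : ∀ {x y} → y ≢ root → x ≢ y → S x y ≡ S x (par y)
  S-par-≡ {x} {y} ne x≢y rewrite S-rec x ne | dec-false (x ≟ y) x≢y = refl

  S-trans : ∀ {x y z} → S x y ≡ true → S y z ≡ true → S x z ≡ true
  S-trans {x} {y} {z} xy = rank-induction (λ z → S y z ≡ true → S x z ≡ true)
    (λ e → ⊥-elim (contra e (root-S y)))
    (λ ne ih e → [ (λ { refl → xy }) , (λ e′ → S-par ne (ih e′)) ]′ (S-step e)) z

  S-rank : ∀ {x y} → S x y ≡ true → x ≡ y ⊎ rank x < rank y
  S-rank {x} {y} = rank-induction (λ y → S x y ≡ true → x ≡ y ⊎ rank x < rank y)
    (λ e → ⊥-elim (contra e (root-S x)))
    (λ ne ih e → [ inj₁ , (λ e′ → inj₂ ([ (λ { refl → rank-< ne })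
                                     , (λ lt → ℕ.<-trans lt (rank-< ne)) ]′ (ih e′))) ]′ (S-step e)) y

  S-antisym : ∀ {x y} → S x y ≡ true → S y x ≡ true → x ≡ y
  S-antisym e e′ with S-rank e | S-rank e′
  ... | inj₁ p | _ = p
  ... | _ | inj₁ p = sym p
  ... | inj₂ a | inj₂ b = ⊥-elim (ℕ.<-asym a b)

  par-∉ : ∀ {x} → x ≢ root → S x (par x) ≡ false
  par-∉ {x} ne = Bool.¬-not λ e → [ (λ p → ℕ.<-irrefl (sym (cong rank p)) (rank-< ne))
                                  , (λ lt → ℕ.<-asym lt (rank-< ne)) ]′ (S-rank e)

  par≢ : ∀ {x} → x ≢ root → par x ≢ x
  par≢ ne e = ℕ.<-irrefl (cong rank e) (rank-< ne)

  -- Both `x` and `y` are met when climbing from `z` to the root; the one met first lies below the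
  -- other.
  comparable : ∀ {x y z} → S x z ≡ true → S y z ≡ true → S x y ≡ true ⊎ S y x ≡ true
  comparable {x} {y} {z} = rank-induction
    (λ z → S x z ≡ true → S y z ≡ true → S x y ≡ true ⊎ S y x ≡ true)
    (λ e → ⊥-elim (contra e (root-S x)))
    (λ ne ih e e′ → case (S-step e , S-step e′) of λ where
      (inj₁ refl , _) → inj₂ e′
      (_ , inj₁ refl) → inj₁ e
      (inj₂ a , inj₂ b) → ih a b) z

  laminar : ∀ {i j z} → S i z ≡ true → S j z ≡ true →
    (∀ y → S i y ≡ true → S j y ≡ true) ⊎ (∀ y → S j y ≡ true → S i y ≡ true)
  laminar e e′ = [ (λ ij → inj₂ λ _ → S-trans ij) , (λ ji → inj₁ λ _ → S-trans ji) ]′ (comparable e e′)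

  child-toward : ∀ {x y} → S x y ≡ true → x ≢ y → ∃[ c ] (c ≢ root × par c ≡ x × S c y ≡ true)
  child-toward {x} {y} = rank-induction
    (λ y → S x y ≡ true → x ≢ y → ∃[ c ] (c ≢ root × par c ≡ x × S c y ≡ true))
    (λ e → ⊥-elim (contra e (root-S x)))
    (λ {y} ne ih e x≢y → case S-step e of λ where
      (inj₁ p) → ⊥-elim (x≢y p)
      (inj₂ e′) → case x ≟ par y of λ where
        (yes refl) → y , ne , refl , S-refl ne
        (no x≢py) → let c , c≢ , pc , cy = ih e′ x≢py in c , c≢ , pc , S-par ne cy) y

  topmost : ∀ {y} → y ≢ root → ∃[ c ] (c ≢ root × par c ≡ root × S c y ≡ true)
  topmost {y} = rank-induction
    (λ y → y ≢ root → ∃[ c ] (c ≢ root × par c ≡ root × S c y ≡ true))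
    (λ ne → ⊥-elim (ne refl))
    (λ {y} ne ih _ → case par y ≟ root of λ where
      (yes e) → y , ne , e , S-refl ne
      (no ne′) → let c , c≢ , pc , cy = ih ne′ in c , c≢ , pc , S-par ne cy) y

  child-⊆ : ∀ {c x} → c ≢ root → par c ≡ x → x ≢ root → S x c ≡ true
  child-⊆ c≢ refl x≢ = S-par c≢ (S-refl x≢)

  Diff : Fin n → Fin n → Fin n → Bool
  Diff i j x = S i x xor S j x

  -- This is why ends determine edges: along a walk, membership in `S x` can change only at the edge
  -- above `x`.
  adj-toggles : ∀ {u w} → adj G u w ≡ true → ∀ {x} → x ≢ root →
    ((u ≡ x × w ≡ par x) ⊎ (u ≡ par x × w ≡ x)) ⊎ S x u ≡ S x w
  adj-toggles {u} {w} e {x} x≢ with adj-par e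
  ... | inj₁ (u≢ , refl) with x ≟ u
  ...   | yes refl = inj₁ (inj₁ (refl , refl))
  ...   | no x≢u   = inj₂ (S-par-≡ u≢ x≢u)
  adj-toggles {u} {w} e {x} x≢ | inj₂ (w≢ , refl) with x ≟ w
  ...   | yes refl = inj₁ (inj₂ (refl , refl))
  ...   | no x≢w   = inj₂ (sym (S-par-≡ w≢ x≢w))

  -- Paths and chords

  ends : Path G → Fin n × Fin n
  ends (mkPath (x ∷ xs) _ _) = x , last x xs

  Crosses : Fin n → Fin n × Fin n → Bool
  Crosses x (a , b) = S x a xor S x b

  ContainsE-∈ : ∀ xs {a b} → ContainsE G xs a b → a ∈ xs × b ∈ xs
  ContainsE-∈ (x ∷ y ∷ xs) (inj₁ (inj₁ (refl , refl))) = here refl , there (here refl)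
  ContainsE-∈ (x ∷ y ∷ xs) (inj₁ (inj₂ (refl , refl))) = there (here refl) , here refl
  ContainsE-∈ (x ∷ y ∷ xs) (inj₂ c) with ContainsE-∈ (y ∷ xs) c
  ... | a∈ , b∈ = there a∈ , there b∈

  ContainsE-swap : ∀ xs {a b} → ContainsE G xs a b → ContainsE G xs b a
  ContainsE-swap (x ∷ y ∷ xs) (inj₁ (inj₁ p)) = inj₁ (inj₂ p)
  ContainsE-swap (x ∷ y ∷ xs) (inj₁ (inj₂ p)) = inj₁ (inj₁ p)
  ContainsE-swap (x ∷ y ∷ xs) (inj₂ c) = inj₂ (ContainsE-swap (y ∷ xs) c)

  xor-step : ∀ {a b c} → a ≡ b → b xor c ≡ true → a xor c ≡ true
  xor-step refl e = e

  crosses⇒contains : ∀ {x} → x ≢ root → ∀ y ys → IsWalk G (y ∷ ys) →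
    S x y xor S x (last y ys) ≡ true → ContainsE G (y ∷ ys) x (par x)
  crosses⇒contains x≢ y [] w e = ⊥-elim (contra e (Bool.xor-same (S _ y)))
  crosses⇒contains x≢ y (z ∷ ys) (a , w) e with adj-toggles a x≢
  ... | inj₁ (inj₁ p) = inj₁ (inj₁ p)
  ... | inj₁ (inj₂ p) = inj₁ (inj₂ p)
  ... | inj₂ s = inj₂ (crosses⇒contains x≢ z ys w (xor-step (sym s) e))

  stays : ∀ {x} → x ≢ root → ∀ y ys → IsWalk G (y ∷ ys) → (x ∉ y ∷ ys) ⊎ (par x ∉ y ∷ ys) →
    S x y ≡ S x (last y ys)
  stays x≢ y [] w _ = refl
  stays x≢ y (z ∷ ys) (a , w) out with adj-toggles a x≢
  ... | inj₁ (inj₁ (refl , refl)) = ⊥-elim ([ (λ f → f (here refl)) , (λ f → f (there (here refl))) ]′ out)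
  ... | inj₁ (inj₂ (refl , refl)) = ⊥-elim ([ (λ f → f (there (here refl))) , (λ f → f (here refl)) ]′ out)
  ... | inj₂ s = trans s (stays x≢ z ys w ([ (λ f → inj₁ (f ∘ there)) , (λ f → inj₂ (f ∘ there)) ]′ out))

  -- Distinctness of the vertices is essential: once a path has used the edge, the end it has left
  -- cannot recur, so membership in `S x` switches exactly once.
  contains⇒crosses : ∀ {x} → x ≢ root → ∀ y ys → Unique (y ∷ ys) → IsWalk G (y ∷ ys) →
    ContainsE G (y ∷ ys) x (par x) → S x y xor S x (last y ys) ≡ true
  contains⇒crosses {x} x≢ y (z ∷ ys) (y∉ ∷ u) (a , w) (inj₁ (inj₁ (refl , refl)))
    rewrite S-refl x≢ | sym (stays x≢ z ys w (inj₁ (Unique.Unique[x∷xs]⇒x∉xs (y∉ ∷ u)))) | par-∉ x≢ = refl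
  contains⇒crosses {x} x≢ y (z ∷ ys) (y∉ ∷ u) (a , w) (inj₁ (inj₂ (refl , refl)))
    rewrite par-∉ x≢ | sym (stays x≢ z ys w (inj₂ (Unique.Unique[x∷xs]⇒x∉xs (y∉ ∷ u)))) = S-refl x≢
  contains⇒crosses {x} x≢ y (z ∷ ys) (y∉ ∷ u) (a , w) (inj₂ c) with adj-toggles a x≢ | ContainsE-∈ (z ∷ ys) c
  ... | inj₁ (inj₁ (refl , refl)) | x∈ , _ = ⊥-elim (All.lookup y∉ x∈ refl)
  ... | inj₁ (inj₂ (refl , refl)) | _ , p∈ = ⊥-elim (All.lookup y∉ p∈ refl)
  ... | inj₂ s | _ = xor-step s (contains⇒crosses x≢ z ys u w c)

  -- An `Edge` orders its ends by index, which says nothing about which of them is the parent.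
  _At_ : Edge G → Fin n → Set
  e At x = (Edge.eu e ≡ x × Edge.ev e ≡ par x) ⊎ (Edge.eu e ≡ par x × Edge.ev e ≡ x)

  contains⇔crosses : ∀ {e x} → x ≢ root → e At x → ∀ P → PathContains G P e ⇔ (Crosses x (ends P) ≡ true)
  contains⇔crosses x≢ (inj₁ (refl , refl)) (mkPath (y ∷ ys) u w) =
    mk⇔ (contains⇒crosses x≢ y ys u w) (crosses⇒contains x≢ y ys w)
  contains⇔crosses x≢ (inj₂ (refl , refl)) (mkPath (y ∷ ys) u w) =
    mk⇔ (contains⇒crosses x≢ y ys u w ∘ ContainsE-swap (y ∷ ys))
        (ContainsE-swap (y ∷ ys) ∘ crosses⇒contains x≢ y ys w)

  lower : ∀ e → ∃[ x ] (x ≢ root × e At x)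
  lower (mkEdge a b _ e) with adj-par e
  ... | inj₁ (a≢ , refl) = a , a≢ , inj₁ (refl , refl)
  ... | inj₂ (b≢ , refl) = b , b≢ , inj₂ (refl , refl)

  edge-at : ∀ {x} → x ≢ root → ∃[ e ] (e At x)
  edge-at {x} x≢ with Fin.<-cmp x (par x)
  ... | tri≈ _ e _ = ⊥-elim (par≢ x≢ (sym e))
  ... | tri< lt _ _ = mkEdge x (par x) lt (par-adj x≢) , inj₁ (refl , refl)
  ... | tri> _ _ gt = mkEdge (par x) x gt (trans (Graph.sym G _ _) (par-adj x≢)) , inj₂ (refl , refl)

  At-same : ∀ {e f x} → e At x → f At x → SameEdge G e f
  At-same (inj₁ (refl , refl)) (inj₁ (refl , refl)) = refl , refl
  At-same (inj₂ (refl , refl)) (inj₂ (refl , refl)) = refl , refl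
  At-same {e} {f} (inj₁ (refl , refl)) (inj₂ (refl , refl)) = ⊥-elim (ℕ.<-asym (Edge.ord e) (Edge.ord f))
  At-same {e} {f} (inj₂ (refl , refl)) (inj₁ (refl , refl)) = ⊥-elim (ℕ.<-asym (Edge.ord e) (Edge.ord f))

  At-functional : ∀ {e x y} → x ≢ root → y ≢ root → e At x → e At y → x ≡ y
  At-functional _ _ (inj₁ (refl , _)) (inj₁ (refl , _)) = refl
  At-functional _ _ (inj₂ (_ , refl)) (inj₂ (_ , refl)) = refl
  At-functional x≢ y≢ (inj₁ (refl , e)) (inj₂ (f , refl)) = ⊥-elim (ℕ.<-asym (lt x≢ e) (lt y≢ f))
    where
      lt : ∀ {a b} → a ≢ root → b ≡ par a → rank b < rank a
      lt a≢ refl = rank-< a≢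
  At-functional x≢ y≢ (inj₂ (e , refl)) (inj₁ (refl , f)) = ⊥-elim (ℕ.<-asym (lt x≢ e) (lt y≢ f))
    where
      lt : ∀ {a b} → a ≢ root → b ≡ par a → rank b < rank a
      lt a≢ refl = rank-< a≢

-- Separating chords

xor-≡ : ∀ {a b} → a xor b ≡ false → a ≡ b
xor-≡ {true}  {true}  _ = refl
xor-≡ {false} {false} _ = refl

≡-xor : ∀ {a b} → a ≡ b → a xor b ≡ false
≡-xor {a} refl = Bool.xor-same a

xor-split : ∀ a b → a xor b ≡ true → (a ≡ true × b ≡ false) ⊎ (a ≡ false × b ≡ true)
xor-split true  false _ = inj₁ (refl , refl)
xor-split false true  _ = inj₂ (refl , refl)

module Chords {n : ℕ} {G : Graph n} (R : Rooted G) where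
  open Rooted R
  open Tree R

  V : Set
  V = Fin n

  Below : V → V → Set
  Below v x = S v x ≡ true × v ≢ x

  Below? : ∀ v x → Dec (Below v x)
  Below? v x = (S v x Bool.≟ true) ×-dec ¬? (v ≟ x)

  Below-⊆ : ∀ {u v x} → S u v ≡ true → Below v x → Below u x
  Below-⊆ uv (vx , v≢x) = S-trans uv vx , λ { refl → v≢x (S-antisym vx uv) }

  -- Every chord crosses both or neither of the edges i and j.
  Agree : V → V → List (V × V) → Set
  Agree i j M = ∀ {m} → m ∈ M → Diff i j (proj₁ m) ≡ Diff i j (proj₂ m)

  Special : List V → List V → V → Set
  Special N D x = x ∈ N ⊎ x ∈ D

  End : List V → List V → V → Set
  End N D x = x ≡ root ⊎ Special N D x

  -- A condition on traces instead of on pairs `i ≢ j`: as `N` and `D` shrink, different edges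
  -- acquire the same trace and need no longer be told apart. Taking `j` to be `root` yields the
  -- covering condition.
  Separating : List V → List V → List (V × V) → Set
  Separating N D M = ∀ i j → Agree i j M → ∀ {x} → Special N D x → Diff i j x ≡ false

  -- Hence a chord to the root settles its other end; leftover vertices are always disposed of in
  -- this way.
  Diff-root : ∀ i j → Diff i j root ≡ false
  Diff-root i j rewrite root-S i | root-S j = refl

  Diff-comm : ∀ i j x → Diff i j x ≡ Diff j i x
  Diff-comm i j x = Bool.xor-comm (S i x) (S j x)

  Diff-end : ∀ {N D M i j x} → Separating N D M → Agree i j M → End N D x → Diff i j x ≡ false
  Diff-end sep ag (inj₁ refl) = Diff-root _ _
  Diff-end sep ag (inj₂ s)    = sep _ _ ag s

  -- N and D are the leaves (other than the root) and the degree-2 vertices not yet removed; hull keeps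
  -- every v ∈ D in the interior of the subtree spanned by the remaining leaves.
  record Valid (N D : List V) : Set where
    field
      uniqueN  : Unique N
      uniqueD  : Unique D
      disjoint : ∀ {x} → x ∈ N → x ∉ D
      hull     : ∀ {v} → v ∈ D → ∃[ l ] (l ∈ N × Below v l)

  -- In `size`, `suc (length N)` counts the root as a leaf, and the final 2 is the slack of the
  -- ceiling. `two≤` and `ends-in` serve rerouting, which compares two chords and needs to know
  -- where chords may end.
  record Solution (N D : List V) : Set where
    field
      chords     : List (V × V)
      separating : Separating N D chords
      ends-in    : ∀ {m} → m ∈ chords → End N D (proj₁ m) × End N D (proj₂ m)
      two≤       : 2 ≤ length chords
      size       : 3 * length chords ≤ 2 * suc (length N) + length D + 2

  record Reduction (N D : List V) : Set where
    field
      {leaf node} : V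
      {N′ D′}     : List V
      removeN     : Removal leaf N N′
      removeD     : Removal node D D′
      valid       : Valid N′ D′
      lift        : Solution N′ D′ → Solution N D

  -- A leaf of weight 2 and a degree-2 vertex of weight 1 pay for one chord of price 3.
  size-step : ∀ {N D N′ D′ : List V} m → length N ≡ suc (length N′) → length D ≡ suc (length D′) →
    3 * m ≤ 2 * suc (length N′) + length D′ + 2 → 3 * suc m ≤ 2 * suc (length N) + length D + 2
  size-step {N′ = N′} {D′} m e e′ le rewrite e | e′ =
    subst₂ _≤_ (sym (lhs m)) (sym (rhs (length N′) (length D′))) (ℕ.+-monoʳ-≤ 3 le)
    where
      lhs : ∀ m → 3 * suc m ≡ 3 + 3 * m
      lhs = solve-∀
      rhs : ∀ a b → 2 * suc (suc a) + suc b + 2 ≡ 3 + (2 * suc a + b + 2)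
      rhs = solve-∀

  -- S i and S j differ on N ∪ D exactly in l and v, so that a chord l v cannot tell them apart.
  Blocked : List V → List V → V → V → Set
  Blocked N D l v = ∃₂ λ i j → S i v ≡ true × S j v ≡ false × Diff i j l ≡ true ×
    All (λ x → x ≡ l ⊎ x ≡ v ⊎ S i x ≡ S j x) (N ++ D)

  Blocked? : ∀ N D l v → Dec (Blocked N D l v)
  Blocked? N D l v = any? λ i → any? λ j → (S i v Bool.≟ true) ×-dec (S j v Bool.≟ false) ×-dec
    (Diff i j l Bool.≟ true) ×-dec
    All.all? (λ x → (x ≟ l) ⊎-dec (x ≟ v) ⊎-dec (S i x Bool.≟ S j x)) (N ++ D)

  module _ {N D : List V} where

    special-∈ : ∀ {x} → Special N D x → x ∈ N ++ D
    special-∈ = [ ∈-++⁺ˡ , ∈-++⁺ʳ N ]′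

    module _ (valid : Valid N D) where
      open Valid valid

      elsewhere : ∀ {i j l v x} → All (λ x → x ≡ l ⊎ x ≡ v ⊎ S i x ≡ S j x) (N ++ D) →
        Special N D x → x ≢ l → x ≢ v → S i x ≡ S j x
      elsewhere al s x≢l x≢v = [ (λ e → ⊥-elim (x≢l e)) , [ (λ e → ⊥-elim (x≢v e)) , id ]′ ]′
        (All.lookup al (special-∈ s))

      -- Since `S i` contains `v`, it contains all that lies below `v`, also `l`. So `j` is the one
      -- that misses `l`, and elsewhere below `v` it agrees with `i`.
      blocked-below : ∀ {l v} → Below v l → Blocked N D l v →
        ∃[ j ] (S j l ≡ false × (∀ {x} → Special N D x → Below v x → x ≢ l → S j x ≡ true))
      blocked-below {l} {v} (vl , _) (i , j , iv , jv , δ , al) = j , jl , λ s b x≢l →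
        trans (sym (elsewhere {i} {j} al s x≢l (λ e → proj₂ b (sym e)))) (S-trans iv (proj₁ b))
        where
          jl : S j l ≡ false
          jl = [ proj₂ , (λ p → ⊥-elim (contra (S-trans iv vl) (proj₁ p))) ]′ (xor-split _ _ δ)

      -- A leaf below `v` lies in `S i`, hence in `S j`. As `S j` misses `v`, it is contained in
      -- `S v`; so `l` can only be in `S i`, and everything else special in `S i` except `v` is in
      -- `S j`.
      blocked-above : ∀ {l v} → l ∈ N → v ∈ D → ¬ Below v l → Blocked N D l v →
        ∃[ i ] (S i v ≡ true × S i l ≡ true ×
          (∀ {x} → Special N D x → S i x ≡ true → x ≢ l → x ≢ v → Below v x))
      blocked-above {l} {v} l∈ v∈ ¬b (i , j , iv , jv , δ , al) with hull v∈
      ... | y , y∈ , yb = i , iv , il , λ s e x≢l x≢v →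
            j⊆v _ (trans (sym (elsewhere {i} {j} al s x≢l x≢v)) e) x≢v
        where
          l≢v : l ≢ v
          l≢v refl = disjoint l∈ v∈
          y≢l : y ≢ l
          y≢l refl = ¬b yb
          jy : S j y ≡ true
          jy = trans (sym (elsewhere {i} {j} al (inj₁ y∈) y≢l (λ e → proj₂ yb (sym e)))) (S-trans iv (proj₁ yb))
          j⊆v : ∀ x → S j x ≡ true → x ≢ v → Below v x
          j⊆v x e x≢v with laminar {j} {v} jy (proj₁ yb)
          ... | inj₁ sub = sub x e , λ p → x≢v (sym p)
          ... | inj₂ sup = ⊥-elim (contra (sup v (S-refl (proj₁ (in⇒≢root {v} (proj₁ yb))))) jv)
          il : S i l ≡ true
          il = [ proj₁ , (λ p → ⊥-elim (¬b (j⊆v l (proj₂ p) l≢v))) ]′ (xor-split _ _ δ)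

      -- The two witnesses miss `a` and `b` respectively and contain the rest below `v`. A third
      -- special vertex would be common to both and force them to be nested.
      two-blocked-below : ∀ {v a b} → a ∈ N → b ∈ N → a ≢ b → Below v a → Below v b →
        Blocked N D a v → Blocked N D b v → ∀ {x} → Special N D x → Below v x → x ≡ a ⊎ x ≡ b
      two-blocked-below {v} {a} {b} a∈ b∈ a≢b va vb Ba Bb {x} s vx
        with blocked-below va Ba | blocked-below vb Bb | x ≟ a | x ≟ b
      ... | _ | _ | yes e | _ = inj₁ e
      ... | _ | _ | no _ | yes e = inj₂ e
      ... | j , ja , jin | k , kb , kin | no x≢a | no x≢b
        with laminar {j} {k} (jin s vx x≢a) (kin s vx x≢b)
      ... | inj₁ sub = ⊥-elim (contra (sub b (jin (inj₁ b∈) vb (a≢b ∘ sym))) kb)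
      ... | inj₂ sub = ⊥-elim (contra (sub a (kin (inj₁ a∈) va a≢b)) ja)

      -- Both witnesses contain `v` and so are nested; the larger one then contains both leaves, but
      -- outside `S v` it may hold only its own.
      two-blocked-above : ∀ {v a b} → v ∈ D → a ∈ N → b ∈ N → a ≢ b → ¬ Below v a → ¬ Below v b →
        Blocked N D a v → Blocked N D b v → ⊥
      two-blocked-above {v} {a} {b} v∈ a∈ b∈ a≢b va vb Ba Bb
        with blocked-above a∈ v∈ va Ba | blocked-above b∈ v∈ vb Bb
      ... | i , iv , ia , iin | k , kv , kb , kin with laminar {i} {k} iv kv
      ... | inj₁ sub = va (kin (inj₁ a∈) (sub a ia) a≢b (λ { refl → disjoint a∈ v∈ }))
      ... | inj₂ sub = vb (iin (inj₁ b∈) (sub b kb) (a≢b ∘ sym) (λ { refl → disjoint b∈ v∈ }))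

      reduced-valid : ∀ {l v N′ D′} → Removal l N N′ → Removal v D D′ →
        (∀ {z} → z ∈ D → z ≢ v → ∃[ x ] (x ∈ N × x ≢ l × Below z x)) → Valid N′ D′
      reduced-valid RN RD other = record
        { uniqueN = Removal.unique RN ; uniqueD = Removal.unique RD
        ; disjoint = λ i j → disjoint (Removal.sub RN i) (Removal.sub RD j)
        ; hull = λ i → let x , x∈ , x≢ , b = other (Removal.sub RD i) (Removal.fresh RD i)
                       in x , Removal.keep RN x∈ x≢ , b }

      widen : ∀ {l v N′ D′ x} → Removal l N N′ → Removal v D D′ → End N′ D′ x → End N D x
      widen RN RD (inj₁ e)        = inj₁ e
      widen RN RD (inj₂ (inj₁ i)) = inj₂ (inj₁ (Removal.sub RN i))
      widen RN RD (inj₂ (inj₂ i)) = inj₂ (inj₂ (Removal.sub RD i))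

      -- If `i` and `j` agree on all chords, the old ones make their traces equal off `l` and `v`,
      -- and the new one makes `Diff` equal at `l` and `v`. Were it true there, `i` and `j` in one
      -- of the two orders would witness `Blocked`. The returned equations tell later arguments
      -- which pair was removed.
      pair-reduction : ∀ {l v} → l ∈ N → v ∈ D → ¬ Blocked N D l v →
        (∀ {z} → z ∈ D → z ≢ v → ∃[ x ] (x ∈ N × x ≢ l × Below z x)) →
        Σ (Reduction N D) λ r → Reduction.leaf r ≡ l × Reduction.node r ≡ v
      pair-reduction {l} {v} l∈ v∈ free other with remove uniqueN l∈ | remove uniqueD v∈
      ... | N′ , RN | D′ , RD = record
        { removeN = RN ; removeD = RD ; valid = reduced-valid RN RD other ; lift = extend } , refl , refl
        where
          extend : Solution N′ D′ → Solution N D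
          extend sol = record
            { chords = (l , v) ∷ chords
            ; separating = separates
            ; ends-in = λ { (here refl) → inj₂ (inj₁ l∈) , inj₂ (inj₂ v∈)
                          ; (there i) → let p , q = ends-in i in widen RN RD p , widen RN RD q }
            ; two≤ = ℕ.≤-trans two≤ (ℕ.n≤1+n _)
            ; size = size-step {N} {D} {N′} {D′} (length chords) (Removal.size RN) (Removal.size RD) size
            }
            where
              open Solution sol
              separates : Separating N D ((l , v) ∷ chords)
              separates i j ag = covers
                where
                  old : ∀ {x} → Special N′ D′ x → Diff i j x ≡ false
                  old = separating i j (ag ∘ there)
                  agree-at : ∀ x → x ∈ N ++ D → x ≡ l ⊎ x ≡ v ⊎ S i x ≡ S j x
                  agree-at x x∈ with ∈-++⁻ N x∈
                  ... | inj₁ p = [ inj₁ , (λ q → inj₂ (inj₂ (xor-≡ (old (inj₁ q))))) ]′ (Removal.cover RN p)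
                  ... | inj₂ p = [ inj₂ ∘ inj₁ , (λ q → inj₂ (inj₂ (xor-≡ (old (inj₂ q))))) ]′ (Removal.cover RD p)
                  l-false : Diff i j l ≡ false
                  l-false = Bool.¬-not λ e → case xor-split _ _ (trans (sym (ag (here refl))) e) of λ where
                    (inj₁ (iv , jv)) → free (i , j , iv , jv , e , All.tabulate (agree-at _))
                    (inj₂ (iv , jv)) → free (j , i , jv , iv , trans (Diff-comm j i l) e ,
                      All.tabulate (λ {x} k → [ inj₁ , [ inj₂ ∘ inj₁ , (λ q → inj₂ (inj₂ (sym q))) ]′ ]′ (agree-at x k)))
                  covers : ∀ {x} → Special N D x → Diff i j x ≡ false
                  covers (inj₁ p) = [ (λ { refl → l-false }) , (λ q → old (inj₁ q)) ]′ (Removal.cover RN p)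
                  covers (inj₂ p) = [ (λ { refl → trans (sym (ag (here refl))) l-false })
                                    , (λ q → old (inj₂ q)) ]′ (Removal.cover RD p)

xor-true : ∀ {a b} → a ≢ b → a xor b ≡ true
xor-true {true}  {true}  ne = ⊥-elim (ne refl)
xor-true {true}  {false} ne = refl
xor-true {false} {true}  ne = refl
xor-true {false} {false} ne = ⊥-elim (ne refl)

-- Transposes a two by two array: two edges are crossed alike by a chord iff their difference is the
-- same at its two ends.
xor-interchange : ∀ a b c d → a xor b ≡ c xor d → a xor c ≡ b xor d
xor-interchange true  true  c d e = cong not (xor-≡ (sym e))
xor-interchange false false c d e = xor-≡ (sym e)
xor-interchange true  false true  false e = refl
xor-interchange true  false false true  e = refl
xor-interchange false true  true  false e = refl
xor-interchange false true  false true  e = refl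

third-≡ : ∀ {a b c : Bool} → a ≢ c → b ≢ c → a ≡ b
third-≡ a≢c b≢c = trans (Bool.¬-not a≢c) (sym (Bool.¬-not b≢c))

bool-ext : ∀ {a b} → (a ≡ true → b ≡ true) → (b ≡ true → a ≡ true) → a ≡ b
bool-ext {true}  f g = sym (f refl)
bool-ext {false} {true}  f g = g refl
bool-ext {false} {false} f g = refl

-- Rerouting a chord through a leaf and a degree-2 vertex above it

module Exchange {n : ℕ} {G : Graph n} (R : Rooted G) where
  open Rooted R
  open Tree R
  open Chords R

  Agree-sym : ∀ {i j M} → Agree i j M → Agree j i M
  Agree-sym {i} {j} ag m∈ = trans (Diff-comm j i _) (trans (ag m∈) (Diff-comm i j _))

  crosses-agree : ∀ {i j M} → (∀ {m} → m ∈ M → Crosses i m ≡ Crosses j m) → Agree i j M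
  crosses-agree {i} {j} h {a , b} m∈ = xor-interchange (S i a) (S i b) (S j a) (S j b) (h m∈)

  -- A leaf l hanging below the degree-2 vertex v is inserted by rerouting a chord a b through l
  -- and v.  Both ways of doing so fail only if l hangs in the middle of an edge whose only chord
  -- is a b, which cannot happen for two chords at once.
  module _ {N D N′ D′ : List V} {l v : V} (valid : Valid N D) (l∈ : l ∈ N) (v∈ : v ∈ D)
    (vl : Below v l) (RN : Removal l N N′) (RD : Removal v D D′)
    (only : ∀ {x} → x ∈ N → Below v x → x ≡ l)
    (other : ∀ {z} → z ∈ D → z ≢ v → ∃[ x ] (x ∈ N × x ≢ l × Below z x))
    (sol : Solution N′ D′) where
    open Valid valid
    open Solution sol renaming (chords to M)

    -- `l` is the only leaf below `v`, and a remaining degree-2 vertex in `S v` would have another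
    -- leaf below itself, hence below `v`.
    outside : ∀ {x} → End N′ D′ x → S v x ≡ false
    outside (inj₁ refl) = root-S v
    outside {x} (inj₂ (inj₁ i)) = Bool.¬-not λ e →
      Removal.fresh RN i (only (Removal.sub RN i) (e , λ { refl → disjoint (Removal.sub RN i) v∈ }))
    outside {x} (inj₂ (inj₂ i)) = Bool.¬-not λ e →
      let y , y∈ , y≢l , b = other (Removal.sub RD i) (Removal.fresh RD i) in y≢l (only y∈ (Below-⊆ e b))

    old-agree : ∀ {i j} → Agree i j M → ∀ {x} → End N′ D′ x → S i x ≡ S j x
    old-agree {i} {j} ag e = xor-≡ (Diff-end {i = i} {j} separating ag e)

    splits : ∀ {i} → S i l ≢ S i v → S i l ≡ true × S i v ≡ false
    splits {i} ne = Bool.¬-not (λ e → ne (trans e (sym (v-out (λ t → contra (S-trans t (proj₁ vl)) e)))))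
                  , v-out λ t → ne (trans (S-trans t (proj₁ vl)) (sym t))
      where
        v-out : ¬ (S i v ≡ true) → S i v ≡ false
        v-out = Bool.¬-not

    -- A set containing `l` but not `v` lies inside `S v`, where no old chord ends.
    split-trace : ∀ {i} → S i l ≢ S i v → ∀ {x} → End N′ D′ x → S i x ≡ false
    split-trace {i} ne e with laminar {i} {v} (proj₁ (splits {i} ne)) (proj₁ vl)
    ... | inj₁ sub = Bool.¬-not λ t → contra (sub _ t) (outside e)
    ... | inj₂ sup = ⊥-elim (contra (sup v (S-refl (proj₁ (in⇒≢root {v} (proj₁ vl))))) (proj₂ (splits {i} ne)))

    Private : V → V → List (V × V) → V → Set
    Private a b rest ρ = Crosses ρ (a , b) ≡ true × All (λ k → Crosses ρ k ≡ false) rest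

    -- One chord singled out of `M` independently of its orientation and place in the list, so that
    -- a single argument serves both ends of either of two chords.
    record Split (a b : V) (rest : List (V × V)) : Set where
      field
        end-a  : End N′ D′ a
        end-b  : End N′ D′ b
        sub    : ∀ {m} → m ∈ rest → m ∈ M
        joined : ∀ {i j} → Diff i j a ≡ Diff i j b → Agree i j rest → Agree i j M
        len    : length M ≡ suc (length rest)

    swap-split : ∀ {a b rest} → Split a b rest → Split b a rest
    swap-split s = record { end-a = end-b ; end-b = end-a ; sub = sub ; joined = joined ∘ sym ; len = len }
      where open Split s

    module _ {a b rest} (s : Split a b rest) where
      open Split s

      -- If `i` and `j` agree on the new chords but `Diff i j` differs at `a` and `b`, exactly one
      -- of them, say `i`, separates `l` from `v`. By `split-trace` the old ends do not see `i`, so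
      -- among the old chords only a b crosses `j`. The chord from `a` to `l` now makes `S j a` and
      -- `S j l` opposite, against the hypothesis.
      reroute : (∀ {ρ} → Private a b rest ρ → S ρ a ≡ S ρ l) → Solution N D
      reroute good = record
        { chords = (a , l) ∷ (b , v) ∷ rest
        ; separating = separates
        ; ends-in = λ { (here refl) → wide end-a , inj₂ (inj₁ l∈)
                      ; (there (here refl)) → wide end-b , inj₂ (inj₂ v∈)
                      ; (there (there i)) → let p , q = ends-in (sub i) in wide p , wide q }
        ; two≤ = s≤s (s≤s z≤n)
        ; size = subst (λ k → 3 * suc k ≤ 2 * suc (length N) + length D + 2) len
                   (size-step {N} {D} {N′} {D′} (length M) (Removal.size RN) (Removal.size RD) size)
        }
        where
          wide : ∀ {x} → End N′ D′ x → End N D x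
          wide = widen valid RN RD
          Agreeing : V → V → Set
          Agreeing i j = Agree i j ((a , l) ∷ (b , v) ∷ rest)
          clash : ∀ {i j} → Agreeing i j → Diff i j a ≢ Diff i j b → S i l ≢ S i v → S j l ≡ S j v → ⊥
          clash {i} {j} ag ne i-splits j-same = Bool.not-¬ {S j l} refl (trans (sym (good priv)) a-not-l)
            where
              trace : ∀ {x} → End N′ D′ x → Diff i j x ≡ S j x
              trace {x} e = cong (_xor S j x) (split-trace {i} i-splits e)
              priv : Private a b rest j
              priv = xor-true (λ e → ne (trans (trace end-a) (trans e (sym (trace end-b)))))
                , All.tabulate λ {k} k∈ → let p , q = ends-in (sub k∈) in
                    ≡-xor (trans (sym (trace p)) (trans (ag (there (there k∈))) (trace q)))
              a-not-l : S j a ≡ not (S j l)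
              a-not-l = trans (sym (trace end-a))
                (trans (ag (here refl)) (cong (_xor S j l) (proj₁ (splits {i} i-splits))))
          separates : Separating N D ((a , l) ∷ (b , v) ∷ rest)
          separates i j ag with Diff i j a Bool.≟ Diff i j b
          ... | yes e = λ where
                (inj₁ p) → [ (λ { refl → trans (sym (ag (here refl))) (old (end-a)) })
                           , (λ q → old (inj₂ (inj₁ q))) ]′ (Removal.cover RN p)
                (inj₂ p) → [ (λ { refl → trans (sym (ag (there (here refl)))) (old end-b) })
                           , (λ q → old (inj₂ (inj₂ q))) ]′ (Removal.cover RD p)
            where
              old : ∀ {x} → End N′ D′ x → Diff i j x ≡ false
              old = Diff-end separating (joined e (ag ∘ there ∘ there))
          ... | no ne with S i l Bool.≟ S i v | S j l Bool.≟ S j v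
          ...   | yes p | yes q = ⊥-elim (ne (trans (ag (here refl)) (trans (cong₂ _xor_ p q) (sym (ag (there (here refl)))))))
          ...   | no p  | yes q = ⊥-elim (clash {i} {j} ag ne p q)
          ...   | yes p | no q  = ⊥-elim (clash {j} {i} (Agree-sym {i} {j} ag)
                    (λ e → ne (trans (Diff-comm i j a) (trans e (Diff-comm j i b)))) q p)
          ...   | no p  | no q  = ⊥-elim (ne (trans (ag (here refl)) (trans lv (sym (ag (there (here refl)))))))
            where
              lv : Diff i j l ≡ Diff i j v
              lv = trans (cong₂ _xor_ (proj₁ (splits {i} p)) (proj₁ (splits {j} q)))
                         (sym (cong₂ _xor_ (proj₂ (splits {i} p)) (proj₂ (splits {j} q))))

      record Straddle : Set where
        field
          {lo hi} : V
          lo-private : Private a b rest lo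
          lo-l       : S lo l ≡ false
          hi-l       : S hi l ≡ true
          trace      : ∀ {x} → End N′ D′ x → S lo x ≡ S hi x

      -- Two edges whose only chord is a b are crossed by the same chords of `M`, which is
      -- separating.
      private-trace : ∀ {ρ σ} → Private a b rest ρ → Private a b rest σ → ∀ {x} → End N′ D′ x → S ρ x ≡ S σ x
      private-trace {ρ} {σ} P Q = old-agree {ρ} {σ}
        (joined (xor-interchange (S ρ a) (S ρ b) (S σ a) (S σ b) (trans (proj₁ P) (sym (proj₁ Q))))
          (crosses-agree λ m∈ → trans (All.lookup (proj₂ P) m∈) (sym (All.lookup (proj₂ Q) m∈))))

      -- If `ρ` and `σ` agreed at `l`, then `S ρ a` and `S σ b` would be equal, both being opposite
      -- to that value. With equal traces this gives `S σ a ≡ S σ b`, although a b crosses `σ`.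
      straddle : ∀ {ρ σ} → Private a b rest ρ → S ρ a ≢ S ρ l → Private a b rest σ → S σ b ≢ S σ l → Straddle
      straddle {ρ} {σ} P ρa Q σb with S ρ l in eρ | S σ l in eσ
      ... | true  | false = record { lo-private = Q ; lo-l = eσ ; hi-l = eρ ; trace = sym ∘ private-trace P Q }
      ... | false | true  = record { lo-private = P ; lo-l = eρ ; hi-l = eσ ; trace = private-trace P Q }
      ... | true  | true  = ⊥-elim (contra (proj₁ Q) (≡-xor
            (trans (sym (private-trace P Q end-a)) (third-≡ ρa σb))))
      ... | false | false = ⊥-elim (contra (proj₁ Q) (≡-xor
            (trans (sym (private-trace P Q end-a)) (third-≡ ρa σb))))

    private-swap : ∀ {a b rest ρ} → Private a b rest ρ → Private b a rest ρ
    private-swap {a} {b} {rest} {ρ} (e , al) = trans (Bool.xor-comm (S ρ b) (S ρ a)) e , al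

    reroutable : ∀ {a b rest} (s : Split a b rest) → Solution N D ⊎ Straddle s
    reroutable {a} {b} {rest} s
      with any? (λ ρ → private? ρ ×-dec ¬? (S ρ a Bool.≟ S ρ l)) | any? (λ ρ → private? ρ ×-dec ¬? (S ρ b Bool.≟ S ρ l))
      where
        private? : ∀ ρ → Dec (Private a b rest ρ)
        private? ρ = (Crosses ρ (a , b) Bool.≟ true) ×-dec All.all? (λ k → Crosses ρ k Bool.≟ false) rest
    ... | no f | _ = inj₁ (reroute s λ {ρ} P → decidable-stable (S ρ a Bool.≟ S ρ l) λ ne → f (ρ , P , ne))
    ... | yes _ | no f = inj₁ (reroute (swap-split s) λ {ρ} P →
            decidable-stable (S ρ b Bool.≟ S ρ l) λ ne → f (ρ , private-swap {ρ = ρ} P , ne))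
    ... | yes (ρ , P , ne) | yes (σ , Q , ne′) = inj₂ (straddle s P ne Q ne′)

    -- The lower set of `p` contains `a` or `b`, and at that end the upper set of `p` meets the
    -- lower set of `q`. Only the former contains `l`, so it includes the latter. Hence the two
    -- lower sets have the same trace, but a b crosses just one of them.
    nested-straddles : ∀ {a b rest c d rest′} {s : Split a b rest} {s′ : Split c d rest′} →
      (p : Straddle s) (q : Straddle s′) → (a , b) ∈ rest′ →
      (∀ x → S (Straddle.hi p) x ≡ true → S (Straddle.hi q) x ≡ true) → ⊥
    nested-straddles {a} {b} {s = s} p q ab∈ sub = [ at (Split.end-a s) ∘ proj₁ , at (Split.end-b s) ∘ proj₂ ]′
        (xor-split _ _ (proj₁ P.lo-private))
      where
        module P = Straddle p
        module Q = Straddle q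
        ρ⊆η : ∀ {y} → End N′ D′ y → S P.lo y ≡ true → S Q.lo y ≡ true
        ρ⊆η e t = trans (Q.trace e) (sub _ (trans (sym (P.trace e)) t))
        at : ∀ {x} → End N′ D′ x → S P.lo x ≡ true → ⊥
        at e t with laminar {P.hi} {Q.lo} (trans (sym (P.trace e)) t) (ρ⊆η e t)
        ... | inj₁ sub′ = contra (sub′ l P.hi-l) Q.lo-l
        ... | inj₂ sup = contra (trans (cong₂ _xor_ (sym (same (Split.end-a s))) (sym (same (Split.end-b s)))) (proj₁ P.lo-private))
                                (All.lookup (proj₂ Q.lo-private) ab∈)
          where
            same : ∀ {y} → End N′ D′ y → S P.lo y ≡ S Q.lo y
            same e = bool-ext (ρ⊆η e) (λ t → trans (P.trace e) (sup _ t))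

    exchange : Solution N D
    exchange with M in eq | two≤
    ... | _ ∷ [] | s≤s ()
    ... | (a , b) ∷ (c , d) ∷ rest | _ = choose (reroutable first) (reroutable second)
      where
        listed : ∀ {m} → m ∈ (a , b) ∷ (c , d) ∷ rest → m ∈ M
        listed = subst (_ ∈_) (sym eq)
        unlisted : ∀ {m} → m ∈ M → m ∈ (a , b) ∷ (c , d) ∷ rest
        unlisted = subst (_ ∈_) eq
        first : Split a b ((c , d) ∷ rest)
        first = record
          { end-a = proj₁ (ends-in (listed (here refl))) ; end-b = proj₂ (ends-in (listed (here refl)))
          ; sub = listed ∘ there ; len = cong length eq
          ; joined = λ e ag m∈ → case unlisted m∈ of λ { (here refl) → e ; (there k) → ag k } }
        second : Split c d ((a , b) ∷ rest)
        second = record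
          { end-a = proj₁ (ends-in (listed (there (here refl)))) ; end-b = proj₂ (ends-in (listed (there (here refl))))
          ; sub = λ { (here refl) → listed (here refl) ; (there k) → listed (there (there k)) } ; len = cong length eq
          ; joined = λ e ag m∈ → case unlisted m∈ of λ
              { (here refl) → ag (here refl) ; (there (here refl)) → e ; (there (there k)) → ag (there k) } }
        choose : Solution N D ⊎ Straddle first → Solution N D ⊎ Straddle second → Solution N D
        choose (inj₁ r) _ = r
        choose _ (inj₁ r) = r
        choose (inj₂ p) (inj₂ q) with laminar {Straddle.hi p} {Straddle.hi q} (Straddle.hi-l p) (Straddle.hi-l q)
        ... | inj₁ sub = ⊥-elim (nested-straddles p q (here refl) sub)
        ... | inj₂ sub = ⊥-elim (nested-straddles q p (here refl) sub)

  exchange-reduction : ∀ {N D l v} → Valid N D → l ∈ N → v ∈ D → Below v l →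
    (∀ {x} → x ∈ N → Below v x → x ≡ l) →
    (∀ {z} → z ∈ D → z ≢ v → ∃[ x ] (x ∈ N × x ≢ l × Below z x)) → Reduction N D
  exchange-reduction valid l∈ v∈ vl only other
    with remove (Valid.uniqueN valid) l∈ | remove (Valid.uniqueD valid) v∈
  ... | N′ , RN | D′ , RD = record
    { removeN = RN ; removeD = RD ; valid = reduced-valid valid RN RD other
    ; lift = exchange valid l∈ v∈ vl RN RD only other }

filter-split : ∀ {A : Set} {P : A → Set} (P? : ∀ x → Dec (P x)) xs →
  length (filter P? xs) + length (filter (¬? ∘ P?) xs) ≡ length xs
filter-split P? [] = refl
filter-split P? (x ∷ xs) with P? x
... | yes _ = cong suc (filter-split P? xs)
... | no _  = trans (ℕ.+-suc _ _) (cong suc (filter-split P? xs))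

-- Existence of a removable leaf and degree-2 vertex

module Reductions {n : ℕ} {G : Graph n} (R : Rooted G) where
  open Rooted R
  open Tree R
  open Chords R
  open Exchange R

  -- What remains when every pair is blocked. Unlike `TaLike` it also admits `a` and `b` as the only
  -- leaves, a case that a star settles.
  record TaShape (N D : List V) : Set where
    field
      {v a b} : V
      v∈      : v ∈ D
      sole    : ∀ {z} → z ∈ D → z ≡ v
      a∈      : a ∈ N
      b∈      : b ∈ N
      a≢b     : a ≢ b
      va      : Below v a
      vb      : Below v b
      exact   : ∀ {x} → x ∈ N → Below v x → x ≡ a ⊎ x ≡ b
      small   : length N ≤ 3

  -- The position of the leaves and the degree-2 vertex in Tᵃ rooted at a leaf.
  record TaLike (N D : List V) : Set where
    field
      {v a b c} : V
      N≡3       : length N ≡ 3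
      D≡1       : length D ≡ 1
      v∈        : v ∈ D
      a∈        : a ∈ N
      b∈        : b ∈ N
      c∈        : c ∈ N
      a≢b       : a ≢ b
      va        : Below v a
      vb        : Below v b
      vc        : ¬ Below v c

  module _ {N D : List V} (valid : Valid N D) where
    open Valid valid

    Only : V → V → Set
    Only z l = All (λ x → Below z x → x ≡ l) N

    Only? : ∀ z l → Dec (Only z l)
    Only? z l = All.all? (λ x → Below? z x →-dec (x ≟ l)) N

    escape : ∀ {z l} → ¬ Only z l → ∃[ x ] (x ∈ N × x ≢ l × Below z x)
    escape {z} {l} h with Any.any? (λ x → ¬? (x ≟ l) ×-dec Below? z x) N
    ... | yes p = let x , x∈ , q , b = find p in x , x∈ , q , b
    ... | no np = ⊥-elim (h (All.tabulate λ {x} x∈ b →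
            decidable-stable (x ≟ l) λ ne → np (lose x∈ (ne , b))))

    only-below : ∀ {z l} → z ∈ D → Only z l → Below z l
    only-below z∈ o with hull z∈
    ... | x , x∈ , b = subst (Below _) (All.lookup o x∈ b) b

    -- The lower one of two degree-2 vertices above the same leaf is never blocked by another leaf.
    chain-reduction : ∀ {u v l l′} → u ∈ D → v ∈ D → u ≢ v → S u v ≡ true → Only u l → Only v l →
      l′ ∈ N → l′ ≢ l → (∀ {z} → z ∈ D → ¬ Only z l′) → Reduction N D
    chain-reduction {u} {v} {l} {l′} u∈ v∈ u≢v uv ou ov l′∈ l′≢l free =
      proj₁ (pair-reduction valid l′∈ v∈ unblocked (λ z∈ _ → escape (free z∈)))
      where
        unblocked : ¬ Blocked N D l′ v
        unblocked B with blocked-above valid l′∈ v∈ (λ b → l′≢l (All.lookup ov l′∈ b)) B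
        ... | i , iv , il′ , iin with laminar {i} {u} iv uv
        ... | inj₁ sub = l′≢l (All.lookup ou l′∈ (sub _ il′ , λ { refl → disjoint l′∈ u∈ }))
        ... | inj₂ sup = u≢v (S-antisym uv (proj₁ (iin (inj₂ u∈)
                (sup u (S-refl (proj₁ (in⇒≢root {u} uv)))) (λ { refl → disjoint l′∈ u∈ }) u≢v)))

    -- Two leaves lie below `v`; both are blocked, so nothing else special does. A second degree-2
    -- vertex `z` would likewise have just two leaves below it. Neither of these is below `v`, since
    -- otherwise one of `z`, `v` would be below the other; but two leaves not below `v` cannot both
    -- be blocked. This also bounds the number of leaves by three.
    all-blocked : (∀ {l z} → l ∈ N → z ∈ D → ¬ Only z l) → (∀ {l z} → l ∈ N → z ∈ D → Blocked N D l z) →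
      ∀ {v} → v ∈ D → TaShape N D
    all-blocked free blocked {v} v∈ with hull v∈
    ... | a , a∈ , va with escape (free a∈ v∈)
    ... | b , b∈ , b≢a , vb = record
      { v∈ = v∈ ; sole = λ {z} z∈ → decidable-stable (z ≟ v) (another z∈)
      ; a∈ = a∈ ; b∈ = b∈ ; a≢b = b≢a ∘ sym ; va = va ; vb = vb ; exact = λ x∈ → exact (inj₁ x∈) ; small = small }
      where
        exact : ∀ {x} → Special N D x → Below v x → x ≡ a ⊎ x ≡ b
        exact = two-blocked-below valid a∈ b∈ (b≢a ∘ sym) va vb (blocked a∈ v∈) (blocked b∈ v∈)
        another : ∀ {z} → z ∈ D → z ≢ v → ⊥
        another {z} z∈ z≢v with hull z∈
        ... | c , c∈ , zc with escape (free c∈ z∈)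
        ... | d , d∈ , d≢c , zd = two-blocked-above valid v∈ c∈ d∈ (d≢c ∘ sym) (unseen c∈ zc) (unseen d∈ zd)
                                    (blocked c∈ v∈) (blocked d∈ v∈)
          where
            zin : ∀ {x} → Special N D x → Below z x → x ≡ c ⊎ x ≡ d
            zin = two-blocked-below valid c∈ d∈ (d≢c ∘ sym) zc zd (blocked c∈ z∈) (blocked d∈ z∈)
            in-N : ∀ {x y w} → x ∈ N → y ∈ N → w ∈ D → ¬ (w ≡ x ⊎ w ≡ y)
            in-N x∈ y∈ w∈ = [ (λ { refl → disjoint x∈ w∈ }) , (λ { refl → disjoint y∈ w∈ }) ]′
            unseen : ∀ {x} → x ∈ N → Below z x → ¬ Below v x
            unseen x∈ zx vx with comparable (proj₁ vx) (proj₁ zx)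
            ... | inj₁ vz = in-N a∈ b∈ z∈ (exact (inj₂ z∈) (vz , z≢v ∘ sym))
            ... | inj₂ zv = in-N c∈ d∈ v∈ (zin (inj₂ v∈) (zv , z≢v))
        small : length N ≤ 3
        small with remove uniqueN a∈
        ... | N₁ , R₁ with remove (Removal.unique R₁) (Removal.keep R₁ b∈ b≢a)
        ... | N₂ , R₂ = subst (_≤ 3) (sym (trans (Removal.size R₁) (cong suc (Removal.size R₂))))
                          (s≤s (s≤s (at-most-one (Removal.unique R₂) (λ i → i))))
          where
            out : ∀ {x} → x ∈ N₂ → ¬ Below v x
            out i b = [ Removal.fresh R₁ (Removal.sub R₂ i) , Removal.fresh R₂ i ]′
                        (exact (inj₁ (Removal.sub R₁ (Removal.sub R₂ i))) b)
            inN : ∀ {x} → x ∈ N₂ → x ∈ N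
            inN = Removal.sub R₁ ∘ Removal.sub R₂
            at-most-one : ∀ {xs} → Unique xs → (∀ {x} → x ∈ xs → x ∈ N₂) → length xs ≤ 1
            at-most-one {[]} _ _ = z≤n
            at-most-one {x ∷ []} _ _ = s≤s z≤n
            at-most-one {x ∷ y ∷ _} ((x≢y ∷ _) ∷ _) sub = ⊥-elim (two-blocked-above valid v∈
              (inN (sub (here refl))) (inN (sub (there (here refl)))) x≢y
              (out (sub (here refl))) (out (sub (there (here refl))))
              (blocked (inN (sub (here refl))) v∈) (blocked (inN (sub (there (here refl)))) v∈))

    -- A degree-2 vertex has some leaf below it, so it can be exclusive to one leaf only.
    crowded : (∀ {l} → l ∈ N → ∃₂ λ y z → y ∈ D × z ∈ D × y ≢ z × Only y l × Only z l) →
      length N * 2 ≤ length D * 1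
    crowded two = double-count (λ l z → does (Only? z l)) N D
      (λ l∈ → let y , z , y∈ , z∈ , y≢z , oy , oz = two l∈ in
        count-two y∈ z∈ y≢z (dec-true (Only? y _) oy) (dec-true (Only? z _) oz))
      (λ {z} z∈ → count-≤1 uniqueN λ {l} {l′} l∈ l′∈ e e′ →
        All.lookup (truth (Only? z l′) e′) l∈ (only-below z∈ (truth (Only? z l) e)))
      where
        truth : ∀ {P : Set} (d : Dec P) → does d ≡ true → P
        truth (yes p) _ = p

    Unaccompanied : V → V → Set
    Unaccompanied l z = Only z l × All (λ y → Only y l → y ≡ z) D

    companion : ∀ {l z} → ¬ Unaccompanied l z → Only z l → ∃[ y ] (y ∈ D × Only y l × y ≢ z)
    companion {l} {z} none oz with Any.any? (λ y → Only? y l ×-dec ¬? (y ≟ z)) D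
    ... | yes q = let y , y∈ , oy , ne = find q in y , y∈ , oy , ne
    ... | no nq = ⊥-elim (none (oz , All.tabulate λ {y} y∈ oy →
            decidable-stable (y ≟ z) λ ne → nq (lose y∈ (oy , ne))))

    -- Removing `l` harms precisely the vertices with `Only z l`. If some leaf has exactly one of
    -- these, both are removed together by rerouting. Otherwise each leaf has none or at least two.
    -- Not every leaf can have two, by `crowded` and the bound on `D`; if some leaf has two and
    -- another none, a chain reduction applies. If no leaf has any, every unblocked pair may be
    -- removed.
    reduce : ∀ {v} → v ∈ D → 2 ≤ length N → length D ≤ suc (length N) → Reduction N D ⊎ TaShape N D
    reduce {v} v∈ 2≤N D≤N with Any.any? (λ l → Any.any? (λ z → Only? z l ×-dec
                                    All.all? (λ y → Only? y l →-dec (y ≟ z)) D) D) N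
    ... | yes p = let l , l∈ , q = find p ; z , z∈ , oz , sole = find q in
          inj₁ (exchange-reduction valid l∈ z∈ (only-below z∈ oz) (All.lookup oz)
            (λ y∈ y≢z → escape λ oy → y≢z (All.lookup sole y∈ oy)))
    ... | no none with Any.any? (λ l → ¬? (Any.any? (λ z → Only? z l) D)) N
    ...   | no every = ⊥-elim (ℕ.<-irrefl refl (ℕ.≤-trans 2≤N (ℕ.+-cancelʳ-≤ (length N) (length N) 1 too-many)))
      where
        two : ∀ {l} → l ∈ N → ∃₂ λ y z → y ∈ D × z ∈ D × y ≢ z × Only y l × Only z l
        two {l} l∈ with find (decidable-stable (Any.any? (λ z → Only? z l) D) λ h → every (lose l∈ h))
        ... | z , z∈ , oz with companion (λ s → none (lose l∈ (lose z∈ s))) oz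
        ... | y , y∈ , oy , ne = y , z , y∈ , z∈ , ne , oy , oz
        too-many : length N + length N ≤ 1 + length N
        too-many = ℕ.≤-trans (ℕ.≤-reflexive (double (length N))) (ℕ.≤-trans (crowded two)
                     (ℕ.≤-trans (ℕ.≤-reflexive (ℕ.*-identityʳ _)) D≤N))
          where
            double : ∀ k → k + k ≡ k * 2
            double = solve-∀
    ...   | yes p with find p | Any.any? (λ l → Any.any? (λ z → Only? z l) D) N
    ...     | l′ , l′∈ , free | yes q = let l , l∈ , r = find q ; z , z∈ , oz = find r in chain l∈ z∈ oz
      where
        chain : ∀ {l z} → l ∈ N → z ∈ D → Only z l → Reduction N D ⊎ TaShape N D
        chain {l} {z} l∈ z∈ oz with companion (λ s → none (lose l∈ (lose z∈ s))) oz
        ... | y , y∈ , oy , ne with comparable (proj₁ (only-below y∈ oy)) (proj₁ (only-below z∈ oz))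
        ... | inj₁ yz = inj₁ (chain-reduction y∈ z∈ ne yz oy oz l′∈
                          (λ { refl → free (lose z∈ oz) }) (λ x∈ o → free (lose x∈ o)))
        ... | inj₂ zy = inj₁ (chain-reduction z∈ y∈ (ne ∘ sym) zy oz oy l′∈
                          (λ { refl → free (lose z∈ oz) }) (λ x∈ o → free (lose x∈ o)))
    ...     | _ | no nq with Any.any? (λ l → Any.any? (λ z → ¬? (Blocked? N D l z)) D) N
    ...       | yes r = let l , l∈ , s = find r ; z , z∈ , nb = find s in
                  inj₁ (proj₁ (pair-reduction valid l∈ z∈ nb (λ y∈ _ → escape λ o → nq (lose l∈ (lose y∈ o)))))
    ...       | no nr = inj₂ (all-blocked (λ l∈ z∈ o → nq (lose l∈ (lose z∈ o)))
                  (λ {l} {z} l∈ z∈ → decidable-stable (Blocked? N D l z) λ nb → nr (lose l∈ (lose z∈ nb))) v∈)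

-- Avoiding the position of Tᵃ

module FourTwo {n : ℕ} {G : Graph n} (R : Rooted G) where
  open Rooted R
  open Tree R
  open Chords R
  open Reductions R

  module _ {N D : List V} (valid : Valid N D) (N≡4 : length N ≡ 4) where
    open Valid valid

    -- One removal from four leaves and two degree-2 vertices leaves three and one, the numbers of
    -- `TaLike`; any other numbers are safe.
    Good : Set
    Good = Σ (Reduction N D) λ r → ¬ TaLike (Reduction.N′ r) (Reduction.D′ r)

    data Profile (u : V) : Set where
      one : ∀ {a b c d} → a ∈ N → b ∈ N → c ∈ N → d ∈ N → b ≢ c → b ≢ d → c ≢ d →
        Below u a → ¬ Below u b → ¬ Below u c → ¬ Below u d → Profile u
      two : ∀ {a b c d} → a ∈ N → b ∈ N → c ∈ N → d ∈ N → a ≢ b → c ≢ d →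
        Below u a → Below u b → ¬ Below u c → ¬ Below u d →
        (∀ {x} → x ∈ N → Below u x → x ≡ a ⊎ x ≡ b) → Profile u
      three : ∀ {a b c d} → a ∈ N → b ∈ N → c ∈ N → d ∈ N → a ≢ b → a ≢ c → b ≢ c →
        Below u a → Below u b → Below u c → ¬ Below u d →
        (∀ {x} → x ∈ N → x ≢ d → Below u x) → Profile u
      four : ∀ {a b c} → a ∈ N → b ∈ N → c ∈ N → a ≢ b → a ≢ c → b ≢ c →
        (∀ {x} → x ∈ N → Below u x) → Profile u

    profile : ∀ {u} → u ∈ D → Profile u
    profile {u} u∈ = classify (filter (Below? u) N) (filter (¬? ∘ Below? u) N)
        (trans (filter-split (Below? u) N) N≡4) (Unique.filter⁺ (Below? u) uniqueN)
        (Unique.filter⁺ (¬? ∘ Below? u) uniqueN)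
        (∈-filter⁻ (Below? u)) (∈-filter⁻ (¬? ∘ Below? u)) (∈-filter⁺ (Below? u)) (∈-filter⁺ (¬? ∘ Below? u))
      where
        classify : ∀ as bs → length as + length bs ≡ 4 → Unique as → Unique bs →
          (∀ {x} → x ∈ as → x ∈ N × Below u x) → (∀ {x} → x ∈ bs → x ∈ N × ¬ Below u x) →
          (∀ {x} → x ∈ N → Below u x → x ∈ as) → (∀ {x} → x ∈ N → ¬ Below u x → x ∈ bs) → Profile u
        classify [] bs _ _ _ _ _ as⁺ _ with hull u∈
        ... | x , x∈ , b with as⁺ x∈ b
        ... | ()
        classify (a ∷ []) (b ∷ c ∷ d ∷ []) _ _ ((b≢c ∷ b≢d ∷ []) ∷ (c≢d ∷ []) ∷ _) as⁻ bs⁻ _ _ =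
          one (proj₁ (as⁻ (here refl))) (proj₁ (bs⁻ (here refl))) (proj₁ (bs⁻ (there (here refl))))
            (proj₁ (bs⁻ (there (there (here refl))))) b≢c b≢d c≢d
            (proj₂ (as⁻ (here refl))) (proj₂ (bs⁻ (here refl))) (proj₂ (bs⁻ (there (here refl))))
            (proj₂ (bs⁻ (there (there (here refl)))))
        classify (a ∷ b ∷ []) (c ∷ d ∷ []) _ ((a≢b ∷ []) ∷ _) ((c≢d ∷ []) ∷ _) as⁻ bs⁻ as⁺ _ =
          two (proj₁ (as⁻ (here refl))) (proj₁ (as⁻ (there (here refl)))) (proj₁ (bs⁻ (here refl)))
            (proj₁ (bs⁻ (there (here refl)))) a≢b c≢d
            (proj₂ (as⁻ (here refl))) (proj₂ (as⁻ (there (here refl)))) (proj₂ (bs⁻ (here refl)))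
            (proj₂ (bs⁻ (there (here refl))))
            (λ x∈ b → case as⁺ x∈ b of λ { (here e) → inj₁ e ; (there (here e)) → inj₂ e })
        classify (a ∷ b ∷ c ∷ []) (d ∷ []) _ ((a≢b ∷ a≢c ∷ []) ∷ (b≢c ∷ []) ∷ _) _ as⁻ bs⁻ _ bs⁺ =
          three (proj₁ (as⁻ (here refl))) (proj₁ (as⁻ (there (here refl)))) (proj₁ (as⁻ (there (there (here refl)))))
            (proj₁ (bs⁻ (here refl))) a≢b a≢c b≢c
            (proj₂ (as⁻ (here refl))) (proj₂ (as⁻ (there (here refl)))) (proj₂ (as⁻ (there (there (here refl)))))
            (proj₂ (bs⁻ (here refl)))
            (λ {x} x∈ x≢d → decidable-stable (Below? u x) λ nb → case bs⁺ x∈ nb of λ { (here e) → x≢d e })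
        classify (a ∷ b ∷ c ∷ _ ∷ []) [] _ ((a≢b ∷ a≢c ∷ _) ∷ (b≢c ∷ _) ∷ _) _ as⁻ _ _ bs⁺ =
          four (proj₁ (as⁻ (here refl))) (proj₁ (as⁻ (there (here refl)))) (proj₁ (as⁻ (there (there (here refl)))))
            a≢b a≢c b≢c (λ {x} x∈ → decidable-stable (Below? u x) λ nb → case bs⁺ x∈ nb of λ ())
        classify (a ∷ []) [] () _ _ _ _ _ _
        classify (a ∷ []) (_ ∷ []) () _ _ _ _ _ _
        classify (a ∷ []) (_ ∷ _ ∷ []) () _ _ _ _ _ _
        classify (a ∷ []) (_ ∷ _ ∷ _ ∷ _ ∷ _) () _ _ _ _ _ _
        classify (a ∷ _ ∷ []) [] () _ _ _ _ _ _
        classify (a ∷ _ ∷ []) (_ ∷ []) () _ _ _ _ _ _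
        classify (a ∷ _ ∷ []) (_ ∷ _ ∷ _ ∷ _) () _ _ _ _ _ _
        classify (a ∷ _ ∷ _ ∷ []) [] () _ _ _ _ _ _
        classify (a ∷ _ ∷ _ ∷ []) (_ ∷ _ ∷ _) () _ _ _ _ _ _
        classify (a ∷ _ ∷ _ ∷ _ ∷ []) (_ ∷ _) () _ _ _ _ _ _
        classify (a ∷ _ ∷ _ ∷ _ ∷ _ ∷ _) _ () _ _ _ _ _ _

    -- Of four leaves, two lie outside `S v` or three lie below `v`; either is too many for all to
    -- be blocked.
    not-all-blocked : ∀ {v} → v ∈ D → (∀ {l} → l ∈ N → Blocked N D l v) → ⊥
    not-all-blocked v∈ B with profile v∈
    ... | one _ b∈ c∈ _ b≢c _ _ _ vb vc _ = two-blocked-above valid v∈ b∈ c∈ b≢c vb vc (B b∈) (B c∈)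
    ... | two _ _ c∈ d∈ _ c≢d _ _ vc vd _ = two-blocked-above valid v∈ c∈ d∈ c≢d vc vd (B c∈) (B d∈)
    ... | three a∈ b∈ c∈ _ a≢b a≢c b≢c va vb vc _ _ =
      [ a≢c ∘ sym , b≢c ∘ sym ]′ (two-blocked-below valid a∈ b∈ a≢b va vb (B a∈) (B b∈) (inj₁ c∈) vc)
    ... | four a∈ b∈ c∈ a≢b a≢c b≢c all =
      [ a≢c ∘ sym , b≢c ∘ sym ]′ (two-blocked-below valid a∈ b∈ a≢b (all a∈) (all b∈) (B a∈) (B b∈) (inj₁ c∈) (all c∈))

    module _ {u v : V} (u∈ : u ∈ D) (v∈ : v ∈ D) (u≢v : u ≢ v)
      (pair : ∀ {z} → z ∈ D → z ≡ u ⊎ z ≡ v) where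

      not-v : ∀ {z} → z ∈ D → z ≢ v → z ≡ u
      not-v z∈ ne = [ id , (λ e → ⊥-elim (ne e)) ]′ (pair z∈)

      -- After the removal only `u` is left in `D`, and two of the three leaves are not below it. In
      -- the position of Tᵃ two leaves are below it.
      keep-mixed : ∀ {l x y z} → l ∈ N → ¬ Blocked N D l v → x ∈ N → x ≢ l → Below u x →
        y ∈ N → z ∈ N → y ≢ l → z ≢ l → y ≢ z → ¬ Below u y → ¬ Below u z → Good
      keep-mixed l∈ free x∈ x≢l ux y∈ z∈ y≢l z≢l y≢z uy uz
        with pair-reduction valid l∈ v∈ free (λ w∈ ne → _ , x∈ , x≢l , subst (λ w → Below w _) (sym (not-v w∈ ne)) ux)
      ... | r , refl , refl = r , λ t → bad t (not-v (Removal.sub removeD (TaLike.v∈ t)) (Removal.fresh removeD (TaLike.v∈ t)))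
        where
          open Reduction r
          bad : (t : TaLike N′ D′) → TaLike.v t ≡ u → ⊥
          bad t refl = ℕ.<-irrefl refl (subst (4 ≤_) N≡3 (unique-⊆-length
              ((a≢b ∷ (λ { refl → uy va }) ∷ (λ { refl → uz va }) ∷ []) ∷
               ((λ { refl → uy vb }) ∷ (λ { refl → uz vb }) ∷ []) ∷ (y≢z ∷ []) ∷ [] ∷ [])
              (Removal.unique removeN) (λ { (here refl) → a∈ ; (there (here refl)) → b∈
                ; (there (there (here refl))) → Removal.keep removeN y∈ y≢l
                ; (there (there (there (here refl)))) → Removal.keep removeN z∈ z≢l })))
            where open TaLike t

      -- In the position of Tᵃ one leaf is not below the degree-2 vertex.
      keep-all : ∀ {l x} → l ∈ N → ¬ Blocked N D l v → x ∈ N → x ≢ l →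
        (∀ {y} → y ∈ N → y ≢ l → Below u y) → Good
      keep-all l∈ free x∈ x≢l all
        with pair-reduction valid l∈ v∈ free (λ w∈ ne → _ , x∈ , x≢l , subst (λ w → Below w _) (sym (not-v w∈ ne)) (all x∈ x≢l))
      ... | r , refl , refl = r , λ t → bad t (not-v (Removal.sub removeD (TaLike.v∈ t)) (Removal.fresh removeD (TaLike.v∈ t)))
        where
          open Reduction r
          bad : (t : TaLike N′ D′) → TaLike.v t ≡ u → ⊥
          bad t refl = TaLike.vc t (all (Removal.sub removeN (TaLike.c∈ t)) (Removal.fresh removeN (TaLike.c∈ t)))

      four-below : ∀ {a b} → a ∈ N → b ∈ N → a ≢ b → (∀ {x} → x ∈ N → Below u x) → Good
      four-below {a} {b} a∈ b∈ a≢b all with Any.any? (λ l → ¬? (Blocked? N D l v)) N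
      ... | no h = ⊥-elim (not-all-blocked v∈ λ {l} l∈ → decidable-stable (Blocked? N D l v) λ nb → h (lose l∈ nb))
      ... | yes h with find h
      ... | l , l∈ , free with a ≟ l
      ... | yes refl = keep-all l∈ free b∈ (a≢b ∘ sym) (λ y∈ _ → all y∈)
      ... | no a≢l   = keep-all l∈ free a∈ a≢l (λ y∈ _ → all y∈)

    module Pair {u v : V} (u∈ : u ∈ D) (v∈ : v ∈ D) (u≢v : u ≢ v)
      (pair : ∀ {z} → z ∈ D → z ≡ u ⊎ z ≡ v) where

      flipped : ∀ {z} → z ∈ D → z ≡ v ⊎ z ≡ u
      flipped z∈ = [ inj₂ , inj₁ ]′ (pair z∈)

      -- Here `x` and `u` are removed, leaving `v` with only `y` below it. Were this pair blocked,
      -- its witness and that of `z` with `v` would share `x` and be nested. One inclusion puts `u`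
      -- below `v`, where only `x` and `y` are allowed; the other puts `y` below `u`.
      two-others : ∀ {a x y z} → a ∈ N → x ∈ N → y ∈ N → z ∈ N → x ≢ y → x ≢ z → y ≢ z →
        Below u a → ¬ Below u x → ¬ Below u y → ¬ Below u z → Below v x → Below v y → ¬ Below v z →
        Blocked N D x v → Blocked N D y v → Blocked N D z v → Good
      two-others {a} {x} {y} {z} a∈ x∈ y∈ z∈ x≢y x≢z y≢z ua ux uy uz vx vy vz Bx By Bz =
        keep-mixed v∈ u∈ (u≢v ∘ sym) flipped x∈ free y∈ (x≢y ∘ sym) vy a∈ z∈
          (λ { refl → ux ua }) (x≢z ∘ sym) (λ { refl → uz ua })
          (λ va → [ (λ { refl → ux ua }) , (λ { refl → uy ua }) ]′ (vin (inj₁ a∈) va)) vz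
        where
          vin : ∀ {w} → Special N D w → Below v w → w ≡ x ⊎ w ≡ y
          vin = two-blocked-below valid x∈ y∈ x≢y vx vy Bx By
          free : ¬ Blocked N D x u
          free B with blocked-above valid x∈ u∈ ux B | blocked-above valid z∈ v∈ vz Bz
          ... | k , ku , kx , kin | i , iv , iz , iin with laminar {k} {i} kx (S-trans iv (proj₁ vx))
          ... | inj₁ sub = [ (λ { refl → disjoint x∈ u∈ }) , (λ { refl → disjoint y∈ u∈ }) ]′
                  (vin (inj₂ u∈) (iin (inj₂ u∈) (sub u ku) (λ { refl → disjoint z∈ u∈ }) u≢v))
          ... | inj₂ sup = uy (kin (inj₁ y∈) (sup y (S-trans iv (proj₁ vy))) (x≢y ∘ sym) (λ { refl → disjoint y∈ u∈ }))

      -- Any unblocked leaf other than `a` can go with `v`, as `u` keeps just `a` below it. If all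
      -- three are blocked, exactly two of them lie below `v`.
      one-below : ∀ {a b c d} → a ∈ N → b ∈ N → c ∈ N → d ∈ N → b ≢ c → b ≢ d → c ≢ d →
        Below u a → ¬ Below u b → ¬ Below u c → ¬ Below u d → Good
      one-below {a} {b} {c} {d} a∈ b∈ c∈ d∈ b≢c b≢d c≢d ua ub uc ud
        with Blocked? N D b v | Blocked? N D c v | Blocked? N D d v
      ... | no free | _ | _ = keep-mixed u∈ v∈ u≢v pair b∈ free a∈ (λ { refl → ub ua }) ua c∈ d∈ (b≢c ∘ sym) (b≢d ∘ sym) c≢d uc ud
      ... | _ | no free | _ = keep-mixed u∈ v∈ u≢v pair c∈ free a∈ (λ { refl → uc ua }) ua b∈ d∈ b≢c (c≢d ∘ sym) b≢d ub ud
      ... | _ | _ | no free = keep-mixed u∈ v∈ u≢v pair d∈ free a∈ (λ { refl → ud ua }) ua b∈ c∈ b≢d c≢d b≢c ub uc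
      ... | yes Bb | yes Bc | yes Bd with Below? v b | Below? v c | Below? v d
      ... | no vb | no vc | _ = ⊥-elim (two-blocked-above valid v∈ b∈ c∈ b≢c vb vc Bb Bc)
      ... | no vb | _ | no vd = ⊥-elim (two-blocked-above valid v∈ b∈ d∈ b≢d vb vd Bb Bd)
      ... | _ | no vc | no vd = ⊥-elim (two-blocked-above valid v∈ c∈ d∈ c≢d vc vd Bc Bd)
      ... | yes vb | yes vc | yes vd = ⊥-elim ([ b≢d ∘ sym , c≢d ∘ sym ]′
              (two-blocked-below valid b∈ c∈ b≢c vb vc Bb Bc (inj₁ d∈) vd))
      ... | yes vb | yes vc | no vd = two-others a∈ b∈ c∈ d∈ b≢c b≢d c≢d ua ub uc ud vb vc vd Bb Bc Bd
      ... | yes vb | no vc | yes vd = two-others a∈ b∈ d∈ c∈ b≢d b≢c (c≢d ∘ sym) ua ub ud uc vb vd vc Bb Bd Bc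
      ... | no vb | yes vc | yes vd = two-others a∈ c∈ d∈ b∈ c≢d (b≢c ∘ sym) (b≢d ∘ sym) ua uc ud ub vc vd vb Bc Bd Bb

      under : ∀ {x y} → x ∈ N → Below u x → Below v x → y ∈ N → Below u y → ¬ Below v y → S u v ≡ true
      under x∈ ux vx y∈ uy vy with comparable (proj₁ ux) (proj₁ vx)
      ... | inj₁ uv = uv
      ... | inj₂ vu = ⊥-elim (vy (Below-⊆ vu uy))

      -- If `a` or `b` is unblocked it goes with `v`. Otherwise one of them at least is below `v`.
      -- If just one is, then `v` is below `u` and has a single leaf. If both are, `u` is above `v`,
      -- and `a` can go with `u`: a blocking set would contain `v` but miss `a`.
      two-below : ∀ {a b c d x y} → a ∈ N → b ∈ N → c ∈ N → d ∈ N → a ≢ b → c ≢ d →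
        Below u a → Below u b → ¬ Below u c → ¬ Below u d → (∀ {x} → x ∈ N → Below u x → x ≡ a ⊎ x ≡ b) →
        x ∈ N → y ∈ N → x ≢ y → Below v x → Below v y → Good
      two-below {a} {b} {c} {d} {x} {y} a∈ b∈ c∈ d∈ a≢b c≢d ua ub uc ud uin x∈ y∈ x≢y vx vy
        with Blocked? N D a v | Blocked? N D b v
      ... | no free | _ = keep-mixed u∈ v∈ u≢v pair a∈ free b∈ (a≢b ∘ sym) ub c∈ d∈
                            (λ { refl → uc ua }) (λ { refl → ud ua }) c≢d uc ud
      ... | _ | no free = keep-mixed u∈ v∈ u≢v pair b∈ free a∈ a≢b ua c∈ d∈
                            (λ { refl → uc ub }) (λ { refl → ud ub }) c≢d uc ud
      ... | yes Ba | yes Bb with Below? v a | Below? v b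
      ... | no va | no vb = ⊥-elim (two-blocked-above valid v∈ a∈ b∈ a≢b va vb Ba Bb)
      ... | yes va | no vb = ⊥-elim (x≢y (trans (only-a x∈ vx) (sym (only-a y∈ vy))))
        where
          uv : S u v ≡ true
          uv = under a∈ ua va b∈ ub vb
          only-a : ∀ {w} → w ∈ N → Below v w → w ≡ a
          only-a w∈ vw = [ id , (λ { refl → ⊥-elim (vb vw) }) ]′ (uin w∈ (Below-⊆ uv vw))
      ... | no va | yes vb = ⊥-elim (x≢y (trans (only-b x∈ vx) (sym (only-b y∈ vy))))
        where
          uv : S u v ≡ true
          uv = under b∈ ub vb a∈ ua va
          only-b : ∀ {w} → w ∈ N → Below v w → w ≡ b
          only-b w∈ vw = [ (λ { refl → ⊥-elim (va vw) }) , id ]′ (uin w∈ (Below-⊆ uv vw))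
      ... | yes va | yes vb = keep-mixed v∈ u∈ (u≢v ∘ sym) flipped a∈ free b∈ (a≢b ∘ sym) vb c∈ d∈
              (λ { refl → uc ua }) (λ { refl → ud ua }) c≢d (uc ∘ Below-⊆ uv) (ud ∘ Below-⊆ uv)
        where
          uv : S u v ≡ true
          uv with comparable (proj₁ ua) (proj₁ va)
          ... | inj₁ e = e
          ... | inj₂ vu = ⊥-elim ([ (λ { refl → disjoint a∈ u∈ }) , (λ { refl → disjoint b∈ u∈ }) ]′
                  (two-blocked-below valid a∈ b∈ a≢b va vb Ba Bb (inj₂ u∈) (vu , u≢v ∘ sym)))
          free : ¬ Blocked N D a u
          free B with blocked-below valid ua B
          ... | j , ja , jin = contra (S-trans (jin (inj₂ v∈) (uv , u≢v) (λ { refl → disjoint a∈ v∈ })) (proj₁ va)) ja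

    -- A set containing `v` and `d` also contains `u`, which lies between; as `u` is not below `v`,
    -- the pair of `d` and `v` is not blocked.
    three-below : ∀ {u v a d} → u ∈ D → v ∈ D → u ≢ v → (∀ {z} → z ∈ D → z ≡ u ⊎ z ≡ v) → S u v ≡ true →
      a ∈ N → d ∈ N → a ≢ d → ¬ Below u d → (∀ {x} → x ∈ N → x ≢ d → Below u x) → Good
    three-below {u} {v} {a} {d} u∈ v∈ u≢v pair uv a∈ d∈ a≢d ud uin = keep-all u∈ v∈ u≢v pair d∈ free a∈ a≢d uin
      where
        free : ¬ Blocked N D d v
        free B with blocked-above valid d∈ v∈ (ud ∘ Below-⊆ uv) B
        ... | i , iv , id∈ , iin with laminar {i} {u} iv uv
        ... | inj₁ sub = ud (sub d id∈ , λ { refl → disjoint d∈ u∈ })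
        ... | inj₂ sup = u≢v (S-antisym uv (proj₁ (iin (inj₂ u∈) (sup u (S-refl (proj₁ (in⇒≢root {u} uv))))
                (λ { refl → disjoint d∈ u∈ }) u≢v)))

    avoid-Ta : ∀ {u v} → u ∈ D → v ∈ D → u ≢ v → (∀ {z} → z ∈ D → z ≡ u ⊎ z ≡ v) → Good
    avoid-Ta {u} {v} u∈ v∈ u≢v pair with profile u∈ | profile v∈
    ... | four a∈ b∈ _ a≢b _ _ all | _ = four-below u∈ v∈ u≢v pair a∈ b∈ a≢b all
    ... | _ | four a∈ b∈ _ a≢b _ _ all = four-below v∈ u∈ (u≢v ∘ sym) (Pair.flipped u∈ v∈ u≢v pair) a∈ b∈ a≢b all
    ... | one a∈ b∈ c∈ d∈ p q r ua ub uc ud | _ = Pair.one-below u∈ v∈ u≢v pair a∈ b∈ c∈ d∈ p q r ua ub uc ud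
    ... | _ | one a∈ b∈ c∈ d∈ p q r va vb vc vd =
      Pair.one-below v∈ u∈ (u≢v ∘ sym) (Pair.flipped u∈ v∈ u≢v pair) a∈ b∈ c∈ d∈ p q r va vb vc vd
    ... | two a∈ b∈ c∈ d∈ p q ua ub uc ud uin | two x∈ y∈ _ _ x≢y _ vx vy _ _ _ =
      Pair.two-below u∈ v∈ u≢v pair a∈ b∈ c∈ d∈ p q ua ub uc ud uin x∈ y∈ x≢y vx vy
    ... | two a∈ b∈ c∈ d∈ p q ua ub uc ud uin | three x∈ y∈ _ _ x≢y _ _ vx vy _ _ _ =
      Pair.two-below u∈ v∈ u≢v pair a∈ b∈ c∈ d∈ p q ua ub uc ud uin x∈ y∈ x≢y vx vy
    ... | three x∈ y∈ _ _ x≢y _ _ ux uy _ _ _ | two a∈ b∈ c∈ d∈ p q va vb vc vd vin =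
      Pair.two-below v∈ u∈ (u≢v ∘ sym) (Pair.flipped u∈ v∈ u≢v pair) a∈ b∈ c∈ d∈ p q va vb vc vd vin x∈ y∈ x≢y ux uy
    ... | three {a} {b} {c} {d} a∈ b∈ c∈ d∈ a≢b a≢c b≢c ua ub uc ud uin
        | three {d = e} x∈ _ _ e∈ _ _ _ vx _ _ ve vin with nested
      where
        -- Two three-element subsets of the four leaves meet.
        nested : S u v ≡ true ⊎ S v u ≡ true
        nested with a ≟ e
        ... | no a≢e   = comparable (proj₁ ua) (proj₁ (vin a∈ a≢e))
        ... | yes refl = comparable (proj₁ ub) (proj₁ (vin b∈ (a≢b ∘ sym)))
    ... | inj₁ uv = three-below u∈ v∈ u≢v pair uv a∈ d∈ (λ { refl → ud ua }) ud uin
    ... | inj₂ vu = three-below v∈ u∈ (u≢v ∘ sym) (Pair.flipped u∈ v∈ u≢v pair) vu x∈ e∈ (λ { refl → ve vx }) ve vin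

-- Only leaves left: rotation in depth-first order

thirds : ∀ k → ∃₂ λ q e → e ≤ 2 × k ≡ q + (q + (q + e))
thirds k = k / 3 , k DivMod.% 3 , ℕ.≤-pred (DivMod.m%n<n k 3) ,
    trans (DivMod.m≡m%n+[m/n]*n k 3) (regroup (k DivMod.% 3) (k / 3))
  where
    regroup : ∀ e q → e + q * 3 ≡ q + (q + (q + e))
    regroup = solve-∀

module Bound {n : ℕ} {G : Graph n} (R : Rooted G) (pos : Fin n → ℕ)
  (convex : ∀ i {x y z} → pos x ≤ pos y → pos y ≤ pos z →
    Rooted.S R i x ≡ true → Rooted.S R i z ≡ true → Rooted.S R i y ≡ true) where
  open Rooted R
  open Tree R
  open Chords R
  open Reductions R
  open FourTwo R

  open import Data.List.Sort (On.decTotalOrder ℕ.≤-decTotalOrder pos) using (sort; sort-↭; sort-↗)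

  split-false : ∀ {i j x} → Diff i j x ≡ false → S i x ≡ true → S j x ≡ true
  split-false e t = trans (sym (xor-≡ e)) t

  module _ {i j p₁ p₂ p₃ p₄ p₅} (le₁ : pos p₁ ≤ pos p₂) (le₂ : pos p₂ ≤ pos p₃) (le₃ : pos p₃ ≤ pos p₄)
    (le₄ : pos p₄ ≤ pos p₅) (d₂ : Diff i j p₂ ≡ false) (d₄ : Diff i j p₄ ≡ false) (d₅ : Diff i j p₅ ≡ true) where

    alternation-same : S i p₁ ≡ true → S i p₃ ≡ true → S j p₃ ≡ false → ⊥
    alternation-same i₁ i₃ j₃ = [ (λ p → contra (convex j le₂ le₃ j₂ (split-false {i} {j} d₄ (convex i le₃ le₄ i₃ (proj₁ p)))) j₃)
                                , (λ p → contra (convex j le₂ (ℕ.≤-trans le₃ le₄) j₂ (proj₂ p)) j₃) ]′ (xor-split _ _ d₅)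
      where
        j₂ : S j p₂ ≡ true
        j₂ = split-false {i} {j} d₂ (convex i le₁ le₂ i₁ i₃)

    alternation-switch : S i p₁ ≡ true → S j p₃ ≡ true → S i p₃ ≡ false → ⊥
    alternation-switch i₁ j₃ i₃ =
      [ (λ p → contra (convex i (ℕ.≤-trans le₁ le₂) (ℕ.≤-trans le₃ le₄) i₁ (proj₁ p)) i₃)
      , (λ p → contra (convex i (ℕ.≤-trans le₁ le₂) le₃ i₁
                 (split-false {j} {i} (trans (Diff-comm j i _) d₄) (convex j le₃ le₄ j₃ (proj₂ p)))) i₃) ]′ (xor-split _ _ d₅)

  -- The symmetric difference of two intervals consists of at most two runs; the pattern has three.
  no-alternation : ∀ i j {p₁ p₂ p₃ p₄ p₅} → pos p₁ ≤ pos p₂ → pos p₂ ≤ pos p₃ → pos p₃ ≤ pos p₄ → pos p₄ ≤ pos p₅ →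
    Diff i j p₁ ≡ true → Diff i j p₂ ≡ false → Diff i j p₃ ≡ true → Diff i j p₄ ≡ false → Diff i j p₅ ≡ true → ⊥
  no-alternation i j le₁ le₂ le₃ le₄ d₁ d₂ d₃ d₄ d₅ with xor-split _ _ d₁ | xor-split _ _ d₃
  ... | inj₁ (i₁ , _) | inj₁ (i₃ , j₃) = alternation-same {i} {j} le₁ le₂ le₃ le₄ d₂ d₄ d₅ i₁ i₃ j₃
  ... | inj₁ (i₁ , _) | inj₂ (i₃ , j₃) = alternation-switch {i} {j} le₁ le₂ le₃ le₄ d₂ d₄ d₅ i₁ j₃ i₃
  ... | inj₂ (_ , j₁) | inj₁ (i₃ , j₃) = alternation-switch {j} {i} le₁ le₂ le₃ le₄
          (trans (Diff-comm j i _) d₂) (trans (Diff-comm j i _) d₄) (trans (Diff-comm j i _) d₅) j₁ i₃ j₃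
  ... | inj₂ (_ , j₁) | inj₂ (i₃ , j₃) = alternation-same {j} {i} le₁ le₂ le₃ le₄
          (trans (Diff-comm j i _) d₂) (trans (Diff-comm j i _) d₄) (trans (Diff-comm j i _) d₅) j₁ j₃ i₃

  at : List V → ℕ → V
  at []       _       = root
  at (x ∷ xs) zero    = x
  at (x ∷ xs) (suc k) = at xs k

  at-∈ : ∀ xs {k} → k < length xs → at xs k ∈ xs
  at-∈ (x ∷ xs) {zero}  _        = here refl
  at-∈ (x ∷ xs) {suc k} (s≤s lt) = there (at-∈ xs lt)

  ∈-at : ∀ {x xs} → x ∈ xs → ∃[ k ] (k < length xs × at xs k ≡ x)
  ∈-at (here refl) = 0 , s≤s z≤n , refl
  ∈-at (there i) with ∈-at i
  ... | k , lt , e = suc k , s≤s lt , e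

  at-sorted : ∀ {xs} → AllPairs (λ x y → pos x ≤ pos y) xs → ∀ {i j} → i ≤ j → j < length xs →
    pos (at xs i) ≤ pos (at xs j)
  at-sorted (al ∷ _) {zero} {zero} _ _ = ℕ.≤-refl
  at-sorted {x ∷ xs} (al ∷ _) {zero} {suc j} _ (s≤s lt) = All.lookup al (at-∈ xs lt)
  at-sorted (_ ∷ s) {suc i} {suc j} (s≤s le) (s≤s lt) = at-sorted s le lt

  -- With leaves ℓ₀ = root, ℓ₁, …, ℓ_{3q-1} in depth-first order, every descendant set is an interval
  -- avoiding ℓ₀.  A union of rotation classes {ℓ_k, ℓ_{k+q}, ℓ_{k+2q}} that is a difference of two
  -- intervals would alternate five times.
  module _ {N : List V} {q e : ℕ} (e≤2 : e ≤ 2) (eq : suc (length N) ≡ suc q + (suc q + (suc q + e))) where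

    Ns : List V
    Ns = sort N

    Ns-length : length Ns ≡ length N
    Ns-length = ↭-length (sort-↭ N)

    Ns-sorted : AllPairs (λ x y → pos x ≤ pos y) Ns
    Ns-sorted = Linked⇒AllPairs ℕ.≤-trans (sort-↗ N)

    ℓ : ℕ → V
    ℓ = at (root ∷ Ns)

    ℓ-mono : ∀ {i j} → 1 ≤ i → i ≤ j → j < suc (length N) → pos (ℓ i) ≤ pos (ℓ j)
    ℓ-mono (s≤s _) (s≤s le) (s≤s lt) = at-sorted Ns-sorted le (subst (_ <_) (sym Ns-length) lt)

    ℓ-end : ∀ {k} → k < suc (length N) → End N [] (ℓ k)
    ℓ-end {zero}  _        = inj₁ refl
    ℓ-end {suc k} (s≤s lt) = inj₂ (inj₁ (∈-resp-↭ (sort-↭ N) (at-∈ Ns (subst (k <_) (sym Ns-length) lt))))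

    -- With `suc q` as the number of classes, each class is joined by two chords, the exact price of
    -- three leaves. The `e` leaves left over are tied to the root, which exceeds their weight by
    -- one each; the slack 2 allows for this as `e ≤ 2`.
    c₁ c₂ c₃ rotation : List (V × V)
    c₁ = map (λ k → ℓ k , ℓ (suc q + k)) (upTo (suc q))
    c₂ = map (λ k → ℓ (suc q + k) , ℓ (suc q + (suc q + k))) (upTo (suc q))
    c₃ = map (λ k → ℓ (suc q + (suc q + (suc q + k))) , root) (upTo e)
    rotation = c₁ ++ c₂ ++ c₃

    third-lt : ∀ {k} → k < e → suc q + (suc q + (suc q + k)) < suc (length N)
    third-lt {k} lt = subst (suc q + (suc q + (suc q + k)) <_) (sym eq) (ℕ.+-monoʳ-< (suc q) (ℕ.+-monoʳ-< (suc q) (ℕ.+-monoʳ-< (suc q) lt)))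

    second-lt : ∀ {k} → k < suc q → suc q + (suc q + k) < suc (length N)
    second-lt {k} lt = subst (suc q + (suc q + k) <_) (sym eq) (ℕ.+-monoʳ-< (suc q) (ℕ.+-monoʳ-< (suc q) (ℕ.≤-trans lt (ℕ.m≤m+n _ e))))

    first-lt : ∀ {k} → k < suc q → suc q + k < suc (length N)
    first-lt lt = ℕ.≤-<-trans (ℕ.+-monoʳ-≤ (suc q) (ℕ.m≤n+m _ (suc q))) (second-lt lt)

    zeroth-lt : ∀ {k} → k < suc q → k < suc (length N)
    zeroth-lt lt = ℕ.≤-<-trans (ℕ.m≤n+m _ (suc q)) (first-lt lt)

    ∈c₁ : ∀ {k} → k < suc q → (ℓ k , ℓ (suc q + k)) ∈ rotation
    ∈c₁ lt = ∈-++⁺ˡ (∈-map⁺ _ (∈-upTo⁺ lt))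

    ∈c₂ : ∀ {k} → k < suc q → (ℓ (suc q + k) , ℓ (suc q + (suc q + k))) ∈ rotation
    ∈c₂ lt = ∈-++⁺ʳ c₁ (∈-++⁺ˡ (∈-map⁺ _ (∈-upTo⁺ lt)))

    ∈c₃ : ∀ {k} → k < e → (ℓ (suc q + (suc q + (suc q + k))) , root) ∈ rotation
    ∈c₃ lt = ∈-++⁺ʳ c₁ (∈-++⁺ʳ c₂ (∈-map⁺ _ (∈-upTo⁺ lt)))

    rotation-separates : Separating N [] rotation
    rotation-separates i j ag (inj₁ x∈) with ∈-at (∈-resp-↭ (↭-sym (sort-↭ N)) x∈)
    ... | k , lt , refl = everywhere (suc k) (s≤s (subst (k <_) Ns-length lt))
      where
        δ : ℕ → Bool
        δ k = Diff i j (ℓ k)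
        -- The class of the root contributes two zeros, at `suc q` and twice `suc q`; they
        -- interleave with the three members of the class of `k`.
        low : ∀ k → k < suc q → δ k ≡ false
        low zero _ = Diff-root i j
        low (suc k) lt = Bool.¬-not λ t → no-alternation i j
          {ℓ (suc k)} {ℓ (suc q + 0)} {ℓ (suc q + suc k)} {ℓ (suc q + (suc q + 0))} {ℓ (suc q + (suc q + suc k))}
          (ℓ-mono (s≤s z≤n) (ℕ.≤-trans (ℕ.<⇒≤ lt) (ℕ.m≤m+n _ 0)) (first-lt (s≤s z≤n)))
          (ℓ-mono (s≤s z≤n) (ℕ.+-monoʳ-≤ (suc q) z≤n) (first-lt lt))
          (ℓ-mono (s≤s z≤n) (ℕ.+-monoʳ-≤ (suc q) (ℕ.≤-trans (ℕ.<⇒≤ lt) (ℕ.m≤m+n _ 0))) (second-lt (s≤s z≤n)))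
          (ℓ-mono (s≤s z≤n) (ℕ.+-monoʳ-≤ (suc q) (ℕ.+-monoʳ-≤ (suc q) z≤n)) (second-lt lt))
          t (trans (sym (ag (∈c₁ (s≤s z≤n)))) (Diff-root i j))
          (trans (sym (ag (∈c₁ lt))) t)
          (trans (sym (ag (∈c₂ (s≤s z≤n)))) (trans (sym (ag (∈c₁ (s≤s z≤n)))) (Diff-root i j)))
          (trans (sym (ag (∈c₂ lt))) (trans (sym (ag (∈c₁ lt))) t))
        middle : ∀ k → k < suc q → δ (suc q + k) ≡ false
        middle k lt = trans (sym (ag (∈c₁ lt))) (low k lt)
        past : ∀ k m → ¬ (k < m) → ∃[ r ] (k ≡ m + r)
        past k m ge = k ∸ m , sym (ℕ.m+[n∸m]≡n (ℕ.≮⇒≥ ge))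
        everywhere : ∀ k → k < suc (length N) → δ k ≡ false
        everywhere k lt with k ℕ.<? suc q
        ... | yes p = low k p
        ... | no np with past k (suc q) np
        ... | k₁ , refl with k₁ ℕ.<? suc q
        ... | yes p = middle k₁ p
        ... | no np₁ with past k₁ (suc q) np₁
        ... | k₂ , refl with k₂ ℕ.<? suc q
        ... | yes p = trans (sym (ag (∈c₂ p))) (middle k₂ p)
        ... | no np₂ with past k₂ (suc q) np₂
        ... | k₃ , refl = trans (ag (∈c₃ (ℕ.+-cancelˡ-< (suc q) _ _ (ℕ.+-cancelˡ-< (suc q) _ _
                            (ℕ.+-cancelˡ-< (suc q) _ _ (subst (suc q + (suc q + (suc q + k₃)) <_) eq lt)))))) (Diff-root i j)

    rotation-ends : ∀ {m} → m ∈ rotation → End N [] (proj₁ m) × End N [] (proj₂ m)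
    rotation-ends m∈ with ∈-++⁻ c₁ m∈
    ... | inj₁ p with ∈-map⁻ _ p
    ...   | k , k∈ , refl = ℓ-end (zeroth-lt (∈-upTo⁻ k∈)) , ℓ-end (first-lt (∈-upTo⁻ k∈))
    rotation-ends m∈ | inj₂ p with ∈-++⁻ c₂ p
    ...   | inj₁ p′ with ∈-map⁻ _ p′
    ...     | k , k∈ , refl = ℓ-end (first-lt (∈-upTo⁻ k∈)) , ℓ-end (second-lt (∈-upTo⁻ k∈))
    rotation-ends m∈ | inj₂ p | inj₂ p′ with ∈-map⁻ _ p′
    ...     | k , k∈ , refl = ℓ-end (third-lt (∈-upTo⁻ k∈)) , inj₁ refl

    rotation-length : length rotation ≡ suc q + (suc q + e)
    rotation-length = trans (List.length-++ c₁) (cong₂ _+_ (len (suc q))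
      (trans (List.length-++ c₂) (cong₂ _+_ (len (suc q)) (len e))))
      where
        len : ∀ {f : ℕ → V × V} k → length (map f (upTo k)) ≡ k
        len {f} k = trans (List.length-map f (upTo k)) (List.length-upTo k)

    leaves-solution : Solution N []
    leaves-solution = record
      { chords = rotation ; separating = rotation-separates ; ends-in = rotation-ends
      ; two≤ = subst (2 ≤_) (sym rotation-length) (s≤s (ℕ.≤-trans (s≤s z≤n) (ℕ.m≤n+m _ q)))
      ; size = subst₂ (λ a b → 3 * a ≤ 2 * b + 0 + 2) (sym rotation-length) (sym eq)
                 (subst₂ _≤_ (sym (lhs (suc q) e)) (sym (rhs (suc q) e)) (ℕ.+-monoʳ-≤ (6 * suc q + 2 * e) e≤2)) }
      where
        lhs : ∀ q e → 3 * (q + (q + e)) ≡ (6 * q + 2 * e) + e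
        lhs = solve-∀
        rhs : ∀ q e → 2 * (q + (q + (q + e))) + 0 + 2 ≡ (6 * q + 2 * e) + 2
        rhs = solve-∀

-- The upper bound by induction on the degree-2 vertices

module Upper {n : ℕ} {G : Graph n} (R : Rooted G) (pos : Fin n → ℕ)
  (convex : ∀ i {x y z} → pos x ≤ pos y → pos y ≤ pos z →
    Rooted.S R i x ≡ true → Rooted.S R i z ≡ true → Rooted.S R i y ≡ true) where
  open Rooted R
  open Tree R
  open Chords R
  open Reductions R
  open FourTwo R
  open Bound R pos convex

  -- Tying everything to the root costs one chord per vertex, which the budget permits up to two
  -- leaves.
  star-solution : ∀ {N D} → 1 ≤ length N → length N ≤ 2 → length D ≡ 1 → Solution N D
  star-solution {N} {D} 1≤N N≤2 D≡1 = record
    { chords = map (λ x → x , root) (N ++ D)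
    ; separating = λ i j ag s → trans (ag (∈-map⁺ _ (special-∈ s))) (Diff-root i j)
    ; ends-in = λ m∈ → case ∈-map⁻ _ m∈ of λ { (x , x∈ , refl) → inj₂ (∈-++⁻ N x∈) , inj₁ refl }
    ; two≤ = subst (2 ≤_) (sym len) (s≤s 1≤N)
    ; size = subst₂ (λ a b → 3 * a ≤ 2 * suc (length N) + b + 2) (sym len) (sym D≡1)
               (subst₂ _≤_ (sym (lhs (length N))) (sym (rhs (length N))) (ℕ.+-monoʳ-≤ (2 * length N + 3) N≤2)) }
    where
      len : length (map (λ x → x , root) (N ++ D)) ≡ suc (length N)
      len = trans (List.length-map _ (N ++ D)) (trans (List.length-++ N) (trans (cong (length N +_) D≡1) (ℕ.+-comm (length N) 1)))
      lhs : ∀ k → 3 * suc k ≡ (2 * k + 3) + k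
      lhs = solve-∀
      rhs : ∀ k → 2 * suc k + 1 + 2 ≡ (2 * k + 3) + 2
      rhs = solve-∀

  -- On the path root, `v`, `u`, `l`, the vertex `u` is settled by the root. A set that contains `v`
  -- contains `u`; its partner then contains `u` too, so both contain `l`.
  P4-solution : ∀ {l u v N D} → l ∈ N → u ∈ D → v ∈ D → (∀ {x} → x ∈ N → x ≡ l) →
    (∀ {z} → z ∈ D → z ≡ u ⊎ z ≡ v) → S u l ≡ true → S v u ≡ true → length N ≡ 1 → length D ≡ 2 → Solution N D
  P4-solution {l} {u} {v} {N} {D} l∈ u∈ v∈ only pair ul vu N≡1 D≡2 = record
    { chords = (u , root) ∷ (v , l) ∷ []
    ; separating = λ i j ag → λ where
        (inj₁ x∈) → subst (λ x → Diff i j x ≡ false) (sym (only x∈)) (l-false i j ag)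
        (inj₂ x∈) → [ (λ { refl → u-false i j ag })
                    , (λ { refl → trans (ag (there (here refl))) (l-false i j ag) }) ]′ (pair x∈)
    ; ends-in = λ { (here refl) → inj₂ (inj₂ u∈) , inj₁ refl ; (there (here refl)) → inj₂ (inj₂ v∈) , inj₂ (inj₁ l∈) }
    ; two≤ = s≤s (s≤s z≤n)
    ; size = subst₂ (λ a b → 6 ≤ 2 * suc a + b + 2) (sym N≡1) (sym D≡2) (s≤s (s≤s (s≤s (s≤s (s≤s (s≤s z≤n)))))) }
    where
      Agrees : V → V → Set
      Agrees i j = Agree i j ((u , root) ∷ (v , l) ∷ [])
      u-false : ∀ i j → Agrees i j → Diff i j u ≡ false
      u-false i j ag = trans (ag (here refl)) (Diff-root i j)
      same-l : ∀ i j → Diff i j u ≡ false → S i v ≡ true → Diff i j l ≡ false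
      same-l i j du iv = ≡-xor (trans (S-trans iu ul) (sym (S-trans (split-false {i} {j} du iu) ul)))
        where
          iu : S i u ≡ true
          iu = S-trans iv vu
      l-false : ∀ i j → Agrees i j → Diff i j l ≡ false
      l-false i j ag = Bool.¬-not λ t → case xor-split _ _ (trans (ag (there (here refl))) t) of λ where
        (inj₁ (iv , _)) → contra t (same-l i j (u-false i j ag) iv)
        (inj₂ (_ , jv)) → contra t (trans (Diff-comm i j l)
                            (same-l j i (trans (Diff-comm j i u) (u-false i j ag)) jv))

  two-elements : ∀ {D : List V} → Unique D → length D ≡ 2 →
    ∃₂ λ u v → u ∈ D × v ∈ D × u ≢ v × (∀ {z} → z ∈ D → z ≡ u ⊎ z ≡ v)
  two-elements {u ∷ v ∷ []} ((u≢v ∷ []) ∷ _) refl = u , v , here refl , there (here refl) , u≢v ,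
    λ { (here e) → inj₁ e ; (there (here e)) → inj₂ e }

  head-∈ : ∀ {xs : List V} → 1 ≤ length xs → ∃[ x ] (x ∈ xs)
  head-∈ {x ∷ xs} _ = x , here refl

  one-element : ∀ {N : List V} → length N ≡ 1 → ∃[ l ] (l ∈ N × (∀ {x} → x ∈ N → x ≡ l))
  one-element {l ∷ []} refl = l , here refl , λ { (here e) → e }

  sole-small : ∀ {N D} → Unique D → TaShape N D → length D ≤ 1
  sole-small {D = []} _ _ = z≤n
  sole-small {D = x ∷ []} _ _ = s≤s z≤n
  sole-small {D = x ∷ y ∷ _} ((x≢y ∷ _) ∷ _) t =
    ⊥-elim (x≢y (trans (TaShape.sole t (here refl)) (sym (TaShape.sole t (there (here refl))))))

  shape⇒like : ∀ {N D} → Valid N D → length N ≡ 3 → length D ≡ 1 → TaShape N D → TaLike N D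
  shape⇒like {N} {D} valid N≡3 D≡1 t with Any.any? (λ x → ¬? (x ≟ a) ×-dec ¬? (x ≟ b)) N
    where open TaShape t
  ... | yes p = let x , x∈ , x≢a , x≢b = find p in record
    { N≡3 = N≡3 ; D≡1 = D≡1 ; v∈ = v∈ ; a∈ = a∈ ; b∈ = b∈ ; c∈ = x∈ ; a≢b = a≢b ; va = va ; vb = vb
    ; vc = λ vx → [ x≢a , x≢b ]′ (exact x∈ vx) }
    where open TaShape t
  ... | no np = ⊥-elim (ℕ.<-irrefl refl (subst (_≤ 2) N≡3 (unique-⊆-length (Valid.uniqueN valid)
                  ((a≢b ∷ []) ∷ [] ∷ []) covered)))
    where
      open TaShape t
      covered : ∀ {x} → x ∈ N → x ∈ a ∷ b ∷ []
      covered {x} x∈ with x ≟ a | x ≟ b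
      ... | yes e | _ = here e
      ... | no _ | yes e = there (here e)
      ... | no p | no q = ⊥-elim (np (lose x∈ (p , q)))

  -- `D≤N` counts the root as a leaf and survives because a reduction takes one from each side. The
  -- last two fields exclude the positions of the single edge and of Tᵃ.
  record Few (d : ℕ) (N D : List V) : Set where
    field
      D≡    : length D ≡ d
      valid : Valid N D
      1≤N   : 1 ≤ length N
      D≤N   : d ≤ suc (length N)
      nontrivial : ¬ (length N ≡ 1 × d ≡ 0)
      unlike     : ¬ TaLike N D

  Progress : ℕ → List V → List V → Set
  Progress d N D = Solution N D ⊎ Σ (Reduction N D) λ r → Few d (Reduction.N′ r) (Reduction.D′ r)

  reduced : ∀ {d N D} → Few (suc d) N D → 2 ≤ length N → (r : Reduction N D) →
    ¬ (length (Reduction.N′ r) ≡ 1 × d ≡ 0) → ¬ TaLike (Reduction.N′ r) (Reduction.D′ r) →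
    Few d (Reduction.N′ r) (Reduction.D′ r)
  reduced few 2≤N r ne unlike′ = record
    { D≡ = ℕ.suc-injective (trans (sym (Removal.size removeD)) D≡) ; valid = Reduction.valid r
    ; 1≤N = ℕ.≤-pred (ℕ.≤-trans 2≤N (ℕ.≤-reflexive (Removal.size removeN)))
    ; D≤N = ℕ.≤-trans (ℕ.≤-pred D≤N) (ℕ.≤-reflexive (Removal.size removeN))
    ; nontrivial = ne ; unlike = unlike′ }
    where
      open Few few
      open Reduction r using (removeN; removeD)

  step-down : ∀ {d N D} → Few (suc d) N D → 2 ≤ length N → Reduction N D ⊎ TaShape N D
  step-down {d} {N} few 2≤N = reduce valid (proj₂ (head-∈ (ℕ.≤-trans (s≤s z≤n) (ℕ.≤-reflexive (sym D≡))))) 2≤N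
      (subst (_≤ suc (length N)) (sym D≡) D≤N)
    where open Few few

  no-shape : ∀ {d N D} → Few (suc (suc d)) N D → ¬ TaShape N D
  no-shape few t = ℕ.<-irrefl refl (ℕ.≤-trans (s≤s (s≤s z≤n))
      (subst (_≤ 1) D≡ (sole-small (Valid.uniqueD valid) t)))
    where open Few few

  path-P4 : ∀ {N D} → Few 2 N D → length N ≡ 1 → Solution N D
  path-P4 {N} {D} few N≡1 with one-element N≡1 | two-elements (Valid.uniqueD (Few.valid few)) (Few.D≡ few)
  ... | l , l∈ , only | u , v , u∈ , v∈ , u≢v , pair = choose (comparable (above u∈) (above v∈))
    where
      above : ∀ {z} → z ∈ D → S z l ≡ true
      above {z} z∈ = let x , x∈ , b , _ = Valid.hull (Few.valid few) z∈ in subst (λ x → S z x ≡ true) (only x∈) b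
      choose : S u v ≡ true ⊎ S v u ≡ true → Solution N D
      choose (inj₁ uv) = P4-solution l∈ v∈ u∈ only (λ z∈ → [ inj₂ , inj₁ ]′ (pair z∈)) (above v∈) uv N≡1 (Few.D≡ few)
      choose (inj₂ vu) = P4-solution l∈ u∈ v∈ only pair (above u∈) vu N≡1 (Few.D≡ few)

  -- The cases differ in what a reduction might reach. From one degree-2 vertex it could end at the
  -- single edge, so two leaves get a star. From two it could reach the position of Tᵃ, but only
  -- with four leaves. From more, at least two degree-2 vertices remain and neither can happen.
  progress-wide : ∀ d {N D} → Few (suc d) N D → 2 ≤ length N → Progress d N D
  progress-wide 0 {N} few 2≤N with length N ℕ.≟ 2
  ... | yes N≡2 = inj₁ (star-solution (Few.1≤N few) (ℕ.≤-reflexive N≡2) (Few.D≡ few))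
  ... | no N≢2 with step-down few 2≤N
  ...   | inj₁ r = inj₂ (r , reduced few 2≤N r
            (λ p → N≢2 (trans (Removal.size (Reduction.removeN r)) (cong suc (proj₁ p))))
            (λ t → case trans (Removal.size (Reduction.removeD r)) (cong suc (TaLike.D≡1 t)) of λ e →
              case trans (sym (Few.D≡ few)) e of λ ()))
  ...   | inj₂ t = ⊥-elim (Few.unlike few (shape⇒like (Few.valid few)
            (ℕ.≤-antisym (TaShape.small t) (ℕ.≤∧≢⇒< 2≤N (N≢2 ∘ sym))) (Few.D≡ few) t))
  progress-wide 1 {N} few 2≤N with length N ℕ.≟ 4
  ... | yes N≡4 with two-elements (Valid.uniqueD (Few.valid few)) (Few.D≡ few)
  ...   | u , v , u∈ , v∈ , u≢v , pair with avoid-Ta (Few.valid few) N≡4 u∈ v∈ u≢v pair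
  ...     | r , unlike = inj₂ (r , reduced few 2≤N r (λ { (_ , ()) }) unlike)
  progress-wide 1 {N} few 2≤N | no N≢4 with step-down few 2≤N
  ...   | inj₁ r = inj₂ (r , reduced few 2≤N r (λ { (_ , ()) })
            (λ t → N≢4 (trans (Removal.size (Reduction.removeN r)) (cong suc (TaLike.N≡3 t)))))
  ...   | inj₂ t = ⊥-elim (no-shape few t)
  progress-wide (suc (suc d)) few 2≤N with step-down few 2≤N
  ... | inj₁ r = inj₂ (r , reduced few 2≤N r (λ { (_ , ()) })
            (λ t → case trans (sym (Few.D≡ few)) (trans (Removal.size (Reduction.removeD r)) (cong suc (TaLike.D≡1 t))) of λ ()))
  ... | inj₂ t = ⊥-elim (no-shape few t)

  -- With one leaf besides the root, `D≤N` leaves room for at most two degree-2 vertices: the paths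
  -- on three and four vertices.
  progress : ∀ d {N D} → Few (suc d) N D → Progress d N D
  progress d {N} few with length N ℕ.≟ 1
  ... | no N≢1 = progress-wide d few (ℕ.≤∧≢⇒< (Few.1≤N few) (N≢1 ∘ sym))
  progress 0 few | yes N≡1 = inj₁ (star-solution (Few.1≤N few) (ℕ.≤-trans (ℕ.≤-reflexive N≡1) (s≤s z≤n)) (Few.D≡ few))
  progress 1 few | yes N≡1 = inj₁ (path-P4 few N≡1)
  progress (suc (suc d)) few | yes N≡1 with ℕ.≤-trans (Few.D≤N few) (ℕ.≤-reflexive (cong suc N≡1))
  ... | s≤s (s≤s ())

  many-leaves : ∀ d {N D} → Few d N D → Solution N D
  many-leaves zero {N} {[]} few with thirds (suc (length N))
  ... | suc q , e , e≤2 , eq = leaves-solution e≤2 eq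
  ... | zero , e , e≤2 , eq = ⊥-elim (Few.nontrivial few
        (ℕ.≤-antisym (ℕ.≤-pred (ℕ.≤-trans (ℕ.≤-reflexive eq) e≤2)) (Few.1≤N few) , refl))
  many-leaves zero {D = _ ∷ _} few with Few.D≡ few
  ... | ()
  many-leaves (suc d) few with progress d few
  ... | inj₁ sol = sol
  ... | inj₂ (r , few′) = Reduction.lift r (many-leaves d few′)

  -- More degree-2 vertices than leaves

  module _ {N D : List V} (valid : Valid N D) where
    open Valid valid

    Covers : V → V → Set
    Covers u v = S u v ≡ true × (∀ {x} → Special N D x → Below u x → x ≢ v → Below v x)

    -- Here `u` too lies in `S i` and not in `S j`, so `S j` is inside both `S u` and `S v`. It
    -- contains a leaf below `u`, whence `u` and `v` are comparable; all else that is special below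
    -- the upper one is in `S j` and so below the lower one.
    blocked⇒covers : ∀ {u v} → u ∈ D → v ∈ D → u ≢ v → Blocked N D u v → Covers u v ⊎ Covers v u
    blocked⇒covers {u} {v} u∈ v∈ u≢v (i , j , iv , jv , δ , al) with hull u∈ | hull v∈
    ... | y , y∈ , yb | z , z∈ , zb = cases (comparable (proj₁ yb) (j⊆v y jy))
      where
        at-other : ∀ {x} → Special N D x → x ≢ u → x ≢ v → S i x ≡ S j x
        at-other = elsewhere valid {i} {j} al
        inside : ∀ {k w x} → S k w ≡ false → S k x ≡ true → Below w x → ∀ t → S k t ≡ true → S w t ≡ true
        inside {k} {w} kw kx wx with laminar {k} {w} kx (proj₁ wx)
        ... | inj₁ sub = sub
        ... | inj₂ sup = ⊥-elim (contra (sup w (S-refl (proj₁ (in⇒≢root {w} (proj₁ wx))))) kw)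
        leaf≢ : ∀ {x w} → x ∈ N → w ∈ D → x ≢ w
        leaf≢ x∈ w∈ refl = disjoint x∈ w∈
        jz : S j z ≡ true
        jz = trans (sym (at-other (inj₁ z∈) (leaf≢ z∈ u∈) (leaf≢ z∈ v∈))) (S-trans iv (proj₁ zb))
        j⊆v : ∀ t → S j t ≡ true → S v t ≡ true
        j⊆v = inside {j} jv jz zb
        iu : S i u ≡ true × S j u ≡ false
        iu = [ id , (λ p → ⊥-elim (contra (S-trans iv (j⊆v u (proj₂ p))) (proj₁ p))) ]′ (xor-split _ _ δ)
        jy : S j y ≡ true
        jy = trans (sym (at-other (inj₁ y∈) (leaf≢ y∈ u∈) (leaf≢ y∈ v∈))) (S-trans (proj₁ iu) (proj₁ yb))
        j⊆u : ∀ t → S j t ≡ true → S u t ≡ true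
        j⊆u = inside {j} (proj₂ iu) jy yb
        cases : S u v ≡ true ⊎ S v u ≡ true → Covers u v ⊎ Covers v u
        cases (inj₁ uv) = inj₁ (uv , λ s b x≢v →
          j⊆v _ (trans (sym (at-other s (proj₂ b ∘ sym) x≢v)) (S-trans (proj₁ iu) (proj₁ b))) , x≢v ∘ sym)
        cases (inj₂ vu) = inj₂ (vu , λ s b x≢u →
          j⊆u _ (trans (sym (at-other s x≢u (proj₂ b ∘ sym))) (S-trans iv (proj₁ b))) , x≢u ∘ sym)

    covers-once : ∀ {u v w} → v ∈ D → w ∈ D → u ≢ v → u ≢ w → v ≢ w → Covers u v → Covers u w → ⊥
    covers-once v∈ w∈ u≢v u≢w v≢w (uv , vin) (uw , win) = v≢w (S-antisym
      (proj₁ (vin (inj₂ w∈) (uw , u≢w) (v≢w ∘ sym))) (proj₁ (win (inj₂ v∈) (uv , u≢v) v≢w)))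

    covers-acyclic : ∀ {u v w} → u ≢ v → Covers u v → Covers v w → Covers w u → ⊥
    covers-acyclic u≢v (uv , _) (vw , _) (wu , _) = u≢v (S-antisym uv (S-trans vw wu))

    -- If all three pairs were blocked, `Covers` would orient the triangle. Then either some vertex
    -- covers two others or there is a directed cycle, and both are impossible.
    some-free : ∀ {a b c} → a ∈ D → b ∈ D → c ∈ D → a ≢ b → a ≢ c → b ≢ c →
      ∃₂ λ u v → u ∈ D × v ∈ D × u ≢ v × ¬ Blocked N D u v
    some-free {a} {b} {c} a∈ b∈ c∈ a≢b a≢c b≢c with Blocked? N D a b | Blocked? N D a c | Blocked? N D b c
    ... | no f | _ | _ = a , b , a∈ , b∈ , a≢b , f
    ... | _ | no f | _ = a , c , a∈ , c∈ , a≢c , f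
    ... | _ | _ | no f = b , c , b∈ , c∈ , b≢c , f
    ... | yes p | yes q | yes r
        with blocked⇒covers a∈ b∈ a≢b p | blocked⇒covers a∈ c∈ a≢c q | blocked⇒covers b∈ c∈ b≢c r
    ... | inj₁ ab | inj₁ ac | _       = ⊥-elim (covers-once b∈ c∈ a≢b a≢c b≢c ab ac)
    ... | inj₁ ab | inj₂ ca | inj₁ bc = ⊥-elim (covers-acyclic a≢b ab bc ca)
    ... | inj₁ ab | inj₂ ca | inj₂ cb = ⊥-elim (covers-once a∈ b∈ (a≢c ∘ sym) (b≢c ∘ sym) a≢b ca cb)
    ... | inj₂ ba | _       | inj₁ bc = ⊥-elim (covers-once a∈ c∈ (a≢b ∘ sym) b≢c a≢c ba bc)
    ... | inj₂ ba | inj₁ ac | inj₂ cb = ⊥-elim (covers-acyclic a≢c ac cb ba)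
    ... | inj₂ ba | inj₂ ca | inj₂ cb = ⊥-elim (covers-once a∈ b∈ (a≢c ∘ sym) (b≢c ∘ sym) a≢b ca cb)

  hull-removal : ∀ {N D D′ v} → Valid N D → Removal v D D′ → Valid N D′
  hull-removal valid RD = record
    { uniqueN = uniqueN ; uniqueD = Removal.unique RD ; disjoint = λ i j → disjoint i (Removal.sub RD j)
    ; hull = λ i → hull (Removal.sub RD i) }
    where open Valid valid

  attach : ∀ {N D D′ v M} → Removal v D D′ → Separating N D′ M → Separating N D ((v , root) ∷ M)
  attach RD sep i j ag (inj₁ p) = sep i j (ag ∘ there) (inj₁ p)
  attach RD sep i j ag (inj₂ p) = [ (λ { refl → trans (ag (here refl)) (Diff-root i j) })
                                  , (λ q → sep i j (ag ∘ there) (inj₂ q)) ]′ (Removal.cover RD p)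

  join : ∀ {N D D₁ D₂ u v M} → Removal u D D₁ → Removal v D₁ D₂ → ¬ Blocked N D u v →
    Separating N D₂ M → Separating N D ((u , v) ∷ M)
  join {N} {D} {D₁} {D₂} {u} {v} {M} R₁ R₂ free sep i j ag = λ where
      (inj₁ p) → old (inj₁ p)
      (inj₂ p) → case split p of λ where
        (inj₁ refl) → u-false
        (inj₂ (inj₁ refl)) → trans (sym (ag (here refl))) u-false
        (inj₂ (inj₂ q)) → old (inj₂ q)
    where
      old : ∀ {x} → Special N D₂ x → Diff i j x ≡ false
      old = sep i j (ag ∘ there)
      split : ∀ {x} → x ∈ D → x ≡ u ⊎ x ≡ v ⊎ x ∈ D₂
      split p = [ inj₁ , (λ q → inj₂ (Removal.cover R₂ q)) ]′ (Removal.cover R₁ p)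
      agree-at : ∀ {x} → x ∈ N ++ D → x ≡ u ⊎ x ≡ v ⊎ Diff i j x ≡ false
      agree-at x∈ with ∈-++⁻ N x∈
      ... | inj₁ p = inj₂ (inj₂ (old (inj₁ p)))
      ... | inj₂ p = [ inj₁ , [ inj₂ ∘ inj₁ , (λ q → inj₂ (inj₂ (old (inj₂ q)))) ]′ ]′ (split p)
      u-false : Diff i j u ≡ false
      u-false = Bool.¬-not λ t → case xor-split _ _ (trans (sym (ag (here refl))) t) of λ where
        (inj₁ (iv , jv)) → free (i , j , iv , jv , t ,
          All.tabulate λ x∈ → [ inj₁ , [ inj₂ ∘ inj₁ , (λ q → inj₂ (inj₂ (xor-≡ q))) ]′ ]′ (agree-at x∈))
        (inj₂ (iv , jv)) → free (j , i , jv , iv , trans (Diff-comm j i u) t ,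
          All.tabulate λ x∈ → [ inj₁ , [ inj₂ ∘ inj₁ , (λ q → inj₂ (inj₂ (sym (xor-≡ q)))) ]′ ]′ (agree-at x∈))

  three-elements : ∀ {D : List V} → Unique D → 3 ≤ length D →
    ∃[ a ] ∃[ b ] ∃[ c ] (a ∈ D × b ∈ D × c ∈ D × a ≢ b × a ≢ c × b ≢ c)
  three-elements {[]} _ ()
  three-elements {_ ∷ []} _ (s≤s ())
  three-elements {_ ∷ _ ∷ []} _ (s≤s (s≤s ()))
  three-elements {a ∷ b ∷ c ∷ _} ((a≢b ∷ a≢c ∷ _) ∷ (b≢c ∷ _) ∷ _) _ =
    a , b , c , here refl , there (here refl) , there (there (here refl)) , a≢b , a≢c , b≢c

  -- With h₁ degree-2 vertices the first budget reads 3m ≤ 3h₁ + 2, so m ≤ h₁, which is what the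
  -- second one allows.
  balanced : ∀ {N D} → length D ≡ suc (length N) → Valid N D → 1 ≤ length N →
    ∃[ M ] (Separating N D M × length M ≤ suc (length N))
  balanced {N} {D} D≡ valid 1≤N = chords , separating , ℕ.≮⇒≥ λ gt → ℕ.<-irrefl refl
      (subst (_≤ 2 * lv + lv + 2) (triple lv) (ℕ.≤-trans (ℕ.*-monoʳ-≤ 3 gt)
        (subst (λ d → 3 * length chords ≤ 2 * lv + d + 2) D≡ size)))
    where
      lv = suc (length N)
      few : Few lv N D
      few = record
        { D≡ = D≡ ; valid = valid ; 1≤N = 1≤N ; D≤N = ℕ.≤-refl ; nontrivial = λ { (_ , ()) }
        ; unlike = λ t → case trans (sym (TaLike.N≡3 t)) (ℕ.suc-injective (trans (sym D≡) (TaLike.D≡1 t))) of λ () }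
      open Solution (many-leaves lv few)
      triple : ∀ h → 3 * suc h ≡ suc (2 * h + h + 2)
      triple = solve-∀

  -- Joined pairs pay exactly in the second budget, and since leaves are not touched every hull
  -- survives. If the surplus is odd, one vertex goes to the root at the expense of rounding.
  many-nodes : ∀ k {N D} → length D ≡ suc (length N) + k → Valid N D → 1 ≤ length N →
    ∃[ M ] (Separating N D M × 2 * length M ≤ suc (length N) + length D + 1)
  many-nodes zero {N} {D} D≡ valid 1≤N with balanced (trans D≡ (ℕ.+-identityʳ _)) valid 1≤N
  ... | M , sep , le = M , sep , subst (λ d → 2 * length M ≤ suc (length N) + d + 1) (sym D≡)
        (ℕ.≤-trans (ℕ.*-monoʳ-≤ 2 le) (ℕ.≤-trans (ℕ.m≤m+n _ 1) (ℕ.≤-reflexive (double (suc (length N))))))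
    where
      double : ∀ h → 2 * h + 1 ≡ h + (h + 0) + 1
      double = solve-∀
  many-nodes (suc zero) {N} {D} D≡ valid 1≤N with head-∈ {D} (ℕ.≤-trans (s≤s z≤n) (ℕ.≤-reflexive (sym D≡)))
  ... | v , v∈ with remove (Valid.uniqueD valid) v∈
  ... | D′ , RD with balanced {N} {D′} (ℕ.suc-injective (trans (sym (Removal.size RD))
                       (trans D≡ (ℕ.+-comm (suc (length N)) 1)))) (hull-removal valid RD) 1≤N
  ... | M , sep , le = (v , root) ∷ M , attach RD sep , subst (λ d → 2 * suc (length M) ≤ suc (length N) + d + 1) (sym D≡)
        (ℕ.≤-trans (ℕ.*-monoʳ-≤ 2 (s≤s le)) (ℕ.≤-reflexive (double (suc (length N)))))
    where
      double : ∀ h → 2 * suc h ≡ h + (h + 1) + 1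
      double = solve-∀
  many-nodes (suc (suc k)) {N} {D} D≡ valid 1≤N with three-elements (Valid.uniqueD valid)
      (subst (3 ≤_) (sym D≡) (s≤s (ℕ.≤-trans (s≤s (s≤s z≤n)) (ℕ.m≤n+m (suc (suc k)) (length N)))))
  ... | a , b , c , a∈ , b∈ , c∈ , a≢b , a≢c , b≢c with some-free valid a∈ b∈ c∈ a≢b a≢c b≢c
  ... | u , v , u∈ , v∈ , u≢v , free with remove (Valid.uniqueD valid) u∈
  ... | D₁ , R₁ with remove (Removal.unique R₁) (Removal.keep R₁ v∈ (u≢v ∘ sym))
  ... | D₂ , R₂ with many-nodes k {N} {D₂} (ℕ.+-cancelˡ-≡ 2 _ _ (trans (sym D≡₂) (trans D≡ (shift (suc (length N)) k))))
                       (hull-removal (hull-removal valid R₁) R₂) 1≤N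
    where
      D≡₂ : length D ≡ 2 + length D₂
      D≡₂ = trans (Removal.size R₁) (cong suc (Removal.size R₂))
      shift : ∀ h k → h + suc (suc k) ≡ 2 + (h + k)
      shift = solve-∀
  ... | M , sep , le = (u , v) ∷ M , join R₁ R₂ free sep ,
        subst (λ d → 2 * suc (length M) ≤ suc (length N) + d + 1) (sym (trans (Removal.size R₁) (cong suc (Removal.size R₂))))
          (subst₂ _≤_ (sym (lhs (length M))) (sym (rhs (suc (length N)) (length D₂))) (ℕ.+-monoʳ-≤ 2 le))
    where
      lhs : ∀ m → 2 * suc m ≡ 2 + 2 * m
      lhs = solve-∀
      rhs : ∀ h d → h + suc (suc d) + 1 ≡ 2 + (h + d + 1)
      rhs = solve-∀

  separating-chords : ∀ {N D} → Valid N D → 1 ≤ length N → ¬ (length N ≡ 1 × length D ≡ 0) → ¬ TaLike N D →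
    ∃[ M ] (Separating N D M × (3 * length M ≤ 2 * suc (length N) + length D + 2
                               ⊎ 2 * length M ≤ suc (length N) + length D + 1))
  separating-chords {N} {D} valid 1≤N ne unlike with length D ℕ.≤? suc (length N)
  ... | yes D≤N = chords , separating , inj₁ size
    where
      few : Few (length D) N D
      few = record { D≡ = refl ; valid = valid ; 1≤N = 1≤N ; D≤N = D≤N ; nontrivial = ne ; unlike = unlike }
      open Solution (many-leaves (length D) few)
  ... | no gt with many-nodes (length D ∸ suc (length N)) (sym (ℕ.m+[n∸m]≡n (ℕ.<⇒≤ (ℕ.≰⇒> gt)))) valid 1≤N
  ...   | M , sep , le = M , sep , inj₂ le

-- The lower bound

module Lower {n : ℕ} {G : Graph n} (R : Rooted G) where
  open Rooted R
  open Tree R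

  -- The edge above `top` is the pendant edge of the leaf `root`; `top∉N` keeps it distinct from the
  -- other pendant edges. In `below`, the edge above `c` is the second edge at a degree-2 vertex.
  record Shape (N D : List (Fin n)) (top : Fin n) : Set where
    field
      uniqueN  : Unique N
      uniqueD  : Unique D
      disjoint : ∀ {x} → x ∈ N → x ∉ D
      N≢root   : ∀ {l} → l ∈ N → l ≢ root
      D≢root   : ∀ {v} → v ∈ D → v ≢ root
      leaf     : ∀ {l} → l ∈ N → ∀ {y} → S l y ≡ true → y ≡ l
      below    : ∀ {v} → v ∈ D → ∃[ c ] (c ≢ root × c ≢ v × (∀ {y} → y ≢ v → S v y ≡ S c y))
      top≢root : top ≢ root
      top-full : ∀ {y} → y ≢ root → S top y ≡ true
      top∉N    : top ∉ N

  is : Fin n → Fin n → Bool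
  is z x = does (x ≟ z)

  -- With `xor`, a one-vertex path ends nowhere, in keeping with its containing no edge.
  Ends-at : Fin n → Fin n × Fin n → Bool
  Ends-at z (a , b) = is z a xor is z b

  is-≤1 : ∀ {zs} x → Unique zs → count (λ z → is z x) zs ≤ 1
  is-≤1 x u = count-≤1 u λ {y} {z} _ _ e e′ → trans (sym (truth (x ≟ y) e)) (truth (x ≟ z) e′)
    where
      truth : ∀ {P : Set} (d : Dec P) → does d ≡ true → P
      truth (yes p) _ = p

  ends-≤2 : ∀ {zs} m → Unique zs → count (λ z → Ends-at z m) zs ≤ 2
  ends-≤2 {zs} (a , b) u = ℕ.≤-trans (sum-mono zs (λ {z} _ → xor-≤ (is z a) (is z b)))
      (ℕ.≤-trans (ℕ.≤-reflexive (sum-+ (λ z → if is z a then 1 else 0) (λ z → if is z b then 1 else 0) zs))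
        (ℕ.+-mono-≤ (is-≤1 a u) (is-≤1 b u)))
    where
      xor-≤ : ∀ p q → (if p xor q then 1 else 0) ≤ (if p then 1 else 0) + (if q then 1 else 0)
      xor-≤ true  true  = z≤n
      xor-≤ true  false = s≤s z≤n
      xor-≤ false true  = s≤s z≤n
      xor-≤ false false = z≤n

  record Separates-edges (M : List (Fin n × Fin n)) : Set where
    field
      distinct : ∀ {x y} → x ≢ root → y ≢ root → x ≢ y → ¬ (∀ {m} → m ∈ M → Crosses x m ≡ Crosses y m)
      covered  : ∀ {x} → x ≢ root → ∃[ m ] (m ∈ M × Crosses x m ≡ true)

  module _ {N D top} (shape : Shape N D top) {M} (sep : Separates-edges M) where
    open Shape shape
    open Separates-edges sep

    leaves : List (Fin n)
    leaves = root ∷ N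

    unique-leaves : Unique leaves
    unique-leaves = All.tabulate (λ l∈ e → N≢root l∈ (sym e)) ∷ uniqueN

    unique-ends : Unique (leaves ++ D)
    unique-ends = Unique.++⁺ unique-leaves uniqueD λ where
      (here refl , r∈) → D≢root r∈ refl
      (there l∈ , l∈D) → disjoint l∈ l∈D

    edge-of : ∀ {z} → z ∈ leaves → ∃[ x ] (x ≢ root × (∀ m → Crosses x m ≡ Ends-at z m))
    edge-of (here refl) = top , top≢root , λ (a , b) → trans (cong₂ _xor_ (at a) (at b)) (negate (is root a) (is root b))
      where
        at : ∀ y → S top y ≡ not (is root y)
        at y with y ≟ root
        ... | yes refl = root-S top
        ... | no ne = top-full ne
        negate : ∀ p q → not p xor not q ≡ p xor q
        negate true  q = refl
        negate false q = Bool.not-involutive q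
    edge-of {z} (there l∈) = z , N≢root l∈ , λ (a , b) → cong₂ _xor_ (at a) (at b)
      where
        at : ∀ y → S z y ≡ is z y
        at y with y ≟ z
        ... | yes refl = S-refl (N≢root l∈)
        ... | no ne = Bool.¬-not λ e → ne (leaf l∈ e)

    edge-of-injective : ∀ {z z′} (p : z ∈ leaves) (q : z′ ∈ leaves) → z ≢ z′ → proj₁ (edge-of p) ≢ proj₁ (edge-of q)
    edge-of-injective (here refl) (here refl) ne _ = ne refl
    edge-of-injective (here refl) (there q) ne refl = top∉N q
    edge-of-injective (there p) (here refl) ne refl = top∉N p
    edge-of-injective (there p) (there q) ne e = ne e

    leaf-ends : ∀ {z} → z ∈ leaves → 1 ≤ count (Ends-at z) M
    leaf-ends z∈ = let x , x≢ , eq = edge-of z∈ ; m , m∈ , c = covered x≢ in count-pos m∈ (trans (sym (eq m)) c)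

    -- If no path ended at `v`, every path through one of its two edges would continue along the
    -- other.
    node-ends : ∀ {v} → v ∈ D → 1 ≤ count (Ends-at v) M
    node-ends {v} v∈ with Any.any? (λ m → Ends-at v m Bool.≟ true) M
    ... | yes p = let m , m∈ , e = find p in count-pos m∈ e
    ... | no np with below v∈
    ... | c , c≢root , c≢v , same = ⊥-elim (distinct (D≢root v∈) c≢root (c≢v ∘ sym) λ {m} m∈ →
            agree m (Bool.¬-not λ e → np (lose m∈ e)))
      where
        agree : ∀ m → Ends-at v m ≡ false → Crosses v m ≡ Crosses c m
        agree (a , b) e with a ≟ v | b ≟ v
        ... | yes refl | yes refl = trans (Bool.xor-same (S v v)) (sym (Bool.xor-same (S c v)))
        ... | no p | no q = cong₂ _xor_ (same p) (same q)
        ... | yes _ | no _ = ⊥-elim (contra refl e)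
        ... | no _ | yes _ = ⊥-elim (contra refl e)

    ends-bound : suc (length N) + length D ≤ 2 * length M
    ends-bound = subst₂ _≤_ (trans (ℕ.*-identityʳ _) (List.length-++ leaves)) (ℕ.*-comm (length M) 2)
      (double-count Ends-at (leaves ++ D) M
        (λ z∈ → [ leaf-ends , node-ends ]′ (∈-++⁻ leaves z∈)) (λ {m} _ → ends-≤2 m unique-ends))

    -- Two leaves cannot both be covered by the same single path, so every leaf is an end of two paths
    -- or owns a path of its own.
    Owns : Fin n → Fin n × Fin n → Bool
    Owns z m = Ends-at z m ∧ (count (Ends-at z) M ≡ᵇ 1)

    owns⇒ : ∀ {z m} → Owns z m ≡ true → Ends-at z m ≡ true × count (Ends-at z) M ≡ 1
    owns⇒ {z} {m} e with Ends-at z m | count (Ends-at z) M in eq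
    ... | true | 1 = refl , refl

    owner-unique : ∀ {z z′ m} → z ∈ leaves → z′ ∈ leaves → m ∈ M → Owns z m ≡ true → Owns z′ m ≡ true → z ≡ z′
    owner-unique {z} {z′} {m} z∈ z′∈ m∈ o o′ with z ≟ z′
    ... | yes e = e
    ... | no ne with edge-of z∈ | edge-of z′∈ | edge-of-injective z∈ z′∈ ne
    ... | x , x≢ , eq | y , y≢ , eq′ | x≢y = ⊥-elim (distinct x≢ y≢ x≢y λ {m′} m′∈ →
            trans (eq m′) (trans (bool-ext (only o o′ m′∈) (only o′ o m′∈)) (sym (eq′ m′))))
      where
        only : ∀ {w w′ m′} → Owns w m ≡ true → Owns w′ m ≡ true → m′ ∈ M → Ends-at w m′ ≡ true → Ends-at w′ m′ ≡ true
        only {w} {w′} {m′} p q m′∈ e with Ends-at w′ m′ in f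
        ... | true = refl
        ... | false = ⊥-elim (ℕ.<-irrefl refl (subst (2 ≤_) (proj₂ (owns⇒ {w} {m} p))
                (count-two m∈ m′∈ (λ { refl → contra (proj₁ (owns⇒ {w′} {m} q)) f }) (proj₁ (owns⇒ {w} {m} p)) e)))

    leaf-weight : ∀ {z} → z ∈ leaves → 2 ≤ count (Ends-at z) M + count (Owns z) M
    leaf-weight {z} z∈ with count (Ends-at z) M in eq | leaf-ends z∈
    ... | suc (suc k) | _ = s≤s (s≤s z≤n)
    ... | 1 | _ = s≤s (subst (1 ≤_) (trans (sym eq) (cong sum (List.map-cong (λ m → cong (if_then 1 else 0)
                    (sym (Bool.∧-identityʳ (Ends-at z m)))) M))) ℕ.≤-refl)
    ... | 0 | ()

    -- A path hands out at most 3, namely two ends and one ownership. Each leaf receives at least 2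
    -- and each degree-2 vertex at least 1.
    weights-bound : 2 * suc (length N) + length D ≤ 3 * length M
    weights-bound = begin
      2 * length leaves + length D
        ≡⟨ cong₂ _+_ (trans (ℕ.*-comm 2 (length leaves)) (sym (sum-const 2 leaves)))
                     (trans (sym (ℕ.*-identityʳ (length D))) (sym (sum-const 1 D))) ⟩
      sum (map (λ _ → 2) leaves) + sum (map (λ _ → 1) D)
        ≤⟨ ℕ.+-mono-≤ (sum-mono leaves leaf-weight) (sum-mono D node-ends) ⟩
      sum (map (λ z → e z + o z) leaves) + sum (map e D)
        ≡⟨ cong (_+ sum (map e D)) (sum-+ e o leaves) ⟩
      sum (map e leaves) + sum (map o leaves) + sum (map e D)
        ≡⟨ rotate (sum (map e leaves)) (sum (map o leaves)) (sum (map e D)) ⟩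
      (sum (map e leaves) + sum (map e D)) + sum (map o leaves)
        ≡⟨ cong (_+ sum (map o leaves)) (sum-++ e leaves D) ⟨
      sum (map e (leaves ++ D)) + sum (map o leaves)
        ≤⟨ ℕ.+-mono-≤ (count-sum-≤ Ends-at (leaves ++ D) M (λ {m} _ → ends-≤2 m unique-ends))
                      (count-sum-≤ Owns leaves M (λ {m} m∈ → count-≤1 unique-leaves
                         λ z∈ z′∈ → owner-unique z∈ z′∈ m∈)) ⟩
      length M * 2 + length M * 1
        ≡⟨ total (length M) ⟩
      3 * length M ∎
      where
        open ℕ.≤-Reasoning
        e o : Fin n → ℕ
        e z = count (Ends-at z) M
        o z = count (Owns z) M
        rotate : ∀ a b c → a + b + c ≡ (a + c) + b
        rotate = solve-∀
        total : ∀ m → m * 2 + m * 1 ≡ 3 * m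
        total = solve-∀
        sum-++ : ∀ (f : Fin n → ℕ) xs ys → sum (map f (xs ++ ys)) ≡ sum (map f xs) + sum (map f ys)
        sum-++ f [] ys = refl
        sum-++ f (x ∷ xs) ys = trans (cong (f x +_) (sum-++ f xs ys)) (sym (ℕ.+-assoc (f x) _ _))

-- Rooting a tree

module _ {n : ℕ} {G : Graph n} where

  walk-snoc : ∀ a ys {z} → IsWalk G (a ∷ ys) → adj G (last a ys) z ≡ true → IsWalk G (a ∷ ys ++ z ∷ [])
  walk-snoc a [] w e = e , tt
  walk-snoc a (y ∷ ys) (e′ , w) e = e′ , walk-snoc y ys w e

  record SimplePath (vs : List (Fin n)) (a b : Fin n) : Set where
    field
      rest   : List (Fin n)
      uniq   : Unique (a ∷ rest)
      walk   : IsWalk G (a ∷ rest)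
      ends   : last a rest ≡ b
      within : ∀ {x} → x ∈ a ∷ rest → x ∈ vs

  trivial-path : ∀ {vs a} → a ∈ vs → SimplePath vs a a
  trivial-path a∈ = record { rest = [] ; uniq = [] ∷ [] ; walk = tt ; ends = refl ; within = λ { (here refl) → a∈ } }

  prepend : ∀ {vs z p b} → z ∉ vs → adj G z p ≡ true → SimplePath vs p b → SimplePath (z ∷ vs) z b
  prepend {p = p} z∉ e P = record
    { rest = p ∷ rest ; uniq = All.tabulate (λ { i refl → z∉ (within i) }) ∷ uniq ; walk = e , walk
    ; ends = ends ; within = λ { (here refl) → here refl ; (there i) → there (within i) } }
    where open SimplePath P

  append : ∀ {vs z p a} → z ∉ vs → adj G p z ≡ true → SimplePath vs a p → SimplePath (z ∷ vs) a z
  append {vs} {z} {p} {a} z∉ e P = record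
    { rest = rest ++ z ∷ []
    ; uniq = Unique.++⁺ uniq ([] ∷ []) λ { (i , here refl) → z∉ (within i) }
    ; walk = walk-snoc a rest walk (subst (λ x → adj G x z ≡ true) (sym ends) e)
    ; ends = last-∷ʳ a rest
    ; within = λ i → [ there ∘ within , (λ { (here refl) → here refl }) ]′ (∈-++⁻ (a ∷ rest) i) }
    where open SimplePath P

  weaken : ∀ {vs z a b} → SimplePath vs a b → SimplePath (z ∷ vs) a b
  weaken P = record { rest = rest ; uniq = uniq ; walk = walk ; ends = ends ; within = there ∘ within }
    where open SimplePath P

  -- Otherwise z would close a cycle with the path joining its two visited neighbours.
  one-neighbour : ∀ {vs z p w} → ¬ HasCycle G → z ∉ vs → SimplePath vs p w →
    adj G z p ≡ true → adj G z w ≡ true → w ≡ p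
  one-neighbour {vs} {z} {p} {w} acyclic z∉ P zp zw with SimplePath.rest P in eq | SimplePath.ends P
  ... | [] | e = sym e
  ... | y ∷ ys | e = ⊥-elim (acyclic (z , p ∷ y ∷ ys ,
        All.tabulate (λ { i refl → z∉ (within (subst (λ r → z ∈ p ∷ r) (sym eq) i)) }) ∷ subst (λ r → Unique (p ∷ r)) eq uniq ,
        s≤s (s≤s z≤n) ,
        zp , walk-snoc p (y ∷ ys) (subst (λ r → IsWalk G (p ∷ r)) eq walk)
               (trans (Graph.sym G _ z) (subst (λ x → adj G z x ≡ true) (sym e) zw))))
    where open SimplePath P using (within; uniq; walk)

  -- A rooting of the part visited so far. By `S-fresh` a new vertex starts without descendants. The
  -- simple paths serve to rule out a second visited neighbour and, in the end, to realise chords.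
  record Grown (r : Fin n) (vs : List (Fin n)) : Set where
    field
      par     : Fin n → Fin n
      rank    : Fin n → ℕ
      S       : Fin n → Fin n → Bool
      pos     : Fin n → ℕ
      r∈      : r ∈ vs
      S-root  : ∀ y → S r y ≡ false
      root-S  : ∀ x → S x r ≡ false
      S-fresh : ∀ {x} → x ∉ vs → ∀ y → S x y ≡ false
      S-rec   : ∀ x {y} → y ∈ vs → y ≢ r → S x y ≡ does (x ≟ y) ∨ S x (par y)
      par-∈   : ∀ {y} → y ∈ vs → y ≢ r → par y ∈ vs
      rank-<  : ∀ {y} → y ∈ vs → y ≢ r → rank (par y) < rank y
      par-adj : ∀ {y} → y ∈ vs → y ≢ r → adj G y (par y) ≡ true
      adj-par : ∀ {u w} → u ∈ vs → w ∈ vs → adj G u w ≡ true → (u ≢ r × par u ≡ w) ⊎ (w ≢ r × par w ≡ u)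
      convex  : ∀ i {x y z} → x ∈ vs → y ∈ vs → z ∈ vs → pos x ≤ pos y → pos y ≤ pos z →
                S i x ≡ true → S i z ≡ true → S i y ≡ true
      path    : ∀ {a b} → a ∈ vs → b ∈ vs → SimplePath vs a b

  seed : ∀ r → Grown r (r ∷ [])
  seed r = record
    { par = id ; rank = λ _ → 0 ; S = λ _ _ → false ; pos = λ _ → 0 ; r∈ = here refl
    ; S-root = λ _ → refl ; root-S = λ _ → refl ; S-fresh = λ _ _ → refl
    ; S-rec = λ { _ (here e) ne → ⊥-elim (ne e) } ; par-∈ = λ { (here e) ne → ⊥-elim (ne e) }
    ; rank-< = λ { (here e) ne → ⊥-elim (ne e) } ; par-adj = λ { (here e) ne → ⊥-elim (ne e) }
    ; adj-par = λ { (here refl) (here refl) e → ⊥-elim (contra e (irrefl G r)) }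
    ; convex = λ { _ _ _ _ _ _ () _ }
    ; path = λ { (here refl) (here refl) → trivial-path (here refl) } }

  update : {A : Set} → Fin n → A → (Fin n → A) → Fin n → A
  update z a f x = if does (x ≟ z) then a else f x

  update-same : ∀ {A : Set} (f : Fin n → A) {z a} → update z a f z ≡ a
  update-same f {z} rewrite dec-true (z ≟ z) refl = refl

  update-other : ∀ {A : Set} (f : Fin n → A) {z a x} → x ≢ z → update z a f x ≡ f x
  update-other f {z} {x = x} ne rewrite dec-false (x ≟ z) ne = refl

  -- The new vertex z is placed immediately after its parent p in the order pos, so a descendant set
  -- cannot tell z from p except for the set of z itself.
  grow : ∀ {r vs z p} → ¬ HasCycle G → Grown r vs → z ∉ vs → p ∈ vs → adj G p z ≡ true → Grown r (z ∷ vs)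
  grow {r} {vs} {z} {p} acyclic T z∉ p∈ pz = record
    { par = par′ ; rank = update z (suc (rank p)) rank ; S = S′ ; pos = pos′ ; r∈ = there r∈
    ; S-root = λ y → cases (λ y → S′ r y ≡ false) (trans (S′-new r) (cong₂ _∨_ (dec-false (r ≟ z) r≢z) (S-root p)))
                          (λ y≢z → trans (S′-old r y≢z) (S-root _)) y
    ; root-S = λ x → trans (S′-old x r≢z) (root-S x)
    ; S-fresh = λ {x} x∉ → cases (λ y → S′ x y ≡ false)
        (trans (S′-new x) (cong₂ _∨_ (dec-false (x ≟ z) (x∉ ∘ here)) (S-fresh (x∉ ∘ there) p)))
        (λ y≢z → trans (S′-old x y≢z) (S-fresh (x∉ ∘ there) _))
    ; S-rec = λ where
        x (here refl) _ → trans (S′-new x) (cong (does (x ≟ z) ∨_) (sym (trans (cong (S′ x) par-new) (S′-old x p≢z))))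
        x {y} (there y∈) y≢r → trans (S′-old x (old≢ y∈)) (trans (S-rec x y∈ y≢r)
          (cong (does (x ≟ y) ∨_) (sym (trans (cong (S′ x) (par-old y∈)) (S′-old x (old≢ (par-∈ y∈ y≢r)))))))
    ; par-∈ = λ where
        (here refl) _ → there (subst (_∈ vs) (sym par-new) p∈)
        (there y∈) y≢r → there (subst (_∈ vs) (sym (par-old y∈)) (par-∈ y∈ y≢r))
    ; rank-< = λ where
        (here refl) _ → subst₂ _<_ (sym (trans (cong rank′ par-new) (update-other rank p≢z))) (sym (update-same rank)) ℕ.≤-refl
        (there y∈) y≢r → subst₂ _<_ (sym (trans (cong rank′ (par-old y∈)) (update-other rank (old≢ (par-∈ y∈ y≢r)))))
                           (sym (update-other rank (old≢ y∈))) (rank-< y∈ y≢r)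
    ; par-adj = λ where
        (here refl) _ → subst (λ q → adj G z q ≡ true) (sym par-new) zp
        {y} (there y∈) y≢r → subst (λ q → adj G y q ≡ true) (sym (par-old y∈)) (par-adj y∈ y≢r)
    ; adj-par = λ where
        (here refl) (here refl) e → ⊥-elim (contra e (irrefl G z))
        (here refl) (there w∈) e → inj₁ (z≢r , trans par-new (sym (one-neighbour acyclic z∉ (path p∈ w∈) zp e)))
        (there u∈) (here refl) e → inj₂ (z≢r , trans par-new (sym (one-neighbour acyclic z∉ (path p∈ u∈) zp
          (trans (Graph.sym G _ _) e))))
        (there u∈) (there w∈) e → [ (λ { (a , b) → inj₁ (a , trans (par-old u∈) b) })
                                  , (λ { (a , b) → inj₂ (a , trans (par-old w∈) b) }) ]′ (adj-par u∈ w∈ e)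
    ; convex = convex′
    ; path = λ where
        (here refl) (here refl) → trivial-path (here refl)
        (here refl) (there b∈) → prepend z∉ zp (path p∈ b∈)
        (there a∈) (here refl) → append z∉ pz (path a∈ p∈)
        (there a∈) (there b∈) → weaken (path a∈ b∈)
    }
    where
      open Grown T
      par′ : Fin n → Fin n
      par′ = update z p par
      rank′ : Fin n → ℕ
      rank′ = update z (suc (rank p)) rank
      S′ : Fin n → Fin n → Bool
      S′ x = update z (does (x ≟ z) ∨ S x p) (S x)
      -- Vacates the slot `suc (pos p)` for `z` by moving all later positions up by one.
      shift : ℕ → ℕ
      shift k = if does (k ℕ.≤? pos p) then k else suc k
      pos′ : Fin n → ℕ
      pos′ = update z (suc (pos p)) (shift ∘ pos)
      old≢ : ∀ {y} → y ∈ vs → y ≢ z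
      old≢ y∈ refl = z∉ y∈
      p≢z : p ≢ z
      p≢z = old≢ p∈
      r≢z : r ≢ z
      r≢z = old≢ r∈
      z≢r : z ≢ r
      z≢r e = r≢z (sym e)
      zp : adj G z p ≡ true
      zp = trans (Graph.sym G z p) pz
      par-new : par′ z ≡ p
      par-new = update-same par
      par-old : ∀ {y} → y ∈ vs → par′ y ≡ par y
      par-old y∈ = update-other par (old≢ y∈)
      S′-new : ∀ x → S′ x z ≡ does (x ≟ z) ∨ S x p
      S′-new x = update-same (S x)
      S′-old : ∀ x {y} → y ≢ z → S′ x y ≡ S x y
      S′-old x = update-other (S x)
      cases : (P : Fin n → Set) → P z → (∀ {y} → y ≢ z → P y) → ∀ y → P y
      cases P new old y with y ≟ z
      ... | yes refl = new
      ... | no ne = old ne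
      collapse : Fin n → Fin n
      collapse = update z p id
      collapse-∈ : ∀ {y} → y ∈ z ∷ vs → collapse y ∈ vs
      collapse-∈ (here refl) = subst (_∈ vs) (sym (update-same id {z})) p∈
      collapse-∈ (there y∈)  = subst (_∈ vs) (sym (update-other id (old≢ y∈))) y∈
      S′-collapse : ∀ {i} → i ≢ z → ∀ y → S′ i y ≡ S i (collapse y)
      S′-collapse {i} i≢z = cases (λ y → S′ i y ≡ S i (collapse y))
        (trans (S′-new i) (trans (cong (_∨ S i p) (dec-false (i ≟ z) i≢z)) (cong (S i) (sym (update-same id {z})))))
        (λ y≢z → trans (S′-old i y≢z) (cong (S i) (sym (update-other id y≢z))))
      shift-low : ∀ {k} → k ≤ pos p → shift k ≡ k
      shift-low {k} le rewrite dec-true (k ℕ.≤? pos p) le = refl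
      shift-high : ∀ {k} → ¬ (k ≤ pos p) → shift k ≡ suc k
      shift-high {k} gt rewrite dec-false (k ℕ.≤? pos p) gt = refl
      shift-cancel : ∀ {k m} → shift k ≤ shift m → k ≤ m
      shift-cancel {k} {m} le with k ℕ.≤? pos p | m ℕ.≤? pos p
      ... | yes a | yes b = subst₂ _≤_ (shift-low a) (shift-low b) le
      ... | yes a | no b  = ℕ.≤-trans a (ℕ.<⇒≤ (ℕ.≰⇒> b))
      ... | no a  | yes b = ℕ.≤-trans (ℕ.n≤1+n _) (subst₂ _≤_ (shift-high a) (shift-low b) le)
      ... | no a  | no b  = ℕ.≤-pred (subst₂ _≤_ (shift-high a) (shift-high b) le)
      below-new : ∀ {k} → shift k ≤ suc (pos p) → k ≤ pos p
      below-new {k} le with k ℕ.≤? pos p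
      ... | yes a = a
      ... | no a  = ℕ.≤-pred (subst (_≤ suc (pos p)) (shift-high a) le)
      above-new : ∀ {k} → suc (pos p) ≤ shift k → pos p ≤ k
      above-new {k} le with k ℕ.≤? pos p
      ... | yes a = ℕ.≤-trans (ℕ.n≤1+n _) (subst (suc (pos p) ≤_) (shift-low a) le)
      ... | no a  = ℕ.≤-pred (subst (suc (pos p) ≤_) (shift-high a) le)
      -- No old vertex occupies the slot of `z`; this makes the set of `z` alone an interval.
      shift≢new : ∀ {k} → shift k ≢ suc (pos p)
      shift≢new {k} e with k ℕ.≤? pos p
      ... | yes a = ℕ.<-irrefl (trans (sym (shift-low a)) e) (s≤s a)
      ... | no a  = a (ℕ.≤-reflexive (ℕ.suc-injective (trans (sym (shift-high a)) e)))
      pos-collapse : ∀ {x y} → pos′ x ≤ pos′ y → pos (collapse x) ≤ pos (collapse y)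
      pos-collapse {x} {y} le with x ≟ z | y ≟ z
      ... | yes _ | yes _ = ℕ.≤-refl
      ... | yes _ | no _  = above-new le
      ... | no _  | yes _ = below-new le
      ... | no _  | no _  = shift-cancel le
      only-z : ∀ y → S′ z y ≡ true → y ≡ z
      only-z y e with y ≟ z
      ... | yes q = q
      ... | no ne = ⊥-elim (contra e (S-fresh z∉ y))
      convex-new : ∀ {x y w} → Dec (y ≡ z) → pos′ x ≤ pos′ y → pos′ y ≤ pos′ w →
        S′ z x ≡ true → S′ z w ≡ true → S′ z y ≡ true
      convex-new {x} {y} {w} d le le′ ex ew with only-z x ex | only-z w ew | d
      ... | refl | refl | yes refl = ex
      ... | refl | refl | no y≢z = ⊥-elim (shift≢new {pos y} (ℕ.≤-antisym
              (subst₂ _≤_ (update-other (shift ∘ pos) y≢z) (update-same (shift ∘ pos) {z}) le′)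
              (subst₂ _≤_ (update-same (shift ∘ pos) {z}) (update-other (shift ∘ pos) y≢z) le)))
      convex′ : ∀ i {x y w} → x ∈ z ∷ vs → y ∈ z ∷ vs → w ∈ z ∷ vs → pos′ x ≤ pos′ y → pos′ y ≤ pos′ w →
        S′ i x ≡ true → S′ i w ≡ true → S′ i y ≡ true
      convex′ i {x} {y} {w} x∈ y∈ w∈ le le′ ex ew = dispatch (i ≟ z) ex ew
        where
          dispatch : Dec (i ≡ z) → S′ i x ≡ true → S′ i w ≡ true → S′ i y ≡ true
          dispatch (no i≢z) ex ew = trans (S′-collapse i≢z y) (convex i (collapse-∈ x∈) (collapse-∈ y∈) (collapse-∈ w∈)
              (pos-collapse {x} {y} le) (pos-collapse {y} {w} le′)
              (trans (sym (S′-collapse i≢z x)) ex) (trans (sym (S′-collapse i≢z w)) ew))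
          dispatch (yes refl) ex ew = convex-new {x} {y} {w} (y ≟ z) le le′ ex ew

  Extends : Fin n → List (Fin n) → Fin n → Set
  Extends r vs y = ∃[ ws ] (Grown r ws × (∀ {x} → x ∈ vs → x ∈ ws) × y ∈ ws)

  grow-along : ∀ {r vs u y} → ¬ HasCycle G → Grown r vs → u ∈ vs → Walk G u y → Extends r vs y
  grow-along acyclic T u∈ here = _ , T , id , u∈
  grow-along {vs = vs} acyclic T u∈ (step {w = w} e walk) with Any.any? (w ≟_) vs
  ... | yes w∈ = grow-along acyclic T w∈ walk
  ... | no w∉ with grow-along acyclic (grow acyclic T w∉ u∈ e) (here refl) walk
  ... | ws , T′ , ⊆ , y∈ = ws , T′ , ⊆ ∘ there , y∈

  grow-all : ∀ {r vs} → IsTree G → Grown r vs → ∀ ys → ∃[ ws ] (Grown r ws × (∀ {x} → x ∈ vs → x ∈ ws) × (∀ {y} → y ∈ ys → y ∈ ws))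
  grow-all tree T [] = _ , T , id , λ ()
  grow-all {r} tree T (y ∷ ys) with grow-along (proj₂ tree) T (Grown.r∈ T) (proj₁ tree r y)
  ... | us , U , ⊆ , y∈ with grow-all tree U ys
  ... | ws , W , ⊆′ , all = ws , W , ⊆′ ∘ ⊆ , λ { (here refl) → ⊆′ y∈ ; (there i) → all i }

  record Rooting (r : Fin n) : Set where
    field
      rooted  : Rooted G
      root≡   : Rooted.root rooted ≡ r
      dfs     : Fin n → ℕ
      convex  : ∀ i {x y z} → dfs x ≤ dfs y → dfs y ≤ dfs z →
                Rooted.S rooted i x ≡ true → Rooted.S rooted i z ≡ true → Rooted.S rooted i y ≡ true
      path-between : ∀ a b → ∃[ P ] (Tree.ends rooted P ≡ (a , b))

  grown-rooting : ∀ {r ws} → Grown r ws → (∀ y → y ∈ ws) → Rooting r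
  grown-rooting {r} T every = record
    { rooted = record
        { root = r ; par = T.par ; rank = T.rank ; S = T.S ; S-root = T.S-root ; root-S = T.root-S
        ; S-rec = λ x → T.S-rec x (every _) ; rank-< = T.rank-< (every _) ; par-adj = T.par-adj (every _)
        ; adj-par = T.adj-par (every _) (every _) }
    ; root≡ = refl ; dfs = T.pos ; convex = λ i → T.convex i (every _) (every _) (every _)
    ; path-between = λ a b → let open SimplePath (T.path (every a) (every b)) in
        mkPath (a ∷ rest) uniq walk , cong (a ,_) ends }
    where module T = Grown T

  abstract
    root-at : IsTree G → ∀ r → Rooting r
    root-at tree r = let _ , T , _ , all = grow-all tree (seed r) (allFin n) in grown-rooting T (λ y → all (∈-allFin y))

-- Degrees

module Degrees {n : ℕ} {G : Graph n} (R : Rooted G) where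
  open Rooted R
  open Tree R

  Child : Fin n → Fin n → Set
  Child x c = c ≢ root × par c ≡ x

  Child? : ∀ x c → Dec (Child x c)
  Child? x c = ¬? (c ≟ root) ×-dec (par c ≟ x)

  neighbour : ∀ {v u} → adj G v u ≡ true → (v ≢ root × par v ≡ u) ⊎ Child v u
  neighbour = adj-par

  child-adj : ∀ {x c} → Child x c → adj G x c ≡ true
  child-adj (c≢ , refl) = trans (Graph.sym G _ _) (par-adj c≢)

  child≢ : ∀ {x c} → Child x c → c ≢ x
  child≢ (c≢ , refl) e = par≢ c≢ (sym e)

  child≢par : ∀ {x c} → x ≢ root → Child x c → c ≢ par x
  child≢par {c = c} x≢ (c≢ , refl) e = ℕ.<-asym (rank-< x≢) (subst (λ z → rank (par c) < rank z) e (rank-< c≢))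

  deg-≥ : ∀ {v} ys → Unique ys → (∀ {y} → y ∈ ys → adj G v y ≡ true) → length ys ≤ deg G v
  deg-≥ ys u h = count-≥ (Unique.allFin⁺ n) u λ y∈ → ∈-allFin _ , h y∈

  deg-≤ : ∀ {v} ys → Unique ys → (∀ {y} → adj G v y ≡ true → y ∈ ys) → deg G v ≤ length ys
  deg-≤ ys u h = count-≤ (Unique.allFin⁺ n) u λ _ → h

  leaf-deg : ∀ {v} → v ≢ root → (∀ {c} → ¬ Child v c) → deg G v ≡ 1
  leaf-deg {v} v≢ none = ℕ.≤-antisym
    (deg-≤ (par v ∷ []) ([] ∷ []) λ e → [ (λ p → here (sym (proj₂ p))) , (λ c → ⊥-elim (none c)) ]′ (neighbour e))
    (deg-≥ (par v ∷ []) ([] ∷ []) λ { (here refl) → par-adj v≢ })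

  deg-leaf : ∀ {v} → v ≢ root → deg G v ≡ 1 → ∀ {c} → ¬ Child v c
  deg-leaf {v} v≢ d {c} ch = ℕ.<-irrefl refl (subst (2 ≤_) d
    (deg-≥ (c ∷ par v ∷ []) ((child≢par v≢ ch ∷ []) ∷ [] ∷ [])
      λ { (here refl) → child-adj ch ; (there (here refl)) → par-adj v≢ }))

  node-deg : ∀ {v c} → v ≢ root → Child v c → (∀ {d} → Child v d → d ≡ c) → deg G v ≡ 2
  node-deg {v} {c} v≢ ch sole = ℕ.≤-antisym
    (deg-≤ (c ∷ par v ∷ []) u λ e → [ (λ p → there (here (sym (proj₂ p)))) , (λ d → here (sole d)) ]′ (neighbour e))
    (deg-≥ (c ∷ par v ∷ []) u λ { (here refl) → child-adj ch ; (there (here refl)) → par-adj v≢ })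
    where
      u : Unique (c ∷ par v ∷ [])
      u = (child≢par v≢ ch ∷ []) ∷ [] ∷ []

  deg-node : ∀ {v} → v ≢ root → deg G v ≡ 2 → ∃[ c ] (Child v c × (∀ {d} → Child v d → d ≡ c))
  deg-node {v} v≢ d with any? (Child? v)
  ... | no none = case trans (sym d) (leaf-deg v≢ (λ ch → none (_ , ch))) of λ ()
  ... | yes (c , ch) = c , ch , λ {e} ch′ → decidable-stable (e ≟ c) λ e≢c → ℕ.<-irrefl refl (subst (3 ≤_) d
        (deg-≥ (e ∷ c ∷ par v ∷ []) ((e≢c ∷ child≢par v≢ ch′ ∷ []) ∷ (child≢par v≢ ch ∷ []) ∷ [] ∷ [])
          λ { (here refl) → child-adj ch′ ; (there (here refl)) → child-adj ch ; (there (there (here refl))) → par-adj v≢ }))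

  -- A descendant of maximal rank has no child.
  leaf-below : ∀ {x} → x ≢ root → ∃[ l ] (S x l ≡ true × (∀ {c} → ¬ Child l c))
  leaf-below {x} x≢ with maximum rank (filter (λ y → S x y Bool.≟ true) (allFin n))
      (∈-filter⁺ (λ y → S x y Bool.≟ true) (∈-allFin x) (S-refl x≢))
  ... | l , l∈ , max with ∈-filter⁻ (λ y → S x y Bool.≟ true) {xs = allFin n} l∈
  ... | _ , xl = l , xl , λ { {c} (c≢ , refl) → ℕ.<-irrefl refl (ℕ.≤-trans (rank-< c≢)
          (max (∈-filter⁺ (λ y → S x y Bool.≟ true) (∈-allFin c) (S-par c≢ xl)))) }

  childless : ∀ {x y} → (∀ {c} → ¬ Child x c) → S x y ≡ true → y ≡ x
  childless {x} {y} none e with x ≟ y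
  ... | yes p = sym p
  ... | no ne = let c , c≢ , pc , _ = child-toward e ne in ⊥-elim (none (c≢ , pc))

  siblings : ∀ {x c d y} → Child x c → Child x d → S c y ≡ true → S d y ≡ true → c ≡ d
  siblings {c = c} {d} (c≢ , pc) (d≢ , pd) cy dy with comparable cy dy
  ... | inj₁ cd = [ id , (λ e → ⊥-elim (contra (trans (cong (S c) (trans pc (sym pd))) e) (par-∉ c≢))) ]′ (S-step cd)
  ... | inj₂ dc = [ sym , (λ e → ⊥-elim (contra (trans (cong (S d) (trans pd (sym pc))) e) (par-∉ d≢))) ]′ (S-step dc)

  N-list D-list : List (Fin n)
  N-list = filter (λ x → (deg G x ℕ.≟ 1) ×-dec ¬? (x ≟ root)) (allFin n)
  D-list = filter (λ x → deg G x ℕ.≟ 2) (allFin n)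

  N⁺ : ∀ {x} → x ≢ root → (∀ {c} → ¬ Child x c) → x ∈ N-list
  N⁺ {x} x≢ none = ∈-filter⁺ _ (∈-allFin x) (leaf-deg x≢ none , x≢)

  N⁻ : ∀ {x} → x ∈ N-list → x ≢ root × deg G x ≡ 1
  N⁻ x∈ = let _ , d , x≢ = ∈-filter⁻ _ {xs = allFin n} x∈ in x≢ , d

  D⁺ : ∀ {x} → deg G x ≡ 2 → x ∈ D-list
  D⁺ {x} d = ∈-filter⁺ _ (∈-allFin x) d

  D⁻ : ∀ {x} → x ∈ D-list → deg G x ≡ 2
  D⁻ x∈ = proj₂ (∈-filter⁻ _ {xs = allFin n} x∈)

  leaf-of : ∀ {x} → x ≢ root → ∃[ l ] (l ∈ N-list × S x l ≡ true)
  leaf-of x≢ with leaf-below x≢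
  ... | l , xl , none = l , N⁺ (proj₂ (in⇒≢root xl)) none , xl

  leaf-closed : ∀ {l} → l ∈ N-list → ∀ {y} → S l y ≡ true → y ≡ l
  leaf-closed l∈ = childless (λ {c} → deg-leaf (proj₁ (N⁻ l∈)) (proj₂ (N⁻ l∈)) {c})

  h₁-length : deg G root ≡ 1 → h₁ G ≡ suc (length N-list)
  h₁-length d = trans (count-filter leaf? (allFin n)) (ℕ.≤-antisym
      (unique-⊆-length (Unique.filter⁺ _ (Unique.allFin⁺ n)) unique-rN into)
      (unique-⊆-length unique-rN (Unique.filter⁺ _ (Unique.allFin⁺ n)) out))
    where
      leaf? : Fin n → Bool
      leaf? x = deg G x ≡ᵇ 1
      unique-rN : Unique (root ∷ N-list)
      unique-rN = All.tabulate (λ i e → proj₁ (N⁻ i) (sym e)) ∷ Unique.filter⁺ _ (Unique.allFin⁺ n)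
      into : ∀ {x} → x ∈ filter (λ x → leaf? x Bool.≟ true) (allFin n) → x ∈ root ∷ N-list
      into {x} i with x ≟ root
      ... | yes e = here e
      ... | no ne = there (∈-filter⁺ _ (∈-allFin x) (≡ᵇ-sound _ _ (proj₂ (∈-filter⁻ (λ x → leaf? x Bool.≟ true) {xs = allFin n} i)) , ne))
      out : ∀ {x} → x ∈ root ∷ N-list → x ∈ filter (λ x → leaf? x Bool.≟ true) (allFin n)
      out {x} i = ∈-filter⁺ (λ x → leaf? x Bool.≟ true) (∈-allFin x) (≡ᵇ-complete _ _ (one i))
        where
          one : ∀ {x} → x ∈ root ∷ N-list → deg G x ≡ 1
          one (here refl) = d
          one (there i) = proj₂ (N⁻ i)

  h₂-length : h₂ G ≡ length D-list
  h₂-length = trans (count-filter node? (allFin n)) (ℕ.≤-antisym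
      (unique-⊆-length (Unique.filter⁺ _ (Unique.allFin⁺ n)) (Unique.filter⁺ _ (Unique.allFin⁺ n)) into)
      (unique-⊆-length (Unique.filter⁺ _ (Unique.allFin⁺ n)) (Unique.filter⁺ _ (Unique.allFin⁺ n)) out))
    where
      node? : Fin n → Bool
      node? x = deg G x ≡ᵇ 2
      into : ∀ {x} → x ∈ filter (λ x → node? x Bool.≟ true) (allFin n) → x ∈ D-list
      into i = D⁺ (≡ᵇ-sound _ _ (proj₂ (∈-filter⁻ (λ x → node? x Bool.≟ true) {xs = allFin n} i)))
      out : ∀ {x} → x ∈ D-list → x ∈ filter (λ x → node? x Bool.≟ true) (allFin n)
      out {x} i = ∈-filter⁺ (λ x → node? x Bool.≟ true) (∈-allFin x) (≡ᵇ-complete _ _ (D⁻ i))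

  module _ (root-leaf : deg G root ≡ 1) where

    D≢root : ∀ {v} → v ∈ D-list → v ≢ root
    D≢root v∈ refl = case trans (sym root-leaf) (D⁻ v∈) of λ ()

    N-D-disjoint : ∀ {x} → x ∈ N-list → x ∉ D-list
    N-D-disjoint x∈ x∈′ = case trans (sym (proj₂ (N⁻ x∈))) (D⁻ x∈′) of λ ()

    root-child : ∀ {c d} → Child root c → Child root d → d ≡ c
    root-child {c} {d} p q = decidable-stable (d ≟ c) λ d≢c → ℕ.<-irrefl refl (subst (2 ≤_) root-leaf
      (deg-≥ (d ∷ c ∷ []) ((d≢c ∷ []) ∷ [] ∷ []) λ { (here refl) → child-adj q ; (there (here refl)) → child-adj p }))

    tree-valid : Chords.Valid R N-list D-list
    tree-valid = record
      { uniqueN = Unique.filter⁺ _ (Unique.allFin⁺ n) ; uniqueD = Unique.filter⁺ _ (Unique.allFin⁺ n)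
      ; disjoint = N-D-disjoint
      ; hull = hull }
      where
        hull : ∀ {v} → v ∈ D-list → ∃[ l ] (l ∈ N-list × Chords.Below R v l)
        hull v∈ with deg-node (D≢root v∈) (D⁻ v∈)
        ... | c , ch , _ with leaf-of (proj₁ ch)
        ... | l , l∈ , cl = l , l∈ , S-trans vc cl , λ { refl → child≢ ch (S-antisym cl vc) }
          where vc = child-⊆ (proj₁ ch) (proj₂ ch) (D≢root v∈)

    tree-shape : ∀ {top} → Child root top → (∃[ y ] (y ≢ root × y ≢ top)) → Lower.Shape R N-list D-list top
    tree-shape {top} t (y , y≢root , y≢top) = record
      { uniqueN = Unique.filter⁺ _ (Unique.allFin⁺ n) ; uniqueD = Unique.filter⁺ _ (Unique.allFin⁺ n)
      ; disjoint = N-D-disjoint ; N≢root = λ l∈ → proj₁ (N⁻ l∈) ; D≢root = D≢root ; leaf = leaf-closed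
      ; below = λ {v} v∈ → let c , ch , sole = deg-node (D≢root v∈) (D⁻ v∈) in
          c , proj₁ ch , child≢ ch , λ {y} y≢v → bool-ext
            (λ e → let d , d≢ , pd , dy = child-toward e (y≢v ∘ sym) in subst (λ d → S d y ≡ true) (sole (d≢ , pd)) dy)
            (S-trans (child-⊆ (proj₁ ch) (proj₂ ch) (D≢root v∈)))
      ; top≢root = proj₁ t ; top-full = full ; top∉N = λ t∈ → y≢top (leaf-closed t∈ (full y≢root)) }
      where
        full : ∀ {y} → y ≢ root → S top y ≡ true
        full {y} y≢ = let c , c≢ , pc , cy = topmost y≢ in subst (λ c → S c y ≡ true) (root-child t (c≢ , pc)) cy

  -- If `x` has a child besides the one towards `y`, a leaf below that child tells the sets apart.
  -- If not, `x` has degree 2 and does so itself.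
  descends : ∀ {x y} → x ≢ y → S x y ≡ true → ∃[ z ] (Chords.Special R N-list D-list z × Diff x y z ≡ true)
  descends {x} {y} x≢y xy with child-toward xy x≢y
  ... | c , c≢ , pc , cy with any? (λ d → Child? x d ×-dec ¬? (d ≟ c))
  ...   | yes (d , ch , d≢c) with leaf-of (proj₁ ch)
  ...     | l , l∈ , dl = l , inj₁ l∈ , cong₂ _xor_ (S-trans (child-⊆ (proj₁ ch) (proj₂ ch) (proj₁ (in⇒≢root xy))) dl)
              (Bool.¬-not λ yl → d≢c (siblings ch (c≢ , pc) dl (S-trans cy yl)))
  descends {x} {y} x≢y xy | c , c≢ , pc , cy | no none =
      x , inj₂ (D⁺ (node-deg (proj₁ (in⇒≢root xy)) (c≢ , pc) λ {d} ch → decidable-stable (d ≟ c) λ ne → none (d , ch , ne)))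
    , cong₂ _xor_ (S-refl (proj₁ (in⇒≢root xy))) (Bool.¬-not λ yx → x≢y (S-antisym xy yx))

  -- The reason why traces on leaves and degree-2 vertices suffice. `y` may be the root, which takes
  -- care of covering.
  distinguish : ∀ {x y} → x ≢ root → x ≢ y → ∃[ z ] (Chords.Special R N-list D-list z × Diff x y z ≡ true)
  distinguish {x} {y} x≢ x≢y with S x y Bool.≟ true | S y x Bool.≟ true
  ... | yes xy | _ = descends x≢y xy
  ... | no _ | yes yx = let z , s , d = descends (x≢y ∘ sym) yx in z , s , trans (Bool.xor-comm (S x z) (S y z)) d
  ... | no ¬xy | no ¬yx with leaf-of x≢
  ...   | l , l∈ , xl = l , inj₁ l∈ , cong₂ _xor_ xl (Bool.¬-not λ yl → [ ¬xy , ¬yx ]′ (comparable xl yl))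

-- Recognising Tᵃ

module Recognise {n : ℕ} {G : Graph n} (R : Rooted G) (root-leaf : deg G (Rooted.root R) ≡ 1)
  (like : Reductions.TaLike R (Degrees.N-list R) (Degrees.D-list R)) where
  open Rooted R
  open Tree R
  open Chords R using (Below; Special)
  open Degrees R
  open Reductions.TaLike like

  v≢root : v ≢ root
  v≢root = D≢root root-leaf v∈

  c-out : S v c ≡ false
  c-out = Bool.¬-not λ e → vc (e , λ { refl → N-D-disjoint root-leaf c∈ v∈ })

  a≢c : a ≢ c
  a≢c refl = vc va

  b≢c : b ≢ c
  b≢c refl = vc vb

  leaves-are : ∀ {z} → z ∈ N-list → z ∈ a ∷ b ∷ c ∷ []
  leaves-are {z} z∈ with z ≟ a | z ≟ b | z ≟ c
  ... | yes e | _ | _ = here e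
  ... | _ | yes e | _ = there (here e)
  ... | _ | _ | yes e = there (there (here e))
  ... | no p | no q | no r = ⊥-elim (ℕ.<-irrefl refl (subst (4 ≤_) N≡3 (unique-⊆-length
          ((p ∷ q ∷ r ∷ []) ∷ (a≢b ∷ a≢c ∷ []) ∷ (b≢c ∷ []) ∷ [] ∷ [])
          (Chords.Valid.uniqueN (tree-valid root-leaf))
          λ { (here refl) → z∈ ; (there (here refl)) → a∈ ; (there (there (here refl))) → b∈
            ; (there (there (there (here refl)))) → c∈ })))

  node-is : ∀ {z} → z ∈ D-list → z ≡ v
  node-is {z} z∈ = decidable-stable (z ≟ v) λ ne → ℕ.<-irrefl refl (subst (2 ≤_) D≡1 (unique-⊆-length
    ((ne ∷ []) ∷ [] ∷ []) (Chords.Valid.uniqueD (tree-valid root-leaf))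
    λ { (here refl) → z∈ ; (there (here refl)) → v∈ }))

  -- By `distinguish`, since `v`, `a`, `b`, `c` are the only special vertices. Four bits thus
  -- identify a vertex, and this bounds the whole tree.
  same-trace : ∀ {x y} → x ≢ root → S x v ≡ S y v → S x c ≡ S y c → S x a ≡ S y a → S x b ≡ S y b → x ≡ y
  same-trace {x} {y} x≢ ev ec ea eb = decidable-stable (x ≟ y) λ x≢y →
      let z , s , d = distinguish x≢ x≢y in contra d (≡-xor (agree s))
    where
      agree : ∀ {z} → Special N-list D-list z → S x z ≡ S y z
      agree (inj₁ z∈) with leaves-are z∈
      ... | here refl = ea
      ... | there (here refl) = eb
      ... | there (there (here refl)) = ec
      agree (inj₂ z∈) with node-is z∈
      ... | refl = ev

  only-child : ∃[ c ] (Child v c × (∀ {d} → Child v d → d ≡ c))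
  only-child = deg-node v≢root (D⁻ v∈)

  w : Fin n
  w = proj₁ only-child

  p : Fin n
  p = par v

  w-child : Child v w
  w-child = proj₁ (proj₂ only-child)

  vw : S v w ≡ true
  vw = child-⊆ (proj₁ w-child) (proj₂ w-child) v≢root

  w-above : ∀ {x} → Below v x → S w x ≡ true
  w-above (e , ne) with child-toward e ne
  ... | d , d≢ , pd , dx = subst (λ d → S d _ ≡ true) (proj₂ (proj₂ only-child) (d≢ , pd)) dx

  w-v : S w v ≡ false
  w-v = Bool.¬-not λ e → child≢ w-child (S-antisym e vw)

  w-c : S w c ≡ false
  w-c = Bool.¬-not λ e → contra (S-trans vw e) c-out

  leaf-out : ∀ {x y} → x ∈ N-list → y ≢ x → S x y ≡ false
  leaf-out x∈ ne = Bool.¬-not λ e → ne (leaf-closed x∈ e)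

  leaf≢v : ∀ {x} → x ∈ N-list → v ≢ x
  leaf≢v x∈ refl = N-D-disjoint root-leaf x∈ v∈

  nonroot : ∀ {x} → x ∈ N-list → x ≢ root
  nonroot x∈ = proj₁ (N⁻ x∈)

  below-v : ∀ {x z} → Below v z → S x z ≡ true → S x v ≡ false → S v x ≡ true
  below-v vz e xv with comparable e (proj₁ vz)
  ... | inj₁ e′ = ⊥-elim (contra e′ xv)
  ... | inj₂ e′ = e′

  below-v-c : ∀ {x} → S v x ≡ true → S x c ≡ false
  below-v-c e = Bool.¬-not λ e′ → contra (S-trans e e′) c-out

  p≢root : p ≢ root
  p≢root e with topmost (nonroot c∈)
  ... | t , t≢ , pt , tc = contra (subst (λ t → S t c ≡ true) (root-child root-leaf (v≢root , e) (t≢ , pt)) tc) c-out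

  pv : S p v ≡ true
  pv = child-⊆ v≢root refl p≢root

  -- Otherwise `p` and `v` would have the same trace.
  p-c : S p c ≡ true
  p-c = Bool.¬-not λ e → par≢ v≢root (same-trace p≢root
    (trans pv (sym (S-refl v≢root))) (trans e (sym c-out))
    (trans (S-trans pv (proj₁ va)) (sym (proj₁ va))) (trans (S-trans pv (proj₁ vb)) (sym (proj₁ vb))))

  -- Laminarity reduces the sixteen traces to seven: a set with `v` has `a` and `b`, and one with
  -- `c` but not `v` has neither. In Tᵃ the centre is `v`, its neighbours are `w` and `p`, the
  -- leaves at `w` are `a` and `b`, and those at `p` are `root` and `c`.
  decode : Bool → Bool → Bool → Bool → Fin 7
  decode true  true  _     _     = fs (fs fz)
  decode true  false _     _     = fz
  decode false true  _     _     = fs (fs (fs (fs (fs (fs fz)))))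
  decode false false true  true  = fs fz
  decode false false true  false = fs (fs (fs fz))
  decode false false false true  = fs (fs (fs (fs fz)))
  decode false false false false = fs (fs (fs (fs (fs fz))))

  ψ : Fin n → Fin 7
  ψ x = decode (S x v) (S x c) (S x a) (S x b)

  φ : Fin 7 → Fin n
  φ fz = v
  φ (fs fz) = w
  φ (fs (fs fz)) = p
  φ (fs (fs (fs fz))) = a
  φ (fs (fs (fs (fs fz)))) = b
  φ (fs (fs (fs (fs (fs fz))))) = root
  φ (fs (fs (fs (fs (fs (fs fz)))))) = c

  ψφ : ∀ i → ψ (φ i) ≡ i
  ψφ fz rewrite S-refl v≢root | c-out = refl
  ψφ (fs fz) rewrite w-v | w-c | w-above va | w-above vb = refl
  ψφ (fs (fs fz)) rewrite pv | p-c = refl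
  ψφ (fs (fs (fs fz))) rewrite leaf-out a∈ (leaf≢v a∈) | leaf-out a∈ (a≢c ∘ sym) | S-refl (nonroot a∈)
    | leaf-out a∈ (a≢b ∘ sym) = refl
  ψφ (fs (fs (fs (fs fz)))) rewrite leaf-out b∈ (leaf≢v b∈) | leaf-out b∈ (b≢c ∘ sym) | S-refl (nonroot b∈)
    | leaf-out b∈ a≢b = refl
  ψφ (fs (fs (fs (fs (fs fz))))) rewrite S-root v | S-root c | S-root a | S-root b = refl
  ψφ (fs (fs (fs (fs (fs (fs fz)))))) rewrite leaf-out c∈ (leaf≢v c∈) | S-refl (nonroot c∈) = refl

  φψ : ∀ x → φ (ψ x) ≡ x
  φψ x with x ≟ root
  ... | yes refl = cong φ (ψφ (fs (fs (fs (fs (fs fz))))))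
  ... | no x≢ with S x v in ev | S x c in ec
  ...   | true | true = sym (same-trace x≢ (trans ev (sym pv)) (trans ec (sym p-c))
            (trans (S-trans ev (proj₁ va)) (sym (S-trans pv (proj₁ va)))) (trans (S-trans ev (proj₁ vb)) (sym (S-trans pv (proj₁ vb)))))
  ...   | true | false = sym (same-trace x≢ (trans ev (sym (S-refl v≢root))) (trans ec (sym c-out))
            (trans (S-trans ev (proj₁ va)) (sym (proj₁ va))) (trans (S-trans ev (proj₁ vb)) (sym (proj₁ vb))))
  ...   | false | true = sym (same-trace x≢ (trans ev (sym (leaf-out c∈ (leaf≢v c∈)))) (trans ec (sym (S-refl (nonroot c∈))))
            (trans (not-at va) (sym (leaf-out c∈ a≢c))) (trans (not-at vb) (sym (leaf-out c∈ b≢c))))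
    where
      not-at : ∀ {z} → Below v z → S x z ≡ false
      not-at vz = Bool.¬-not λ e → contra ec (below-v-c (below-v vz e ev))
  ...   | false | false with S x a in ea | S x b in eb
  ...     | true | true = sym (same-trace x≢ (trans ev (sym w-v)) (trans ec (sym w-c))
              (trans ea (sym (w-above va))) (trans eb (sym (w-above vb))))
  ...     | true | false = sym (same-trace x≢ (trans ev (sym (leaf-out a∈ (leaf≢v a∈)))) (trans ec (sym (leaf-out a∈ (a≢c ∘ sym))))
              (trans ea (sym (S-refl (nonroot a∈)))) (trans eb (sym (leaf-out a∈ (a≢b ∘ sym)))))
  ...     | false | true = sym (same-trace x≢ (trans ev (sym (leaf-out b∈ (leaf≢v b∈)))) (trans ec (sym (leaf-out b∈ (b≢c ∘ sym))))
              (trans ea (sym (leaf-out b∈ a≢b))) (trans eb (sym (S-refl (nonroot b∈)))))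
  ...     | false | false = ⊥-elim (x≢ (same-trace x≢ (trans ev (sym (S-root v))) (trans ec (sym (S-root c)))
              (trans ea (sym (S-root a))) (trans eb (sym (S-root b)))))

  parent-in : ∀ {x y} → x ≢ root → S y x ≡ true → y ≢ x → S y (par x) ≡ true
  parent-in x≢ e ne = [ (λ q → ⊥-elim (ne q)) , id ]′ (S-step e)

  decoded : ∀ {q bv bc ba bb} → S q v ≡ bv → S q c ≡ bc → S q a ≡ ba → S q b ≡ bb → q ≡ φ (decode bv bc ba bb)
  decoded {q} refl refl refl refl = sym (φψ q)

  module _ {x} (x∈ : x ∈ N-list) (vx : Below v x) (w≢x : w ≢ x) where

    w-par : S w (par x) ≡ true
    w-par = parent-in (nonroot x∈) (w-above vx) w≢x

    par-v : S (par x) v ≡ false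
    par-v = Bool.¬-not λ e → contra (S-trans w-par e) w-v

    par-c : S (par x) c ≡ false
    par-c = Bool.¬-not λ e → contra (S-trans w-par e) w-c

    par-self : S (par x) x ≡ true
    par-self = child-⊆ (nonroot x∈) refl (proj₂ (in⇒≢root {w} w-par))

  w≢a : w ≢ a
  w≢a e = a≢b (sym (leaf-closed a∈ (subst (λ z → S z b ≡ true) e (w-above vb))))

  w≢b : w ≢ b
  w≢b e = a≢b (leaf-closed b∈ (subst (λ z → S z a ≡ true) e (w-above va)))

  par-a : par a ≡ w
  par-a with S (par a) b in e
  ... | true  = decoded (par-v a∈ va w≢a) (par-c a∈ va w≢a) (par-self a∈ va w≢a) e
  ... | false = ⊥-elim (par≢ (nonroot a∈) (decoded (par-v a∈ va w≢a) (par-c a∈ va w≢a) (par-self a∈ va w≢a) e))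

  par-b : par b ≡ w
  par-b with S (par b) a in e
  ... | true  = decoded (par-v b∈ vb w≢b) (par-c b∈ vb w≢b) e (par-self b∈ vb w≢b)
  ... | false = ⊥-elim (par≢ (nonroot b∈) (decoded (par-v b∈ vb w≢b) (par-c b∈ vb w≢b) e (par-self b∈ vb w≢b)))

  par-c′ : par c ≡ p
  par-c′ with S (par c) v in e
  ... | true  = decoded e par-cc refl refl
    where
      par-cc : S (par c) c ≡ true
      par-cc = child-⊆ (nonroot c∈) refl (proj₁ (in⇒≢root {par c} e))
  ... | false = ⊥-elim (par≢ (nonroot c∈) (decoded {bb = S (par c) b} e par-cc refl refl))
    where
      par-cc : S (par c) c ≡ true
      par-cc = child-⊆ (nonroot c∈) refl (proj₂ (in⇒≢root {p} (parent-in (nonroot c∈) p-c λ { refl →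
        a≢c (leaf-closed c∈ (S-trans pv (proj₁ va))) })))

  par-p : par p ≡ root
  par-p with topmost p≢root
  ... | t , t≢ , pt , tp = trans (cong par (same-trace p≢root (trans pv (sym (S-trans tp pv))) (trans p-c (sym (S-trans tp p-c)))
      (trans (S-trans pv (proj₁ va)) (sym (S-trans tp (S-trans pv (proj₁ va)))))
      (trans (S-trans pv (proj₁ vb)) (sym (S-trans tp (S-trans pv (proj₁ vb))))))) pt

  -- Since `root` is a leaf, Tᵃ is viewed here from one of its leaves and not from its centre.
  r₇ : Fin 7
  r₇ = fs (fs (fs (fs (fs fz))))

  par₇ : Fin 7 → Fin 7
  par₇ fz = fs (fs fz)
  par₇ (fs fz) = fz
  par₇ (fs (fs fz)) = r₇
  par₇ (fs (fs (fs fz))) = fs fz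
  par₇ (fs (fs (fs (fs fz)))) = fs fz
  par₇ (fs (fs (fs (fs (fs fz))))) = r₇
  par₇ (fs (fs (fs (fs (fs (fs fz)))))) = fs (fs fz)

  par-φ : ∀ i → i ≢ r₇ → φ i ≢ root × par (φ i) ≡ φ (par₇ i)
  par-φ fz _ = v≢root , refl
  par-φ (fs fz) _ = proj₁ w-child , proj₂ w-child
  par-φ (fs (fs fz)) _ = p≢root , par-p
  par-φ (fs (fs (fs fz))) _ = nonroot a∈ , par-a
  par-φ (fs (fs (fs (fs fz)))) _ = nonroot b∈ , par-b
  par-φ (fs (fs (fs (fs (fs fz))))) ne = ⊥-elim (ne refl)
  par-φ (fs (fs (fs (fs (fs (fs fz)))))) _ = nonroot c∈ , par-c′

  φ-injective : ∀ {i j} → φ i ≡ φ j → i ≡ j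
  φ-injective {i} {j} e = trans (sym (ψφ i)) (trans (cong ψ e) (ψφ j))

  adjA-par : ∀ i → i ≢ r₇ → adjA i (par₇ i) ≡ true × adjA (par₇ i) i ≡ true
  adjA-par = from-yes (all? λ i → ¬? (i ≟ r₇) →-dec ((adjA i (par₇ i) Bool.≟ true) ×-dec (adjA (par₇ i) i Bool.≟ true)))

  par-adjA : ∀ i j → adjA i j ≡ true → (i ≢ r₇ × par₇ i ≡ j) ⊎ (j ≢ r₇ × par₇ j ≡ i)
  par-adjA = from-yes (all? λ i → all? λ j → (adjA i j Bool.≟ true) →-dec
    ((¬? (i ≟ r₇) ×-dec (par₇ i ≟ j)) ⊎-dec (¬? (j ≟ r₇) ×-dec (par₇ j ≟ i))))

  adj-φ : ∀ i j → adj G (φ i) (φ j) ≡ adjA i j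
  adj-φ i j = bool-ext forth back
    where
      par-of : ∀ {i j} → φ i ≢ root → par (φ i) ≡ φ j → i ≢ r₇ × par₇ i ≡ j
      par-of ne e = i≢ , φ-injective (trans (sym (proj₂ (par-φ _ i≢))) e)
        where
          i≢ = λ { refl → ne refl }
      forth : adj G (φ i) (φ j) ≡ true → adjA i j ≡ true
      forth e with adj-par e
      ... | inj₁ (ne , q) with par-of {i} {j} ne q
      ...   | i≢ , refl = proj₁ (adjA-par i i≢)
      forth e | inj₂ (ne , q) with par-of {j} {i} ne q
      ...   | j≢ , refl = proj₂ (adjA-par j j≢)
      back : adjA i j ≡ true → adj G (φ i) (φ j) ≡ true
      back e with par-adjA i j e
      ... | inj₁ (ne , refl) with par-φ i ne
      ...   | φ≢ , q = subst (λ z → adj G (φ i) z ≡ true) q (par-adj φ≢)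
      back e | inj₂ (ne , refl) with par-φ j ne
      ...   | φ≢ , q = trans (Graph.sym G _ _) (subst (λ z → adj G (φ j) z ≡ true) q (par-adj φ≢))

  is-Ta : G ≅ Ta
  is-Ta = mk↔ₛ′ ψ φ ψφ φψ , λ x y → trans (sym (cong₂ (adj G) (φψ x) (φψ y))) (adj-φ (ψ x) (ψ y))

-- Families of paths and chords

module Families {n : ℕ} {G : Graph n} (R : Rooted G) where
  open Rooted R
  open Tree R
  open Lower R using (Separates-edges)

  chords-of : List (Path G) → List (Fin n × Fin n)
  chords-of = map ends

  family-separates : ∀ {F} → (∀ {x y} → x ≢ root → y ≢ root → x ≢ y →
    ∃[ m ] (m ∈ chords-of F × Crosses x m ≢ Crosses y m)) → SeparatesE G F
  family-separates sep e f e≢f same with lower e | lower f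
  ... | x , x≢ , ex | y , y≢ , fy with sep x≢ y≢ (λ { refl → e≢f (At-same {e} {f} ex fy) })
  ... | m , m∈ , ne with ∈-map⁻ ends m∈
  ... | P , P∈ , refl = ne (bool-ext
        (λ c → Equivalence.to (contains⇔crosses {f} y≢ fy P) (Equivalence.to (same P P∈) (Equivalence.from (contains⇔crosses {e} x≢ ex P) c)))
        (λ c → Equivalence.to (contains⇔crosses {e} x≢ ex P) (Equivalence.from (same P P∈) (Equivalence.from (contains⇔crosses {f} y≢ fy P) c))))

  family-covers : ∀ {F} → (∀ {x} → x ≢ root → ∃[ m ] (m ∈ chords-of F × Crosses x m ≡ true)) → CoversE G F
  family-covers cov e with lower e
  ... | x , x≢ , ex with cov x≢
  ... | m , m∈ , c with ∈-map⁻ ends m∈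
  ... | P , P∈ , refl = P , P∈ , Equivalence.from (contains⇔crosses {e} x≢ ex P) c

  chords-separate : ∀ {F} → SeparatesE G F → CoversE G F → Separates-edges (chords-of F)
  chords-separate {F} sep cov = record { distinct = distinct ; covered = covered }
    where
      distinct : ∀ {x y} → x ≢ root → y ≢ root → x ≢ y → ¬ (∀ {m} → m ∈ chords-of F → Crosses x m ≡ Crosses y m)
      distinct x≢ y≢ x≢y agree with edge-at x≢ | edge-at y≢
      ... | e , ex | f , fy = sep e f
            (λ { (p , q) → x≢y (At-functional {e} x≢ y≢ ex (transport {e} {f} fy (sym p) (sym q))) })
            λ P P∈ → mk⇔
              (λ c → Equivalence.from (contains⇔crosses {f} y≢ fy P) (trans (sym (agree (∈-map⁺ ends P∈)))
                       (Equivalence.to (contains⇔crosses {e} x≢ ex P) c)))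
              (λ c → Equivalence.from (contains⇔crosses {e} x≢ ex P) (trans (agree (∈-map⁺ ends P∈))
                       (Equivalence.to (contains⇔crosses {f} y≢ fy P) c)))
        where
          transport : ∀ {e f y} → f At y → Edge.eu f ≡ Edge.eu e → Edge.ev f ≡ Edge.ev e → e At y
          transport (inj₁ (a , b)) refl refl = inj₁ (a , b)
          transport (inj₂ (a , b)) refl refl = inj₂ (a , b)
      covered : ∀ {x} → x ≢ root → ∃[ m ] (m ∈ chords-of F × Crosses x m ≡ true)
      covered x≢ with edge-at x≢
      ... | e , ex with cov e
      ... | P , P∈ , c = ends P , ∈-map⁺ ends P∈ , Equivalence.to (contains⇔crosses {e} x≢ ex P) c

all-triples : ∀ {A : Set} (p : A → A → A → Bool) xs → all (λ a → all (λ b → all (p a b) xs) xs) xs ≡ true →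
  ∀ {a b c} → a ∈ xs → b ∈ xs → c ∈ xs → T (p a b c)
all-triples p xs e {a} {b} a∈ b∈ c∈ = All.lookup (All.all⁺ (p a b) xs
  (All.lookup (All.all⁺ (λ b → all (p a b) xs) xs
    (All.lookup (All.all⁺ (λ a → all (λ b → all (p a b) xs) xs) xs (subst T (sym e) tt)) a∈)) b∈)) c∈

-- The exceptional tree

module Exceptional where

  parA : Fin 7 → Fin 7
  parA fz = fz
  parA (fs fz) = fz
  parA (fs (fs fz)) = fz
  parA (fs (fs (fs fz))) = fs fz
  parA (fs (fs (fs (fs fz)))) = fs fz
  parA (fs (fs (fs (fs (fs fz))))) = fs (fs fz)
  parA (fs (fs (fs (fs (fs (fs fz)))))) = fs (fs fz)

  -- Rooted at the centre, Tᵃ has depth two, so a vertex and its parent are its only ancestors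
  -- besides the root.
  SA : Fin 7 → Fin 7 → Bool
  SA x y = not (does (x ≟ fz)) ∧ (does (x ≟ y) ∨ does (x ≟ parA y))

  nonzero? : ∀ (x : Fin 7) → Dec (x ≢ fz)
  nonzero? x = ¬? (x ≟ fz)

  rootedA : Rooted Ta
  rootedA = record
    { root = fz ; par = parA ; rank = toℕ ; S = SA
    ; S-root = λ _ → refl
    ; root-S = from-yes (all? λ x → SA x fz Bool.≟ false)
    ; S-rec = λ x {y} → from-yes (all? λ x → all? λ y → nonzero? y →-dec (SA x y Bool.≟ (does (x ≟ y) ∨ SA x (parA y)))) x y
    ; rank-< = λ {y} → from-yes (all? λ y → nonzero? y →-dec (toℕ (parA y) ℕ.<? toℕ y)) y
    ; par-adj = λ {y} → from-yes (all? λ y → nonzero? y →-dec (adjA y (parA y) Bool.≟ true)) y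
    ; adj-par = λ {u} {w} → from-yes (all? λ u → all? λ w → (adjA u w Bool.≟ true) →-dec
        ((nonzero? u ×-dec (parA u ≟ w)) ⊎-dec (nonzero? w ×-dec (parA w ≟ u)))) u w }

  open Tree rootedA
  open Families rootedA
  open Lower rootedA using (Separates-edges)

  -- A list failing a check is dropped; that none fails is confirmed when the length 4 of `family`
  -- is checked by `refl`.
  path : (vs : List (Fin 7)) → Dec (Unique vs) → Dec (IsWalk Ta vs) → List (Path Ta)
  path vs (yes u) (yes w) = mkPath vs u w ∷ []
  path vs _ _ = []

  walk? : ∀ vs → Dec (IsWalk Ta vs)
  walk? [] = no λ ()
  walk? (x ∷ []) = yes tt
  walk? (x ∷ y ∷ vs) = (adjA x y Bool.≟ true) ×-dec walk? (y ∷ vs)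

  route : List (Fin 7) → List (Path Ta)
  route vs = path vs (unique? _≟_ vs) (walk? vs)

  v₀ v₁ v₂ v₃ v₄ v₅ v₆ : Fin 7
  v₀ = fz
  v₁ = fs fz
  v₂ = fs (fs fz)
  v₃ = fs (fs (fs fz))
  v₄ = fs (fs (fs (fs fz)))
  v₅ = fs (fs (fs (fs (fs fz))))
  v₆ = fs (fs (fs (fs (fs (fs fz)))))

  -- Numbering the paths 1 to 4, the edges v₁v₃, v₁v₄, v₀v₁, v₀v₂, v₂v₅, v₂v₆ lie in the paths 13,
  -- 23, 12, 124, 14 and 2 respectively.
  family : List (Path Ta)
  family = route (v₃ ∷ v₁ ∷ v₀ ∷ v₂ ∷ v₅ ∷ []) ++ route (v₄ ∷ v₁ ∷ v₀ ∷ v₂ ∷ v₆ ∷ []) ++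
           route (v₃ ∷ v₁ ∷ v₄ ∷ []) ++ route (v₀ ∷ v₂ ∷ v₅ ∷ [])

  separates : SeparatesE Ta family
  separates = family-separates λ {x} {y} x≢ y≢ x≢y → find (from-yes (all? λ x → all? λ y → nonzero? x →-dec nonzero? y →-dec
    ¬? (x ≟ y) →-dec Any.any? (λ m → ¬? (Crosses x m Bool.≟ Crosses y m)) (chords-of family)) x y x≢ y≢ x≢y)

  covers : CoversE Ta family
  covers = family-covers λ {x} x≢ → find (from-yes (all? λ x → nonzero? x →-dec
    Any.any? (λ m → Crosses x m Bool.≟ true) (chords-of family)) x x≢)

  pairs : List (Fin 7 × Fin 7)
  pairs = concatMap (λ a → map (a ,_) (filter (λ b → toℕ a ℕ.<? toℕ b) (allFin 7))) (allFin 7)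

  -- Reversing a chord does not change what it crosses, and all one-vertex chords cross nothing, so
  -- 22 of the 49 chords suffice.
  representatives : List (Fin 7 × Fin 7)
  representatives = (v₀ , v₀) ∷ pairs

  profile : Fin 7 × Fin 7 → Vec Bool 7
  profile m = tabulate λ x → Crosses x m

  profiles : List (Vec Bool 7)
  profiles = map profile representatives

  same : Vec Bool 7 → Fin 7 × Fin 7 → Bool
  same c (i , j) = not (lookup c i xor lookup c j)

  clash : Vec Bool 7 → Vec Bool 7 → Vec Bool 7 → Bool
  clash c₁ c₂ c₃ = any (λ ij → same c₁ ij ∧ same c₂ ij ∧ same c₃ ij) pairs

  -- Evaluated over all triples of edge sets of paths.  Index 0 is the root, hence the edge in no path.
  all-clash : all (λ c₁ → all (λ c₂ → all (clash c₁ c₂) profiles) profiles) profiles ≡ true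
  all-clash = refl

  unequal : ∀ {ij} → ij ∈ pairs → proj₁ ij ≢ proj₂ ij
  unequal = All.lookup (from-yes (All.all? (λ ij → ¬? (proj₁ ij ≟ proj₂ ij)) pairs))

  represented : ∀ a b → Any.Any (λ r → ∀ x → Crosses x (a , b) ≡ Crosses x r) representatives
  represented = from-yes (all? λ a → all? λ b → Any.any? (λ r → all? λ x → Crosses x (a , b) Bool.≟ Crosses x r) representatives)

  clashes : ∀ {c₁ c₂ c₃} → c₁ ∈ profiles → c₂ ∈ profiles → c₃ ∈ profiles → T (clash c₁ c₂ c₃)
  clashes = all-triples clash profiles all-clash

  Represents : Fin 7 × Fin 7 → Fin 7 × Fin 7 → Set
  Represents r m = ∀ x → Crosses x m ≡ Crosses x r

  module _ {m₁ m₂ m₃ r₁ r₂ r₃ : Fin 7 × Fin 7} where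

    Undistinguished : Set
    Undistinguished = ∃₂ λ i j → i ≢ j × Crosses i m₁ ≡ Crosses j m₁ × Crosses i m₂ ≡ Crosses j m₂ × Crosses i m₃ ≡ Crosses j m₃

    agreeing : ∀ {m r} i j → Represents r m → T (same (profile r) (i , j)) → Crosses i m ≡ Crosses j m
    agreeing {m} {r} i j e t = trans (e i) (trans (sym (lookup∘tabulate (λ x → Crosses x r) i))
        (trans (xnor _ _ t) (trans (lookup∘tabulate (λ x → Crosses x r) j) (sym (e j)))))
      where
        xnor : ∀ a b → T (not (a xor b)) → a ≡ b
        xnor true  true  _ = refl
        xnor false false _ = refl

    collision : Represents r₁ m₁ → Represents r₂ m₂ → Represents r₃ m₃ →
      (∃ λ ij → ij ∈ pairs × T (same (profile r₁) ij ∧ same (profile r₂) ij ∧ same (profile r₃) ij)) → Undistinguished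
    collision e₁ e₂ e₃ ((i , j) , ij∈ , t) = i , j , unequal ij∈ ,
        agreeing i j e₁ (proj₁ t₁) , agreeing i j e₂ (proj₁ t₂) , agreeing i j e₃ (proj₂ t₂)
      where
        t₁ : T (same (profile r₁) (i , j)) × T (same (profile r₂) (i , j) ∧ same (profile r₃) (i , j))
        t₁ = Equivalence.to (Bool.T-∧ {same (profile r₁) (i , j)}) t
        t₂ : T (same (profile r₂) (i , j)) × T (same (profile r₃) (i , j))
        t₂ = Equivalence.to (Bool.T-∧ {same (profile r₂) (i , j)}) (proj₂ t₁)

  undistinguished : ∀ {m₁ m₂ m₃} →
    (∃ λ r → r ∈ representatives × Represents r m₁) →
    (∃ λ r → r ∈ representatives × Represents r m₂) →
    (∃ λ r → r ∈ representatives × Represents r m₃) →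
    ∃₂ λ i j → i ≢ j × Crosses i m₁ ≡ Crosses j m₁ × Crosses i m₂ ≡ Crosses j m₂ × Crosses i m₃ ≡ Crosses j m₃
  undistinguished (r₁ , r₁∈ , e₁) (r₂ , r₂∈ , e₂) (r₃ , r₃∈ , e₃) = collision e₁ e₂ e₃ (find
    (any⁻ (λ ij → same (profile r₁) ij ∧ same (profile r₂) ij ∧ same (profile r₃) ij) pairs
      (clashes (∈-map⁺ profile r₁∈) (∈-map⁺ profile r₂∈) (∈-map⁺ profile r₃∈))))

  -- A collision with index 0 violates covering, any other one separation.
  separated-by-three : ∀ {M m₁ m₂ m₃} → (∀ {m} → m ∈ M → m ∈ m₁ ∷ m₂ ∷ m₃ ∷ []) → Separates-edges M →
    ¬ (∃₂ λ i j → i ≢ j × Crosses i m₁ ≡ Crosses j m₁ × Crosses i m₂ ≡ Crosses j m₂ × Crosses i m₃ ≡ Crosses j m₃)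
  separated-by-three {M} ⊆ sep (i , j , i≢j , q₁ , q₂ , q₃) = conclude (i ≟ fz) (j ≟ fz)
    where
      open Separates-edges sep
      agree : ∀ {m} → m ∈ M → Crosses i m ≡ Crosses j m
      agree m∈ with ⊆ m∈
      ... | here refl = q₁
      ... | there (here refl) = q₂
      ... | there (there (here refl)) = q₃
      conclude : Dec (i ≡ fz) → Dec (j ≡ fz) → ⊥
      conclude (yes refl) (yes refl) = i≢j refl
      conclude (yes refl) (no j≢) = let m , m∈ , c = covered j≢ in contra c (sym (agree m∈))
      conclude (no i≢) (yes refl) = let m , m∈ , c = covered i≢ in contra c (agree m∈)
      conclude (no i≢) (no j≢) = distinct i≢ j≢ i≢j agree

  no-three : ∀ {M} m₁ m₂ m₃ → (∀ {m} → m ∈ M → m ∈ m₁ ∷ m₂ ∷ m₃ ∷ []) → ¬ Separates-edges M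
  no-three (a , b) (c , d) (e , f) ⊆ sep = separated-by-three ⊆ sep
    (undistinguished (find (represented a b)) (find (represented c d)) (find (represented e f)))

  four-needed : ∀ M → Separates-edges M → 4 ≤ length M
  four-needed [] sep = ⊥-elim (no-three (v₀ , v₀) (v₀ , v₀) (v₀ , v₀) (λ ()) sep)
  four-needed (m₁ ∷ []) sep = ⊥-elim (no-three m₁ (v₀ , v₀) (v₀ , v₀) (λ { (here e) → here e }) sep)
  four-needed (m₁ ∷ m₂ ∷ []) sep = ⊥-elim (no-three m₁ m₂ (v₀ , v₀)
    (λ { (here e) → here e ; (there (here e)) → there (here e) }) sep)
  four-needed (m₁ ∷ m₂ ∷ m₃ ∷ []) sep = ⊥-elim (no-three m₁ m₂ m₃ id sep)
  four-needed (_ ∷ _ ∷ _ ∷ _ ∷ _) _ = s≤s (s≤s (s≤s (s≤s z≤n)))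

  sp-Ta : SpStarE≡ Ta 4
  sp-Ta = (family , separates , covers , refl) , λ F sep cov →
    subst (4 ≤_) (List.length-map ends F) (four-needed (chords-of F) (chords-separate sep cov))

-- Trees in general

⌈/3⌉-≤ : ∀ {a k} → a ≤ 3 * k → ⌈ a / 3 ⌉ ≤ k
⌈/3⌉-≤ {a} {k} le = ℕ.≤-pred (DivMod.m<n*o⇒m/o<n {a + 2} {suc k} {3}
  (subst₂ _<_ (ℕ.+-comm 2 a) (cong (3 +_) (ℕ.*-comm 3 k)) (ℕ.+-monoʳ-≤ 3 le)))

≤-⌈/3⌉ : ∀ {a k} → 3 * k ≤ a + 2 → k ≤ ⌈ a / 3 ⌉
≤-⌈/3⌉ {a} {k} le = subst (_≤ (a + 2) / 3) (DivMod.m*n/n≡m k 3)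
  (DivMod./-mono-≤ {o = 3} (subst (_≤ a + 2) (ℕ.*-comm 3 k) le) ℕ.≤-refl)

⌈/2⌉-≤ : ∀ {a k} → a ≤ 2 * k → ⌈ a / 2 ⌉ ≤ k
⌈/2⌉-≤ {a} {k} le = ℕ.≤-pred (DivMod.m<n*o⇒m/o<n {a + 1} {suc k} {2}
  (subst₂ _<_ (ℕ.+-comm 1 a) (cong (2 +_) (ℕ.*-comm 2 k)) (ℕ.+-monoʳ-≤ 2 le)))

≤-⌈/2⌉ : ∀ {a k} → 2 * k ≤ a + 1 → k ≤ ⌈ a / 2 ⌉
≤-⌈/2⌉ {a} {k} le = subst (_≤ (a + 1) / 2) (DivMod.m*n/n≡m k 2)
  (DivMod./-mono-≤ {o = 2} (subst (_≤ a + 1) (ℕ.*-comm 2 k) le) ℕ.≤-refl)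

formula : ℕ → ℕ → ℕ
formula a b = ⌈ 2 * a + b / 3 ⌉ ⊔ ⌈ a + b / 2 ⌉

formula-≤ : ∀ a b {k} → 2 * a + b ≤ 3 * k → a + b ≤ 2 * k → formula a b ≤ k
formula-≤ a b p q = ℕ.⊔-lub (⌈/3⌉-≤ {2 * a + b} p) (⌈/2⌉-≤ {a + b} q)

≤-formula : ∀ a b {k} → 3 * k ≤ 2 * a + b + 2 ⊎ 2 * k ≤ a + b + 1 → k ≤ formula a b
≤-formula a b (inj₁ le) = ℕ.≤-trans (≤-⌈/3⌉ {2 * a + b} le) (ℕ.m≤m⊔n _ _)
≤-formula a b (inj₂ le) = ℕ.≤-trans (≤-⌈/2⌉ {a + b} le) (ℕ.m≤n⊔m ⌈ 2 * a + b / 3 ⌉ _)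

avoid-two : ∀ {m} (a b : Fin (3 + m)) → ∃[ y ] (y ≢ a × y ≢ b)
avoid-two a b with fz ≟ a | fz ≟ b | fs fz ≟ a | fs fz ≟ b
... | no p | no q | _ | _ = fz , p , q
... | _ | _ | no p | no q = fs fz , p , q
... | yes refl | _ | _ | yes refl = fs (fs fz) , (λ ()) , (λ ())
... | _ | yes refl | yes refl | _ = fs (fs fz) , (λ ()) , (λ ())
... | yes refl | _ | yes () | _
... | _ | yes refl | _ | yes ()

module Assembly {m : ℕ} {G : Graph (3 + m)} {r : Fin (3 + m)} (rooting : Rooting {G = G} r) (leaf : deg G r ≡ 1)
  (not-Ta : ¬ (G ≅ Ta)) where

  open Rooting rooting renaming (rooted to R)
  open Rooted R
  open Tree R
  open Chords R using (Separating; Special)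
  open Degrees R
  open Families R
  open Lower R

  r-leaf : deg G root ≡ 1
  r-leaf = trans (cong (deg G) root≡) leaf

  top-child : ∃[ t ] Child root t
  top-child with avoid-two root root
  ... | y , y≢ , _ with topmost y≢
  ... | t , t≢ , pt , _ = t , t≢ , pt

  top : Fin (3 + m)
  top = proj₁ top-child

  shape : Shape N-list D-list top
  shape = tree-shape r-leaf (proj₂ top-child) (avoid-two root top)

  some-leaf : 1 ≤ length N-list
  some-leaf = let _ , l∈ , _ = leaf-of (Shape.top≢root shape) in ∈⇒nonempty l∈

  -- A leaf below `top` is not `top`, so some special vertex tells the two apart. It cannot be that
  -- leaf, which lies in both sets.
  not-single-edge : ¬ (length N-list ≡ 1 × length D-list ≡ 0)
  not-single-edge (N≡1 , D≡0) =
      let l , l∈ , tl = leaf-of (Shape.top≢root shape)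
          z , s , d   = descends (λ e → Shape.top∉N shape (subst (_∈ N-list) (sym e) l∈)) tl
      in clash l∈ tl s d
    where
      clash : ∀ {l z} → l ∈ N-list → S top l ≡ true → Special N-list D-list z → Diff top l z ≡ true → ⊥
      clash l∈ tl (inj₁ z∈) d with singleton-≡ N≡1 z∈ l∈
      ... | refl = contra d (≡-xor (trans tl (sym (S-refl (proj₁ (N⁻ l∈))))))
      clash l∈ tl (inj₂ z∈) d = ℕ.<-irrefl (sym D≡0) (∈⇒nonempty z∈)

  spFormula-≡ : spFormula G ≡ formula (suc (length N-list)) (length D-list)
  spFormula-≡ = cong₂ formula (h₁-length r-leaf) h₂-length

  lower-bound : ∀ F → SeparatesE G F → CoversE G F → spFormula G ≤ length F
  lower-bound F sep cov = subst₂ _≤_ (sym spFormula-≡) (List.length-map ends F)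
      (formula-≤ (suc (length N-list)) (length D-list) (weights-bound shape chords) (ends-bound shape chords))
    where
      chords : Separates-edges (chords-of F)
      chords = chords-separate sep cov

  realise : List (Fin (3 + m) × Fin (3 + m)) → List (Path G)
  realise = map (λ ab → proj₁ (path-between (proj₁ ab) (proj₂ ab)))

  realise-chords : ∀ M → chords-of (realise M) ≡ M
  realise-chords [] = refl
  realise-chords ((a , b) ∷ M) = cong₂ _∷_ (proj₂ (path-between a b)) (realise-chords M)

  told-apart : ∀ {M x y} → Separating N-list D-list M → x ≢ root → x ≢ y → ∃[ k ] (k ∈ M × Crosses x k ≢ Crosses y k)
  told-apart {M} {x} {y} sep x≢ x≢y with Any.any? (λ k → ¬? (Crosses x k Bool.≟ Crosses y k)) M
  ... | yes q = find q
  ... | no nq = let z , s , d = distinguish x≢ x≢y in ⊥-elim (contra d (sep x y agree s))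
    where
      agree : ∀ {k} → k ∈ M → Diff x y (proj₁ k) ≡ Diff x y (proj₂ k)
      agree {a , b} k∈ = xor-interchange (S x a) (S x b) (S y a) (S y b)
        (decidable-stable (_ Bool.≟ _) λ ne → nq (lose k∈ ne))

  module Realised (M : List (Fin (3 + m) × Fin (3 + m))) (sep : Separating N-list D-list M) where

    on-chords : ∀ {P : Fin (3 + m) × Fin (3 + m) → Set} → ∃[ k ] (k ∈ M × P k) → ∃[ k ] (k ∈ chords-of (realise M) × P k)
    on-chords (k , k∈ , p) = k , subst (k ∈_) (sym (realise-chords M)) k∈ , p

    separates : SeparatesE G (realise M)
    separates = family-separates λ x≢ _ x≢y → on-chords (told-apart sep x≢ x≢y)

    covers : CoversE G (realise M)
    -- To differ from the empty set of `root` on a chord is to be crossed by it.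
    covers = family-covers λ {x} x≢ → on-chords (let (a , b) , k∈ , ne = told-apart {y = root} sep x≢ x≢ in
      (a , b) , k∈ , Bool.¬-not λ e → ne (trans e (sym (cong₂ _xor_ (S-root a) (S-root b)))))

  upper-bound : ∃[ M ] (Separating N-list D-list M × (3 * length M ≤ 2 * suc (length N-list) + length D-list + 2
                                                     ⊎ 2 * length M ≤ suc (length N-list) + length D-list + 1)) →
    ∃[ F ] (SeparatesE G F × CoversE G F × length F ≡ spFormula G)
  upper-bound (M , sep , size) = realise M , separates , covers ,
      ℕ.≤-antisym (subst₂ _≤_ (sym (List.length-map _ M)) (sym spFormula-≡) (≤-formula (suc (length N-list)) (length D-list) size)) (lower-bound (realise M) separates covers)
    where open Realised M sep

  sp-tree : SpStarE≡ G (spFormula G)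
  sp-tree = upper-bound (Upper.separating-chords R dfs convex
      (tree-valid r-leaf) some-leaf not-single-edge (λ like → not-Ta (Recognise.is-Ta R r-leaf like))) , lower-bound

a-leaf : ∀ {m} {G : Graph (3 + m)} → Rooted G → ∃[ r ] (deg G r ≡ 1)
a-leaf R with avoid-two (Rooted.root R) (Rooted.root R)
... | y , y≢ , _ with Degrees.leaf-below R y≢
... | l , e , none = l , Degrees.leaf-deg R (proj₂ (Tree.in⇒≢root R e)) none

sp-edgeless : ∀ {n} (G : Graph n) → ¬ Edge G → spFormula G ≡ 0 → SpStarE≡ G (spFormula G)
sp-edgeless G none eq rewrite eq = ([] , (λ e → ⊥-elim (none e)) , (λ e → ⊥-elim (none e)) , refl) , λ _ _ _ → z≤n

spFormula-single : (G : Graph 1) → spFormula G ≡ 0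
spFormula-single G rewrite irrefl G fz = refl

theorem3p3 : SpStarE≡ Ta 4
    × (∀ (n : ℕ) (T : Graph n) → IsTree T → ¬ (n ≡ 2) → ¬ (T ≅ Ta)
    → SpStarE≡ T (spFormula T))
theorem3p3 = Exceptional.sp-Ta , λ where
  0 T _ _ _ → sp-edgeless T (λ { (mkEdge () _ _ _) }) refl
  1 T _ _ _ → sp-edgeless T (λ { (mkEdge fz fz () _) }) (spFormula-single T)
  -- For the single edge the formula gives 2, while one path is enough.
  2 T _ n≢2 _ → ⊥-elim (n≢2 refl)
  -- The tree is rooted twice: first anywhere, to find a leaf, and then at that leaf.
  (suc (suc (suc m))) T tree _ T≇Ta → let r , r-leaf = a-leaf (Rooting.rooted (root-at tree fz)) in
    Assembly.sp-tree (root-at tree r) r-leaf T≇Ta
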